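{- There is an absolute constant $C$ such that for every integer $r\ge1$ the randomized online algorithm Lazy-Move-All-To-Front (LMA) satisfies the following for the Exponential Caching problem, even against adaptive-online adversaries: for every adversary that chooses each request $R_t$ (a nonempty set of cardinality at most $r$) as a function of the initial partitioning and the random choices made by LMA in steps $1,\dots,t-1$, the resulting (random) input $\mathcal I$ satisfies $\mathbf E[\mathrm{LMA}(\mathcal I)]\le C r^2\cdot \mathbf E[\mathrm{OPT}(\mathcal I)]$. In particular, LMA is $O(r^2)$-competitive.
   Context: Exponential Caching (EC): universe $U$ with $|U|=n=2^w-1$; with $[w]=\{0,\dots,w-1\}$, a partitioning $p:U\to[w]$ is valid if $|p^{ -1}(i)|=2^i$; chunks $S_i=p^{ -1}(i)$; $\mathrm{size}(p,x)=2^{p(x)}$. Input: a valid $p_0$ and nonempty sets $R_1,\dots,R_m\subseteq U$ revealed online. Upon $R_t$, an algorithm pays access cost $\min_{x\in R_t}\mathrm{size}(p_{t-1},x)$, then chooses a valid $p_t$ paying $\sum_{x:p_t(x)\ne p_{t-1}(x)}\max\{\mathrm{size}(p_{t-1},x),\mathrm{size}(p_t,x)\}$. $\mathrm{OPT}(\mathcal I)$ is the minimum total cost of an offline solution; an algorithm is $c$-competitive if there is $\xi$ with $\mathbf E[\mathrm{ALG}(\mathcal I)]\le c\,\mathrm{OPT}(\mathcal I)+\xi$ for all inputs. Algorithm LMA (does not need to know $r$) maintains a valid partitioning $p$ and budgets $b(z)$, initially $0$. Routine fetch$(z)$: if $\ell=p(z)>0$, for $i=0,\dots,\ell-1$ pick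 $a_i$ uniformly at random from $S_i$ (current chunks), then move $z$ from $S_\ell$ to $S_0$ and each $a_i$ from $S_i$ to $S_{i+1}$; in all cases set $b(z)\gets0$. On request $R$: let $x\in R$ minimize $p(x)$ and $\ell=p(x)$ (at the time of the request); pay access cost $2^\ell$; execute fetch$(x)$; for each $y\in R\setminus\{x\}$ set $b(y)\gets b(y)+2^\ell$; then while some $z$ has $b(z)\ge2^{p(z)}$, execute fetch$(z)$. The new partitioning $p_t$ is LMA's partitioning after processing $R_t$. -}

module Defs where

open import Data.Nat using (ℕ; zero; suc; _+_; _*_; _∸_; _^_; _≤_; _⊓_; _⊔_; _≡ᵇ_; _≤ᵇ_)
open import Data.Bool using (Bool; true; false; if_then_else_; _∧_; not)
open import Data.Fin using (Fin; zero; suc; toℕ)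
open import Data.Fin.Subset using (Subset; Nonempty; ∣_∣)
open import Data.Vec using (Vec; lookup; replicate; _[_]≔_; [] ; _∷_)
open import Data.List using (List; []; _∷_; filterᵇ; length; map; foldr; concatMap; allFin; _++_; [_])
import Data.List as L
import Data.Bool.ListAction
open import Data.Nat.ListAction using (sum)
open import Data.Product using (Σ; _×_; _,_; proj₁; proj₂)
open import Data.Integer using (+_)
open import Data.Rational using (ℚ; 0ℚ; _/_)
import Data.Rational as ℚ
open import Relation.Binary.PropositionalEquality using (_≡_)

-- Exponential Caching: universe U = Fin n, chunks indexed by Fin w.
-- (In the theorem n = 2 ^ w ∸ 1.)

-- A partitioning p : U → [w], represented as a vector.
Part : ℕ → ℕ → Set
Part n w = Vec (Fin w) n

chunk : ∀ {n w} → Part n w → Fin w → List (Fin n)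
chunk {n} p i = filterᵇ (λ x → toℕ (lookup p x) ≡ᵇ toℕ i) (allFin n)

Valid : ∀ {n w} → Part n w → Set
Valid {n} {w} p = (i : Fin w) → length (chunk p i) ≡ 2 ^ toℕ i

size : ∀ {n w} → Part n w → Fin n → ℕ
size p x = 2 ^ toℕ (lookup p x)

members : ∀ {n} → Subset n → List (Fin n)
members {n} R = filterᵇ (λ x → lookup R x) (allFin n)

-- minimum of a list of naturals (0 on the empty list; only used on nonempty lists)
minList : List ℕ → ℕ
minList [] = 0
minList (a ∷ as) = foldr _⊓_ a as

accessCost : ∀ {n w} → Part n w → Subset n → ℕ
accessCost p R = minList (map (size p) (members R))

_≟ᵇ_ : ∀ {w} → Fin w → Fin w → Bool
i ≟ᵇ j = toℕ i ≡ᵇ toℕ j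

moveCost : ∀ {n w} → Part n w → Part n w → ℕ
moveCost {n} p q =
  sum (map (λ x → if lookup p x ≟ᵇ lookup q x then 0 else (size p x ⊔ size q x)) (allFin n))

allVec : ∀ {w} (n : ℕ) → List (Vec (Fin w) n)
allVec zero = [ [] ]
allVec {w} (suc n) = concatMap (λ i → map (i ∷_) (allVec n)) (allFin w)

allSeqs : ∀ {n w} → ℕ → List (List (Part n w))
allSeqs zero = [ [] ]
allSeqs {n} (suc m) = concatMap (λ q → map (q ∷_) (allSeqs m)) (allVec n)

AllValid : ∀ {n w} → List (Part n w) → Set
AllValid [] = Data.Unit.Polymorphic.⊤
  where import Data.Unit.Polymorphic
AllValid (q ∷ qs) = Valid q × AllValid qs

offCost : ∀ {n w} → Part n w → List (Subset n) → List (Part n w) → ℕ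
offCost p (R ∷ Rs) (q ∷ qs) = accessCost p R + moveCost p q + offCost q Rs qs
offCost p _ _ = 0

validᵇ : ∀ {n w} → Part n w → Bool
validᵇ {n} {w} p = Data.Bool.ListAction.all (λ i → length (chunk p i) ≡ᵇ 2 ^ toℕ i) (allFin w)

allValidᵇ : ∀ {n w} → List (Part n w) → Bool
allValidᵇ [] = true
allValidᵇ (q ∷ qs) = validᵇ q ∧ allValidᵇ qs

OPT : ∀ {n w} → Part n w → List (Subset n) → ℕ
OPT {n} {w} p₀ Rs =
  minList (map (offCost p₀ Rs) (filterᵇ allValidᵇ (allSeqs {n} {w} (length Rs))))

-- Finite randomness: a computation tree whose internal nodes draw an
-- element of U uniformly at random from a given (finite) list.

data Rand (n : ℕ) (A : Set) : Set where
  ret  : A → Rand n A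
  unif : List (Fin n) → (Fin n → Rand n A) → Rand n A

_>>=_ : ∀ {n A B} → Rand n A → (A → Rand n B) → Rand n B
ret a     >>= f = f a
unif xs k >>= f = unif xs (λ x → k x >>= f)

E : ∀ {n A} → Rand n A → (A → ℚ) → ℚ
E (ret a) f = f a
E (unif [] k) f = 0ℚ
E (unif (x ∷ xs) k) f =
  foldr ℚ._+_ 0ℚ (map (λ y → E (k y) f) (x ∷ xs)) ℚ.* (+ 1 / suc (length xs))

ℕtoℚ : ℕ → ℚ
ℕtoℚ k = + k / 1

record State (n w : ℕ) : Set where
  constructor st
  field
    part   : Part n w
    budget : Vec ℕ n
open State

-- Tie-breaking rule: given the current state and a nonempty list of
-- candidates c ∷ cs (in increasing order), select the index of one of them.
-- The paper leaves the choice ("let x ∈ R minimize p(x)", "while some z …")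
-- unspecified; the theorem is quantified over all such rules.
TieBreak : ℕ → ℕ → Set
TieBreak n w = State n w → (c : Fin n) → (cs : List (Fin n)) → Fin (suc (length cs))

select : ∀ {n w} → TieBreak n w → State n w → (c : Fin n) → List (Fin n) → Fin n
select tb s c cs = L.lookup (c ∷ cs) (tb s c cs)

steps : ∀ {w} → Fin w → List (Fin w × Fin w)
steps zero = []
steps {suc (suc w)} (suc j) = (zero , suc zero) ∷ map (λ ij → (suc (proj₁ ij) , suc (proj₂ ij))) (steps j)
steps {suc zero} (suc ())

zeroOf : ∀ {w} → Fin w → Fin w
zeroOf zero = zero
zeroOf (suc _) = zero

pickAll : ∀ {n w} → Part n w → List (Fin w × Fin w) → Rand n (List (Fin n × Fin w))
pickAll p [] = ret []
pickAll p ((i , i′) ∷ rest) =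
  unif (chunk p i) (λ a → pickAll p rest >>= λ as → ret ((a , i′) ∷ as))

moveAll : ∀ {n w} → Part n w → List (Fin n × Fin w) → Part n w
moveAll p [] = p
moveAll p ((a , j) ∷ as) = moveAll (p [ a ]≔ j) as

fetch : ∀ {n w} → State n w → Fin n → Rand n (State n w × List (Fin n))
fetch (st p b) z =
  pickAll p (steps (lookup p z)) >>= λ as →
  ret (st (moveAll p as [ z ]≔ zeroOf (lookup p z)) (b [ z ]≔ 0) , map proj₁ as)

overfull : ∀ {n w} → State n w → List (Fin n)
overfull {n} (st p b) = filterᵇ (λ z → size p z ≤ᵇ lookup b z) (allFin n)

-- the while loop; each fetch strictly shrinks the set of overfull elements,
-- so n iterations of fuel always suffice
loop : ∀ {n w} → TieBreak n w → ℕ → State n w → List (Fin n) → Rand n (State n w × List (Fin n))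
loop tb zero s ch = ret (s , ch)
loop tb (suc k) s ch with overfull s
... | [] = ret (s , ch)
... | c ∷ cs = fetch s (select tb s c cs) >>= λ r → loop tb k (proj₁ r) (ch ++ proj₂ r)

addBudget : ∀ {n} → Vec ℕ n → List (Fin n) → ℕ → Vec ℕ n
addBudget b [] v = b
addBudget b (y ∷ ys) v = addBudget (b [ y ]≔ (lookup b y + v)) ys v

lmaStep : ∀ {n w} → TieBreak n w → TieBreak n w → Subset n → State n w
        → Rand n (State n w × List (Fin n) × ℕ)
lmaStep {n} tbx tbz R s with filterᵇ (λ x → size (part s) x ≡ᵇ accessCost (part s) R) (members R)
... | [] = ret (s , [] , 0)
... | c ∷ cs =
  let x = select tbx s c cs
      ℓ = toℕ (lookup (part s) x)
  in fetch s x >>= λ r →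
     let s₁ = proj₁ r
         s₂ = st (part s₁) (addBudget (budget s₁) (filterᵇ (λ y → not (toℕ y ≡ᵇ toℕ x)) (members R)) (2 ^ ℓ))
     in loop tbz n s₂ (proj₂ r) >>= λ r′ →
        ret (proj₁ r′ , proj₂ r′ , 2 ^ ℓ + moveCost (part s) (part (proj₁ r′)))

-- Adaptive-online adversary: R_t is chosen as a function of the random
-- choices made by LMA in steps 1, …, t-1 (the list of per-step choice
-- lists, in chronological order); the initial partitioning is fixed before
-- the adversary is chosen. Each request is nonempty with |R_t| ≤ r.

Adversary : ℕ → ℕ → Set
Adversary n r = List (List (Fin n)) → Σ (Subset n) (λ R → Nonempty R × ∣ R ∣ ≤ r)

run : ∀ {n w r} → TieBreak n w → TieBreak n w → Adversary n r → ℕ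
    → State n w → List (List (Fin n)) → Rand n (ℕ × List (Subset n))
run tbx tbz adv zero s h = ret (0 , [])
run tbx tbz adv (suc m) s h =
  let R = proj₁ (adv h) in
  lmaStep tbx tbz R s >>= λ r →
  run tbx tbz adv m (proj₁ r) (h ++ [ proj₁ (proj₂ r) ]) >>= λ o →
  ret (proj₂ (proj₂ r) + proj₁ o , R ∷ proj₂ o)

initState : ∀ {n w} → Part n w → State n w
initState p₀ = st p₀ (replicate _ 0)

E-LMA : ∀ {n w r} → TieBreak n w → TieBreak n w → Adversary n r → ℕ → Part n w → ℚ
E-LMA tbx tbz adv m p₀ = E (run tbx tbz adv m (initState p₀) []) (λ o → ℕtoℚ (proj₁ o))

E-OPT : ∀ {n w r} → TieBreak n w → TieBreak n w → Adversary n r → ℕ → Part n w → ℚ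
E-OPT tbx tbz adv m p₀ = E (run tbx tbz adv m (initState p₀) []) (λ o → ℕtoℚ (OPT p₀ (proj₂ o)))

{-# OPTIONS --safe #-}
module Submission where

-- LMA is charged against a potential φ. An element z at most κ levels deeper than its place in the offline solution p*
-- carries 4 b(z); one that lies deeper carries β 2^p(z) − γ b(z). Here γ, β and 2^κ are of order r. All steps but the
-- random evictions are amortised pathwise; evicting a from S_i costs β 2^(i+1), but only if p*(a) ≤ i − κ.
--
-- OPT is the optimum of the realised input, so p* may depend on later coins and an evicted element is not independent
-- of p*. Therefore, for each level i, every element gets up to κ binary counters: an eviction of z from S_i sets the
-- lowest clear counter of z, and the k-th counters of all elements are cleared after every 4^k 2^(i−4) evictions from
-- S_i. The number of clear counters k ≥ p*(z) − (i − κ) of z serves as a further potential. It pays for the eviction of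
-- an element with p*(a) ≤ i − κ; a clearing of the k-th counters matters only for the fewer than 2^(i−κ+k+1) elements
-- with p*(z) ≤ i − κ + k; and a move of p* raises it, summed over i, by a multiple of the cost of the move. What stays
-- unpaid are evictions of elements all of whose counters are set. This event does not mention p*, and an exponential
-- potential Γ of the counters shows that it is rare enough on average, whatever the adversary does.

open import Defs
open import Data.Bool using (Bool; true; false; if_then_else_; not; _∧_; T?)
import Data.Bool as 𝔹
open import Data.Bool.ListAction using (all)
open import Data.Empty using (⊥-elim)
open import Data.Fin using (Fin; zero; suc; toℕ)
open import Data.Fin.Properties using (toℕ-injective)
open import Data.Fin.Subset using (Subset; Nonempty; ∣_∣)
import Data.Integer as ℤ
import Data.Integer.Properties as ℤP
open import Data.List using (List; []; _∷_; length; map; filterᵇ; foldr; tabulate; allFin; replicate; _++_; [_])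
open import Data.List.Membership.Propositional using (_∈_; lose; find)
open import Data.List.Membership.Propositional.Properties using (∈-lookup; ∈-filter⁺; ∈-filter⁻; ∈-allFin; ∈-concatMap⁺; ∈-concatMap⁻; ∈-map⁺; ∈-map⁻)
open import Data.List.Properties using (length-replicate)
open import Data.List.Relation.Unary.All as All using (All; []; _∷_)
open import Data.List.Relation.Unary.All.Properties using (all-filter)
open import Data.List.Relation.Unary.Any using (here; there)
open import Data.Nat
import Data.Nat.ListAction as L
open import Data.Nat.Properties
open import Data.Nat.Tactic.RingSolver using (solve-∀)
open import Data.Product using (Σ; ∃-syntax; _×_; _,_; proj₁; proj₂)
open import Data.Rational using (ℚ; 0ℚ; 1ℚ)
import Data.Rational as ℚ
import Data.Rational.Properties as ℚP
import Data.Rational.Unnormalised as ℚᵘ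
import Data.Rational.Unnormalised.Properties as ℚᵘP
open import Data.Unit using (⊤; tt)
open import Data.Vec using (Vec; []; _∷_; lookup; _[_]≔_)
open import Data.Vec.Properties using (lookup∘update; lookup∘update′; lookup-replicate; []=⇒lookup)
open import Function using (_∘_; id)
open import Relation.Binary.PropositionalEquality hiding ([_])
open import Relation.Nullary using (yes; no)
open import Algebra.Bundles using (CommutativeMonoid)
open import Algebra.Properties.CommutativeSemigroup (CommutativeMonoid.commutativeSemigroup ℚP.+-0-commutativeMonoid) using (interchange)
import Algebra.Properties.Semiring.Sum +-*-semiring as Sum

-- Origin of the constants. A fetch from level `l` moves items at cost at most `3 * 2 ^ l` and
-- reserves `2 ^ l` for the tolls of its evictions: this is the `4` in `φ`. A request adds `2 ^ l`
-- for the access and deposits `2 ^ l`, at price `4` per unit, on at most `r` items, whence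
-- `γ = 5 + 4 * r`. Budgets never exceed twice the size, so `β = 2 * γ + 4` leaves `4 * 2 ^ l` in a
-- far item. The reserve suffices because an eviction from level `i` has an amortised expected toll
-- of at most `136 * β * 2 ^ (i - κ)`, and `2 ^ κ` is at least `136 * β`. The ratio is of order
-- `β * 2 ^ κ`, which is quadratic in `r`. The base `4` of the lifetimes lies between two other
-- rates. The number of items for which a clearing matters doubles with `k`, so the clearings cost a
-- geometric series of ratio 2/4 per eviction. Within one item, weights fall by the factor `8` from
-- a set counter to the next one above, so an arrival raises the potential by a geometric series of
-- ratio 4/8.

private
  variable
    n w : ℕ

-- Finite sums

infix 4 _⟦_⟧

_⟦_⟧ : ℕ → Bool → ℕ
x ⟦ b ⟧ = if b then x else 0

-- Opaque so that the summand is inferred by unification.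
opaque
  ∑ : (Fin n → ℕ) → ℕ
  ∑ = Sum.sum

  ∑-empty : (f : Fin 0 → ℕ) → ∑ f ≡ 0
  ∑-empty f = refl

  ∑-suc : (f : Fin (suc n) → ℕ) → ∑ f ≡ f zero + ∑ (f ∘ suc)
  ∑-suc f = refl

  ∑-cong : {f g : Fin n → ℕ} → (∀ z → f z ≡ g z) → ∑ f ≡ ∑ g
  ∑-cong = Sum.sum-cong-≗

  ∑-+ : (f g : Fin n → ℕ) → ∑ (λ z → f z + g z) ≡ ∑ f + ∑ g
  ∑-+ = Sum.∑-distrib-+

  ∑-comm : ∀ {m} (f : Fin m → Fin n → ℕ) → ∑ (λ i → ∑ (f i)) ≡ ∑ (λ j → ∑ (λ i → f i j))
  ∑-comm = Sum.∑-comm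

  *-distribˡ-∑ : ∀ x (f : Fin n → ℕ) → x * ∑ f ≡ ∑ (λ z → x * f z)
  *-distribˡ-∑ = Sum.*-distribˡ-sum

  ∑-mono : {f g : Fin n → ℕ} → (∀ z → f z ≤ g z) → ∑ f ≤ ∑ g
  ∑-mono {zero}  h = z≤n
  ∑-mono {suc n} h = +-mono-≤ (h zero) (∑-mono (h ∘ suc))

  ∑-const : ∀ n (c : ℕ) → ∑ {n} (λ _ → c) ≡ n * c
  ∑-const zero    c = refl
  ∑-const (suc n) c = cong (c +_) (∑-const n c)

∑-zero : {f : Fin n → ℕ} → (∀ z → f z ≡ 0) → ∑ f ≡ 0
∑-zero {n} h = trans (∑-cong h) (trans (∑-const n 0) (*-zeroʳ n))

⟦⟧-≤ : ∀ {x y} b → x ≤ y → (x ⟦ b ⟧) ≤ y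
⟦⟧-≤ true  h = h
⟦⟧-≤ false h = z≤n

⟦⟧-mono : ∀ {x y} b → x ≤ y → (x ⟦ b ⟧) ≤ (y ⟦ b ⟧)
⟦⟧-mono true  h = h
⟦⟧-mono false h = z≤n

≡ᵇ-refl : ∀ m → (m ≡ᵇ m) ≡ true
≡ᵇ-refl zero    = refl
≡ᵇ-refl (suc m) = ≡ᵇ-refl m

≡ᵇ-sound : ∀ m n → (m ≡ᵇ n) ≡ true → m ≡ n
≡ᵇ-sound m n e = ≡ᵇ⇒≡ m n (subst 𝔹.T (sym e) _)

≡ᵇ-complete : ∀ {m n} → m ≡ n → (m ≡ᵇ n) ≡ true
≡ᵇ-complete {m} refl = ≡ᵇ-refl m

≡ᵇ-false : ∀ {m n} → m ≢ n → (m ≡ᵇ n) ≡ false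
≡ᵇ-false {m} {n} ne with m ≡ᵇ n in e
... | true  = ⊥-elim (ne (≡ᵇ-sound m n e))
... | false = refl

∑-single : (a : Fin n) (c : ℕ) → ∑ {n} (λ z → c ⟦ toℕ z ≡ᵇ toℕ a ⟧) ≡ c
∑-single zero    c = trans (∑-suc _) (trans (cong (c +_) (∑-zero (λ _ → refl))) (+-identityʳ c))
∑-single (suc a) c = trans (∑-suc _) (∑-single a c)

term≤∑ : (f : Fin n → ℕ) (z : Fin n) → f z ≤ ∑ f
term≤∑ f zero    = ≤-trans (m≤m+n _ _) (≤-reflexive (sym (∑-suc f)))
term≤∑ f (suc z) = ≤-trans (≤-trans (term≤∑ (f ∘ suc) z) (m≤n+m _ _)) (≤-reflexive (sym (∑-suc f)))

-- Exchange form of a change at one index: without truncated subtraction it serves increases and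
-- decreases alike.
∑-update : (f g : Fin n → ℕ) (a : Fin n) → (∀ z → z ≢ a → f z ≡ g z) → ∑ f + g a ≡ ∑ g + f a
∑-update f g a h = trans (sym (eq f g)) (trans (∑-cong pt) (eq g f))
  where
  eq : ∀ f g → ∑ (λ z → f z + (g a ⟦ toℕ z ≡ᵇ toℕ a ⟧)) ≡ ∑ f + g a
  eq f g = trans (∑-+ f _) (cong (∑ f +_) (∑-single a (g a)))
  pt : ∀ z → f z + (g a ⟦ toℕ z ≡ᵇ toℕ a ⟧) ≡ g z + (f a ⟦ toℕ z ≡ᵇ toℕ a ⟧)
  pt z with toℕ z ≡ᵇ toℕ a in e
  ... | true  rewrite toℕ-injective (≡ᵇ-sound (toℕ z) (toℕ a) e) = +-comm (f a) (g a)
  ... | false = cong (_+ 0) (h z λ { refl → case e })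
    where
    case : (toℕ z ≡ᵇ toℕ z) ≡ false → _
    case e rewrite ≡ᵇ-refl (toℕ z) with () ← e

sum-filter-tabulate : ∀ {A : Set} {n} (P : A → Bool) (h : A → ℕ) (g : Fin n → A)
  → L.sum (map h (filterᵇ P (tabulate g))) ≡ ∑ (λ z → h (g z) ⟦ P (g z) ⟧)
sum-filter-tabulate {n = zero} P h g = sym (∑-empty _)
sum-filter-tabulate {n = suc n} P h g with P (g zero) | ∑-suc (λ z → h (g z) ⟦ P (g z) ⟧)
... | true  | e = trans (cong (h (g zero) +_) (sum-filter-tabulate P h (g ∘ suc))) (sym e)
... | false | e = trans (sum-filter-tabulate P h (g ∘ suc)) (sym e)

sum-filter : (P : Fin n → Bool) (h : Fin n → ℕ)
  → L.sum (map h (filterᵇ P (allFin n))) ≡ ∑ (λ z → h z ⟦ P z ⟧)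
sum-filter P h = sum-filter-tabulate P h id

length-as-sum : ∀ {A : Set} (xs : List A) → length xs ≡ L.sum (map (λ _ → 1) xs)
length-as-sum [] = refl
length-as-sum (x ∷ xs) = cong suc (length-as-sum xs)

length-filter : (P : Fin n → Bool) → length (filterᵇ P (allFin n)) ≡ ∑ (λ z → 1 ⟦ P z ⟧)
length-filter P = trans (length-as-sum (filterᵇ P (allFin _))) (sum-filter P _)

sum-tabulate : ∀ {A : Set} {n} (h : A → ℕ) (g : Fin n → A) → L.sum (map h (tabulate g)) ≡ ∑ (h ∘ g)
sum-tabulate {n = zero} h g = sym (∑-empty _)
sum-tabulate {n = suc n} h g = trans (cong (h (g zero) +_) (sum-tabulate h (g ∘ suc))) (sym (∑-suc (h ∘ g)))

-- Partitionings

lev : Part n w → Fin n → ℕ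
lev p z = toℕ (lookup p z)

count : Part n w → ℕ → ℕ
count p l = ∑ (λ z → 1 ⟦ lev p z ≡ᵇ l ⟧)

valid-count : (p : Part n w) → Valid p → (i : Fin w) → count p (toℕ i) ≡ 2 ^ toℕ i
valid-count p v i = trans (sym (length-filter (λ x → lev p x ≡ᵇ toℕ i))) (v i)

count-valid : (p : Part n w) → ((i : Fin w) → count p (toℕ i) ≡ 2 ^ toℕ i) → Valid p
count-valid p c i = trans (length-filter (λ x → lev p x ≡ᵇ toℕ i)) (c i)

-- Validity fixes the number of items per level, so a sum over items becomes one over levels. This
-- is all that is ever known about an offline partitioning.
∑-by-level : (p : Part n w) → Valid p → (G : ℕ → ℕ)
  → ∑ (λ z → G (lev p z)) ≡ ∑ {w} (λ l → 2 ^ toℕ l * G (toℕ l))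
∑-by-level {n} {w} p v G = begin
  ∑ (λ z → G (lev p z))
    ≡⟨ ∑-cong (λ z → sym (pick z)) ⟩
  ∑ (λ z → ∑ (λ l → G (toℕ l) * (1 ⟦ lev p z ≡ᵇ toℕ l ⟧)))
    ≡⟨ ∑-comm _ ⟩
  ∑ (λ l → ∑ (λ z → G (toℕ l) * (1 ⟦ lev p z ≡ᵇ toℕ l ⟧)))
    ≡⟨ ∑-cong (λ l → sym (*-distribˡ-∑ (G (toℕ l)) _)) ⟩
  ∑ (λ l → G (toℕ l) * count p (toℕ l))
    ≡⟨ ∑-cong (λ l → trans (cong (G (toℕ l) *_) (valid-count p v l)) (*-comm _ (2 ^ toℕ l))) ⟩
  ∑ (λ l → 2 ^ toℕ l * G (toℕ l)) ∎
  where
  open ≡-Reasoning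
  sym-≡ᵇ : ∀ m n → (m ≡ᵇ n) ≡ (n ≡ᵇ m)
  sym-≡ᵇ zero zero = refl
  sym-≡ᵇ zero (suc n) = refl
  sym-≡ᵇ (suc m) zero = refl
  sym-≡ᵇ (suc m) (suc n) = sym-≡ᵇ m n
  pt : ∀ z (l : Fin w) → G (toℕ l) * (1 ⟦ lev p z ≡ᵇ toℕ l ⟧) ≡ (G (lev p z) ⟦ toℕ l ≡ᵇ lev p z ⟧)
  pt z l rewrite sym-≡ᵇ (lev p z) (toℕ l) with toℕ l ≡ᵇ lev p z in e
  ... | true  rewrite ≡ᵇ-sound (toℕ l) (lev p z) e = *-identityʳ _
  ... | false = *-zeroʳ (G (toℕ l))
  pick : ∀ z → ∑ (λ l → G (toℕ l) * (1 ⟦ lev p z ≡ᵇ toℕ l ⟧)) ≡ G (lev p z)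
  pick z = trans (∑-cong (pt z)) (∑-single (lookup p z) (G (lev p z)))

lev-update : (p : Part n w) (a : Fin n) (j : Fin w) → lev (p [ a ]≔ j) a ≡ toℕ j
lev-update p a j = cong toℕ (lookup∘update a p j)

lev-update′ : (p : Part n w) {z a : Fin n} (j : Fin w) → z ≢ a → lev (p [ a ]≔ j) z ≡ lev p z
lev-update′ p j z≢a = cong toℕ (lookup∘update′ z≢a p j)

count-update : (p : Part n w) (a : Fin n) (j : Fin w) (l : ℕ)
  → count (p [ a ]≔ j) l + (1 ⟦ lev p a ≡ᵇ l ⟧) ≡ count p l + (1 ⟦ toℕ j ≡ᵇ l ⟧)
count-update p a j l =
  trans (∑-update (λ z → 1 ⟦ lev (p [ a ]≔ j) z ≡ᵇ l ⟧) (λ z → 1 ⟦ lev p z ≡ᵇ l ⟧) a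
           (λ z ne → cong (λ x → 1 ⟦ x ≡ᵇ l ⟧) (lev-update′ p j ne)))
        (cong (λ x → count p l + (1 ⟦ x ≡ᵇ l ⟧)) (lev-update p a j))

-- Movement cost

mv : ℕ → ℕ → ℕ
mv a b = if a ≡ᵇ b then 0 else (2 ^ a ⊔ 2 ^ b)

moveCost-∑ : (p q : Part n w) → moveCost p q ≡ ∑ (λ x → mv (lev p x) (lev q x))
moveCost-∑ p q = sum-tabulate (λ x → mv (lev p x) (lev q x)) id

mv-refl : ∀ a → mv a a ≡ 0
mv-refl a rewrite ≡ᵇ-refl a = refl

mv-≤ : ∀ a b → mv a b ≤ 2 ^ a ⊔ 2 ^ b
mv-≤ a b with a ≡ᵇ b
... | true = z≤n
... | false = ≤-refl

mv-triangle : ∀ a b c → mv a c ≤ mv a b + mv b c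
mv-triangle a b c with a ≡ᵇ b in e₁
... | true rewrite ≡ᵇ-sound a b e₁ = ≤-refl
... | false with b ≡ᵇ c in e₂
...   | true rewrite ≡ᵇ-sound b c e₂ | e₁ = m≤m+n _ _
...   | false with a ≡ᵇ c
...     | true = z≤n
...     | false = ⊔-lub (≤-trans (m≤m⊔n (2 ^ a) (2 ^ b)) (m≤m+n _ _)) (≤-trans (m≤n⊔m (2 ^ b) (2 ^ c)) (m≤n+m _ _))

moveCost-refl : (p : Part n w) → moveCost p p ≡ 0
moveCost-refl p = trans (moveCost-∑ p p) (∑-zero (λ z → mv-refl (lev p z)))

moveCost-triangle : (p q s : Part n w) → moveCost p s ≤ moveCost p q + moveCost q s
moveCost-triangle {n} p q s rewrite moveCost-∑ p q | moveCost-∑ q s | moveCost-∑ p s =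
  ≤-trans (∑-mono (λ z → mv-triangle (lev p z) (lev q z) (lev s z))) (≤-reflexive (∑-+ _ _))

moveCost-update : (p : Part n w) (a : Fin n) (j : Fin w) → moveCost p (p [ a ]≔ j) ≤ 2 ^ lev p a ⊔ 2 ^ toℕ j
moveCost-update p a j = begin
  moveCost p (p [ a ]≔ j)                  ≡⟨ moveCost-∑ p (p [ a ]≔ j) ⟩
  ∑ F                                      ≡⟨ +-identityʳ _ ⟨
  ∑ F + 0                                  ≡⟨ ∑-update F (λ _ → 0) a off ⟩
  ∑ {n = _} (λ _ → 0) + F a                ≡⟨ cong (_+ F a) (∑-zero (λ _ → refl)) ⟩
  F a                                      ≡⟨ cong (mv (lev p a)) (lev-update p a j) ⟩
  mv (lev p a) (toℕ j)                     ≤⟨ mv-≤ (lev p a) (toℕ j) ⟩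
  2 ^ lev p a ⊔ 2 ^ toℕ j                  ∎
  where
  open ≤-Reasoning
  F = λ x → mv (lev p x) (lev (p [ a ]≔ j) x)
  off : ∀ z → z ≢ a → F z ≡ 0
  off z ne = trans (cong (mv (lev p z)) (lev-update′ p j ne)) (mv-refl (lev p z))

-- Expectations

toℚᵘ-ι : ∀ a → ℚ.toℚᵘ (ℕtoℚ a) ℚᵘ.≃ ℚᵘ.mkℚᵘ (ℤ.+ a) 0
toℚᵘ-ι a = ℚP.toℚᵘ-fromℚᵘ (ℚᵘ.mkℚᵘ (ℤ.+ a) 0)

ι-+ : ∀ a b → ℕtoℚ (a + b) ≡ ℕtoℚ a ℚ.+ ℕtoℚ b
ι-+ a b = ℚP.toℚᵘ-injective (begin
  ℚ.toℚᵘ (ℕtoℚ (a + b))                              ≈⟨ toℚᵘ-ι (a + b) ⟩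
  ℚᵘ.mkℚᵘ (ℤ.+ (a + b)) 0                            ≈⟨ ℚᵘ.*≡* (cong (ℤ._* ℤ.+ 1) (sym (cong₂ ℤ._+_ (ℤP.*-identityʳ (ℤ.+ a)) (ℤP.*-identityʳ (ℤ.+ b))))) ⟩
  ℚᵘ.mkℚᵘ (ℤ.+ a) 0 ℚᵘ.+ ℚᵘ.mkℚᵘ (ℤ.+ b) 0           ≈⟨ ℚᵘP.+-cong (toℚᵘ-ι a) (toℚᵘ-ι b) ⟨
  ℚ.toℚᵘ (ℕtoℚ a) ℚᵘ.+ ℚ.toℚᵘ (ℕtoℚ b)               ≈⟨ ℚP.toℚᵘ-homo-+ (ℕtoℚ a) (ℕtoℚ b) ⟨
  ℚ.toℚᵘ (ℕtoℚ a ℚ.+ ℕtoℚ b)                         ∎)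
  where open ℚᵘP.≃-Reasoning

ι-* : ∀ a b → ℕtoℚ (a * b) ≡ ℕtoℚ a ℚ.* ℕtoℚ b
ι-* a b = ℚP.toℚᵘ-injective (begin
  ℚ.toℚᵘ (ℕtoℚ (a * b))                              ≈⟨ toℚᵘ-ι (a * b) ⟩
  ℚᵘ.mkℚᵘ (ℤ.+ (a * b)) 0                            ≈⟨ ℚᵘ.*≡* (cong (ℤ._* ℤ.+ 1) (ℤP.pos-* a b)) ⟩
  ℚᵘ.mkℚᵘ (ℤ.+ a) 0 ℚᵘ.* ℚᵘ.mkℚᵘ (ℤ.+ b) 0           ≈⟨ ℚᵘP.*-cong (toℚᵘ-ι a) (toℚᵘ-ι b) ⟨
  ℚ.toℚᵘ (ℕtoℚ a) ℚᵘ.* ℚ.toℚᵘ (ℕtoℚ b)               ≈⟨ ℚP.toℚᵘ-homo-* (ℕtoℚ a) (ℕtoℚ b) ⟨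
  ℚ.toℚᵘ (ℕtoℚ a ℚ.* ℕtoℚ b)                         ∎)
  where open ℚᵘP.≃-Reasoning

ι-mono : ∀ {a b} → a ≤ b → ℕtoℚ a ℚ.≤ ℕtoℚ b
ι-mono {a} {b} h = ℚP.toℚᵘ-cancel-≤ (begin
  ℚ.toℚᵘ (ℕtoℚ a)      ≃⟨ toℚᵘ-ι a ⟩
  ℚᵘ.mkℚᵘ (ℤ.+ a) 0    ≤⟨ ℚᵘ.*≤* (ℤP.*-monoʳ-≤-nonNeg (ℤ.+ 1) (ℤ.+≤+ h)) ⟩
  ℚᵘ.mkℚᵘ (ℤ.+ b) 0    ≃⟨ toℚᵘ-ι b ⟨
  ℚ.toℚᵘ (ℕtoℚ b)      ∎)
  where open ℚᵘP.≤-Reasoning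

ι-inverse : ∀ N → ℕtoℚ (suc N) ℚ.* (ℤ.+ 1 ℚ./ suc N) ≡ 1ℚ
ι-inverse N = ℚP.toℚᵘ-injective (begin
  ℚ.toℚᵘ (ℕtoℚ (suc N) ℚ.* (ℤ.+ 1 ℚ./ suc N))
    ≈⟨ ℚP.toℚᵘ-homo-* (ℕtoℚ (suc N)) (ℤ.+ 1 ℚ./ suc N) ⟩
  ℚ.toℚᵘ (ℕtoℚ (suc N)) ℚᵘ.* ℚ.toℚᵘ (ℤ.+ 1 ℚ./ suc N)
    ≈⟨ ℚᵘP.*-cong (toℚᵘ-ι (suc N)) (ℚP.toℚᵘ-fromℚᵘ (ℚᵘ.mkℚᵘ (ℤ.+ 1) N)) ⟩
  ℚᵘ.mkℚᵘ (ℤ.+ suc N) 0 ℚᵘ.* ℚᵘ.mkℚᵘ (ℤ.+ 1) N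
    ≈⟨ ℚᵘ.*≡* (cong ℤ.+_ (trans (*-identityʳ _) (trans (*-identityʳ (suc N)) (sym (trans (*-identityˡ _) (*-identityˡ _)))))) ⟩
  ℚᵘ.1ℚᵘ ∎)
  where open ℚᵘP.≃-Reasoning

E-bind : {A B : Set} (t : Rand n A) (k : A → Rand n B) (f : B → ℚ) → E (t >>= k) f ≡ E t (λ a → E (k a) f)
E-bind (ret a) k f = refl
E-bind (unif [] c) k f = refl
E-bind (unif (x ∷ xs) c) k f = cong (ℚ._* (ℤ.+ 1 ℚ./ suc (length xs)))
  (cong (foldr ℚ._+_ 0ℚ) (cong₂ _∷_ (E-bind (c x) k f) (go xs)))
  where
  go : ∀ ys → map (λ y → E (c y >>= k) f) ys ≡ map (λ y → E (c y) (λ a → E (k a) f)) ys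
  go [] = refl
  go (y ∷ ys) = cong₂ _∷_ (E-bind (c y) k f) (go ys)

-- Restricted to combinations without a constant term, because a draw from an empty list has
-- expectation `0` whatever the integrand is.
E-linear : {A : Set} (t : Rand n A) (f g : A → ℚ) (a b : ℚ)
  → E t (λ o → a ℚ.* f o ℚ.+ b ℚ.* g o) ≡ a ℚ.* E t f ℚ.+ b ℚ.* E t g
E-linear (ret o) f g a b = refl
E-linear (unif [] k) f g a b = sym (trans (cong₂ ℚ._+_ (ℚP.*-zeroʳ a) (ℚP.*-zeroʳ b)) (ℚP.+-identityʳ 0ℚ))
E-linear (unif (x ∷ xs) k) f g a b =
  trans (cong (ℚ._* c) (go (x ∷ xs)))
    (trans (ℚP.*-distribʳ-+ c (a ℚ.* total f (x ∷ xs)) (b ℚ.* total g (x ∷ xs)))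
      (cong₂ ℚ._+_ (ℚP.*-assoc a (total f (x ∷ xs)) c) (ℚP.*-assoc b (total g (x ∷ xs)) c)))
  where
  c = ℤ.+ 1 ℚ./ suc (length xs)
  total : (_ → ℚ) → List (Fin _) → ℚ
  total h ys = foldr ℚ._+_ 0ℚ (map (λ y → E (k y) h) ys)
  go : ∀ ys → total (λ o → a ℚ.* f o ℚ.+ b ℚ.* g o) ys ≡ a ℚ.* total f ys ℚ.+ b ℚ.* total g ys
  go [] = sym (trans (cong₂ ℚ._+_ (ℚP.*-zeroʳ a) (ℚP.*-zeroʳ b)) (ℚP.+-identityʳ 0ℚ))
  go (y ∷ ys) = begin
    E (k y) (λ o → a ℚ.* f o ℚ.+ b ℚ.* g o) ℚ.+ total _ ys
      ≡⟨ cong₂ ℚ._+_ (E-linear (k y) f g a b) (go ys) ⟩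
    (a ℚ.* E (k y) f ℚ.+ b ℚ.* E (k y) g) ℚ.+ (a ℚ.* total f ys ℚ.+ b ℚ.* total g ys)
      ≡⟨ interchange (a ℚ.* E (k y) f) _ _ _ ⟩
    (a ℚ.* E (k y) f ℚ.+ a ℚ.* total f ys) ℚ.+ (b ℚ.* E (k y) g ℚ.+ b ℚ.* total g ys)
      ≡⟨ cong₂ ℚ._+_ (ℚP.*-distribˡ-+ a _ _) (ℚP.*-distribˡ-+ b _ _) ⟨
    a ℚ.* total f (y ∷ ys) ℚ.+ b ℚ.* total g (y ∷ ys) ∎
    where
    open ≡-Reasoning

-- Averaging principle: the bounds `h` may vary with the draw, only their mean has to be at most
-- `M`. `P` carries what is known about drawn items, and nonemptiness excludes the default
-- expectation `0`.
E-unif : {A : Set} (xs : List (Fin n)) (k : Fin n → Rand n A) (F : A → ℚ) (P : Fin n → Set) (h : Fin n → ℕ) (T M : ℕ)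
  → 1 ≤ length xs → All P xs
  → (∀ y → P y → E (k y) F ℚ.+ ℕtoℚ T ℚ.≤ ℕtoℚ (h y))
  → L.sum (map h xs) ≤ length xs * M
  → E (unif xs k) F ℚ.+ ℕtoℚ T ℚ.≤ ℕtoℚ M
E-unif {n = n} xs₀@(x ∷ xs) k F P h T M _ all bound avg = begin
  total xs₀ ℚ.* c ℚ.+ ℕtoℚ T
    ≡⟨ cong (total xs₀ ℚ.* c ℚ.+_) (sym (cancel T)) ⟩
  total xs₀ ℚ.* c ℚ.+ ℕtoℚ (N * T) ℚ.* c
    ≡⟨ ℚP.*-distribʳ-+ c (total xs₀) (ℕtoℚ (N * T)) ⟨
  (total xs₀ ℚ.+ ℕtoℚ (N * T)) ℚ.* c
    ≤⟨ ℚP.*-monoʳ-≤-nonNeg c {{c≥0}} (ℚP.≤-trans (go xs₀ all) (ι-mono avg)) ⟩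
  ℕtoℚ (N * M) ℚ.* c
    ≡⟨ cancel M ⟩
  ℕtoℚ M ∎
  where
  open ℚP.≤-Reasoning
  N = suc (length xs)
  c = ℤ.+ 1 ℚ./ N
  c≥0 : ℚ.NonNegative c
  c≥0 = ℚP.normalize-nonNeg 1 N
  total : List (Fin n) → ℚ
  total ys = foldr ℚ._+_ 0ℚ (map (λ y → E (k y) F) ys)
  cancel : ∀ m → ℕtoℚ (N * m) ℚ.* c ≡ ℕtoℚ m
  cancel m = trans (cong (ℚ._* c) (trans (cong ℕtoℚ (*-comm N m)) (ι-* m N)))
    (trans (ℚP.*-assoc (ℕtoℚ m) (ℕtoℚ N) c) (trans (cong (ℕtoℚ m ℚ.*_) (ι-inverse (length xs))) (ℚP.*-identityʳ (ℕtoℚ m))))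
  go : ∀ ys → All P ys → total ys ℚ.+ ℕtoℚ (length ys * T) ℚ.≤ ℕtoℚ (L.sum (map h ys))
  go [] [] = ℚP.≤-reflexive (ℚP.+-identityʳ 0ℚ)
  go (y ∷ ys) (py ∷ pys) = begin
    (E (k y) F ℚ.+ total ys) ℚ.+ ℕtoℚ (T + length ys * T)
      ≡⟨ cong ((E (k y) F ℚ.+ total ys) ℚ.+_) (ι-+ T (length ys * T)) ⟩
    (E (k y) F ℚ.+ total ys) ℚ.+ (ℕtoℚ T ℚ.+ ℕtoℚ (length ys * T))
      ≡⟨ interchange (E (k y) F) _ _ _ ⟩
    (E (k y) F ℚ.+ ℕtoℚ T) ℚ.+ (total ys ℚ.+ ℕtoℚ (length ys * T))
      ≤⟨ ℚP.+-mono-≤ (bound y py) (go ys pys) ⟩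
    ℕtoℚ (h y) ℚ.+ ℕtoℚ (L.sum (map h ys))
      ≡⟨ ι-+ (h y) _ ⟨
    ℕtoℚ (h y + L.sum (map h ys)) ∎

ι-cancel : ∀ x a b c → x ℚ.+ ℕtoℚ (a + c) ℚ.≤ ℕtoℚ (b + c) → x ℚ.+ ℕtoℚ a ℚ.≤ ℕtoℚ b
ι-cancel x a b c h = ℚP.≤-trans (ℚP.≤-reflexive (sym (undo (x ℚ.+ ℕtoℚ a))))
  (ℚP.≤-trans (ℚP.+-monoˡ-≤ (ℚ.- ℕtoℚ c) h′) (ℚP.≤-reflexive (undo (ℕtoℚ b))))
  where
  undo : ∀ y → y ℚ.+ ℕtoℚ c ℚ.+ (ℚ.- ℕtoℚ c) ≡ y
  undo y = trans (ℚP.+-assoc y _ _) (trans (cong (y ℚ.+_) (ℚP.+-inverseʳ (ℕtoℚ c))) (ℚP.+-identityʳ y))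
  h′ : x ℚ.+ ℕtoℚ a ℚ.+ ℕtoℚ c ℚ.≤ ℕtoℚ b ℚ.+ ℕtoℚ c
  h′ = subst₂ ℚ._≤_ (trans (cong (x ℚ.+_) (ι-+ a c)) (sym (ℚP.+-assoc x _ _))) (ι-+ b c) h

ι-weaken : ∀ x {y a b} → a ≤ b → x ℚ.+ ℕtoℚ b ℚ.≤ y → x ℚ.+ ℕtoℚ a ℚ.≤ y
ι-weaken x h = ℚP.≤-trans (ℚP.+-monoʳ-≤ x (ι-mono h))

E-bind-≤ : {A B : Set} (t : Rand n A) (k : A → Rand n B) (f : B → ℚ) (T : ℕ) {y : ℚ}
  → E t (λ a → E (k a) f) ℚ.+ ℕtoℚ T ℚ.≤ y → E (t >>= k) f ℚ.+ ℕtoℚ T ℚ.≤ y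
E-bind-≤ t k f T h = ℚP.≤-trans (ℚP.≤-reflexive (cong (ℚ._+ ℕtoℚ T) (E-bind t k f))) h

-- The counters of a single element

-- A list of counters starts with counter 0, and ρ k is the time left until the k-th counters are cleared.

pop : List Bool → ℕ
pop []           = 0
pop (true  ∷ cs) = suc (pop cs)
pop (false ∷ cs) = pop cs

-- Each set counter contributes its remaining lifetime, weighted exponentially in the number of set counters above it:
-- this makes the decay per step, rate, proportional to the gain 2 q 8^pop of an arrival (8^pop≤rate).
pot : List Bool → (ℕ → ℕ) → ℕ
pot []           ρ = 0
pot (true  ∷ cs) ρ = ρ 0 * 8 ^ pop cs + pot cs (ρ ∘ suc)
pot (false ∷ cs) ρ = pot cs (ρ ∘ suc)

rate : List Bool → ℕ
rate []           = 0
rate (true  ∷ cs) = 8 ^ pop cs + rate cs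
rate (false ∷ cs) = rate cs

expire : List Bool → (ℕ → ℕ) → List Bool
expire []       ρ = []
expire (c ∷ cs) ρ = (c ∧ not (ρ 0 ≡ᵇ 1)) ∷ expire cs (ρ ∘ suc)

tick : (P ρ : ℕ → ℕ) → ℕ → ℕ
tick P ρ k = if ρ k ≡ᵇ 1 then P k else ρ k ∸ 1

inc : List Bool → List Bool
inc []           = []
inc (true  ∷ cs) = true ∷ inc cs
inc (false ∷ cs) = true ∷ cs

full : List Bool → Bool
full []           = true
full (true  ∷ cs) = full cs
full (false ∷ cs) = false

zeros : ℕ → List Bool → ℕ
zeros d       []       = 0
zeros zero    (c ∷ cs) = (1 ⟦ not c ⟧) + zeros zero cs
zeros (suc d) (c ∷ cs) = zeros d cs

length-expire : ∀ cs ρ → length (expire cs ρ) ≡ length cs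
length-expire []       ρ = refl
length-expire (c ∷ cs) ρ = cong suc (length-expire cs (ρ ∘ suc))

length-inc : ∀ cs → length (inc cs) ≡ length cs
length-inc []           = refl
length-inc (true  ∷ cs) = cong suc (length-inc cs)
length-inc (false ∷ cs) = refl

pop-expire : ∀ cs ρ → pop (expire cs ρ) ≤ pop cs
pop-expire [] ρ = z≤n
pop-expire (true ∷ cs) ρ with ρ 0 ≡ᵇ 1
... | true  = m≤n⇒m≤1+n (pop-expire cs (ρ ∘ suc))
... | false = s≤s (pop-expire cs (ρ ∘ suc))
pop-expire (false ∷ cs) ρ = pop-expire cs (ρ ∘ suc)

rate-expire : ∀ cs ρ → rate (expire cs ρ) ≤ rate cs
rate-expire [] ρ = z≤n
rate-expire (true ∷ cs) ρ with ρ 0 ≡ᵇ 1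
... | true  = ≤-trans (rate-expire cs (ρ ∘ suc)) (m≤n+m _ _)
... | false = +-mono-≤ (^-monoʳ-≤ 8 (pop-expire cs (ρ ∘ suc))) (rate-expire cs (ρ ∘ suc))
rate-expire (false ∷ cs) ρ = rate-expire cs (ρ ∘ suc)

-- A set counter that ages by one loses its weight. One that expires loses its last unit of
-- lifetime, and its clearing can only lower the weights of the counters below.
pot-tick : ∀ cs P ρ → (∀ k → 1 ≤ ρ k) → pot (expire cs ρ) (tick P ρ) + rate cs ≤ pot cs ρ
pot-tick [] P ρ pos = z≤n
pot-tick (false ∷ cs) P ρ pos = pot-tick cs (P ∘ suc) (ρ ∘ suc) (pos ∘ suc)
pot-tick (true ∷ cs) P ρ pos with ρ 0 ≡ᵇ 1 in e
... | true = begin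
  X + (A + R)              ≡⟨ lem X A R ⟩
  1 * A + (X + R)          ≤⟨ +-mono-≤ (*-monoˡ-≤ A (pos 0)) (pot-tick cs (P ∘ suc) (ρ ∘ suc) (pos ∘ suc)) ⟩
  ρ 0 * A + pot cs (ρ ∘ suc) ∎
  where
  open ≤-Reasoning
  X = pot (expire cs (ρ ∘ suc)) (tick P ρ ∘ suc)
  A = 8 ^ pop cs
  R = rate cs
  lem : ∀ X A R → X + (A + R) ≡ 1 * A + (X + R)
  lem = solve-∀
... | false = begin
  tick P ρ 0 * 8 ^ pop (expire cs (ρ ∘ suc)) + X + (A + R)
    ≡⟨ cong (λ b → (if b then P 0 else m) * 8 ^ pop (expire cs (ρ ∘ suc)) + X + (A + R)) e ⟩
  m * 8 ^ pop (expire cs (ρ ∘ suc)) + X + (A + R)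
    ≤⟨ +-monoˡ-≤ (A + R) (+-monoˡ-≤ X (*-monoʳ-≤ m (^-monoʳ-≤ 8 (pop-expire cs (ρ ∘ suc))))) ⟩
  m * A + X + (A + R)
    ≡⟨ lem m A X R ⟩
  suc m * A + (X + R)
    ≤⟨ +-mono-≤ (≤-reflexive (cong (_* A) (m+[n∸m]≡n (pos 0)))) (pot-tick cs (P ∘ suc) (ρ ∘ suc) (pos ∘ suc)) ⟩
  ρ 0 * A + pot cs (ρ ∘ suc) ∎
  where
  open ≤-Reasoning
  m = ρ 0 ∸ 1
  X = pot (expire cs (ρ ∘ suc)) (tick P ρ ∘ suc)
  A = 8 ^ pop cs
  R = rate cs
  lem : ∀ m A X R → m * A + X + (A + R) ≡ suc m * A + (X + R)
  lem = solve-∀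

full-inc : ∀ cs → full cs ≡ true → inc cs ≡ cs
full-inc []          _ = refl
full-inc (true ∷ cs) e = cong (true ∷_) (full-inc cs e)

full-pop : ∀ cs → full cs ≡ true → pop cs ≡ length cs
full-pop []          _ = refl
full-pop (true ∷ cs) e = cong suc (full-pop cs e)

pop-inc : ∀ cs → full cs ≡ false → pop (inc cs) ≡ suc (pop cs)
pop-inc (true  ∷ cs) e = cong suc (pop-inc cs e)
pop-inc (false ∷ cs) e = refl

4^-shift : ∀ k q → 4 ^ suc k * q ≡ 4 ^ k * (4 * q)
4^-shift k q = trans (cong (_* q) (*-comm 4 (4 ^ k))) (*-assoc (4 ^ k) 4 q)

-- Setting the lowest clear counter multiplies the weights of the set block below it by `8`. Since
-- lifetimes grow by `4` while weights fall by `8`, the increments halve from one counter to the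
-- next and sum to at most twice `q * 8 ^ pop cs`.
pot-inc′ : ∀ cs ρ q → (∀ k → ρ k ≤ 4 ^ k * q) → full cs ≡ false
  → pot (inc cs) ρ ≤ pot cs ρ + 2 * q * 8 ^ pop cs
pot-inc′ (false ∷ cs) ρ q up e = begin
  ρ 0 * A + X     ≤⟨ +-monoˡ-≤ X (*-monoˡ-≤ A (≤-trans (up 0) (≤-trans (≤-reflexive (*-identityˡ q)) (m≤n*m q 2)))) ⟩
  2 * q * A + X   ≡⟨ +-comm _ X ⟩
  X + 2 * q * A   ∎
  where
  open ≤-Reasoning
  A = 8 ^ pop cs
  X = pot cs (ρ ∘ suc)
pot-inc′ (true ∷ cs) ρ q up e rewrite pop-inc cs e = begin
  ρ 0 * (8 * A) + pot (inc cs) (ρ ∘ suc)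
    ≤⟨ +-monoʳ-≤ (ρ 0 * (8 * A)) (pot-inc′ cs (ρ ∘ suc) (4 * q) (λ k → ≤-trans (up (suc k)) (≤-reflexive (4^-shift k q))) e) ⟩
  ρ 0 * (8 * A) + (X + 2 * (4 * q) * A)
    ≡⟨ lem₁ (ρ 0) A X q ⟩
  ρ 0 * A + X + 2 * (4 * q) * A + ρ 0 * (7 * A)
    -- Rounding `7` up to `8` gives `8 * q * A` from the head and the same from the tail, together
    -- the required `2 * q * (8 * A)`.
    ≤⟨ +-monoʳ-≤ (ρ 0 * A + X + 2 * (4 * q) * A) (*-mono-≤ (≤-trans (up 0) (≤-reflexive (*-identityˡ q))) (*-monoˡ-≤ A (n≤1+n 7))) ⟩
  ρ 0 * A + X + 2 * (4 * q) * A + q * (8 * A)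
    ≡⟨ lem₂ (ρ 0) A X q ⟩
  ρ 0 * A + X + 2 * q * (8 * A) ∎
  where
  open ≤-Reasoning
  A = 8 ^ pop cs
  X = pot cs (ρ ∘ suc)
  lem₁ : ∀ r A X q → r * (8 * A) + (X + 2 * (4 * q) * A) ≡ r * A + X + 2 * (4 * q) * A + r * (7 * A)
  lem₁ = solve-∀
  lem₂ : ∀ r A X q → r * A + X + 2 * (4 * q) * A + q * (8 * A) ≡ r * A + X + 2 * q * (8 * A)
  lem₂ = solve-∀

-- The lowest set counter has all the others above it and contributes `8 ^ (pop cs - 1)`; the `1` is
-- for the case that no counter is set.
8^pop≤rate : ∀ cs → 8 ^ pop cs ≤ 8 * rate cs + 1
8^pop≤rate []           = ≤-refl
8^pop≤rate (false ∷ cs) = 8^pop≤rate cs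
8^pop≤rate (true  ∷ cs) = ≤-trans (*-monoʳ-≤ 8 (m≤m+n (8 ^ pop cs) (rate cs))) (m≤m+n _ 1)

-- On a full list the arrival changes nothing, but its allowance `2 * q * 8 ^ length cs` is granted
-- all the same. This surplus pays for a lost eviction.
pot-inc : ∀ cs ρ q → (∀ k → ρ k ≤ 4 ^ k * q)
  → pot (inc cs) ρ + (2 * q * 8 ^ length cs ⟦ full cs ⟧) ≤ pot cs ρ + (16 * q * rate cs + 2 * q)
pot-inc cs ρ q up = ≤-trans step (+-monoʳ-≤ (pot cs ρ) (≤-trans (*-monoʳ-≤ (2 * q) (8^pop≤rate cs)) (≤-reflexive (lem q (rate cs)))))
  where
  lem : ∀ q r → 2 * q * (8 * r + 1) ≡ 16 * q * r + 2 * q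
  lem = solve-∀
  step : pot (inc cs) ρ + (2 * q * 8 ^ length cs ⟦ full cs ⟧) ≤ pot cs ρ + 2 * q * 8 ^ pop cs
  step with full cs in e
  ... | true  rewrite full-inc cs e | full-pop cs e = ≤-refl
  ... | false = ≤-trans (≤-reflexive (+-identityʳ _)) (pot-inc′ cs ρ q up e)

zeros-inc : ∀ d cs → zeros d (inc cs) ≤ zeros d cs
zeros-inc d       []           = z≤n
zeros-inc zero    (true  ∷ cs) = zeros-inc zero cs
zeros-inc zero    (false ∷ cs) = n≤1+n _
zeros-inc (suc d) (true  ∷ cs) = zeros-inc d cs
zeros-inc (suc d) (false ∷ cs) = ≤-refl

zeros-gain : ∀ cs → full cs ≡ false → zeros 0 (inc cs) + 1 ≡ zeros 0 cs
zeros-gain (true  ∷ cs) e = zeros-gain cs e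
zeros-gain (false ∷ cs) e = +-comm _ 1

-- Each counter between the two thresholds adds at most one.
zeros-move : ∀ d d′ cs → zeros d′ cs ≤ zeros d cs + (d ∸ d′)
zeros-move d       d′       []       = z≤n
zeros-move d       zero     (c ∷ cs) with d
... | zero  = m≤m+n _ _
... | suc d = ≤-trans (+-mono-≤ (⟦⟧-≤ (not c) ≤-refl) (zeros-move d zero cs)) (≤-reflexive (sym (+-suc (zeros d cs) d)))
zeros-move zero    (suc d′) (c ∷ cs) =
  ≤-trans (≤-trans (zeros-move zero d′ cs) (+-monoʳ-≤ (zeros zero cs) (≤-reflexive (0∸n≡0 d′))))
          (+-monoˡ-≤ 0 (m≤n+m (zeros zero cs) _))
zeros-move (suc d) (suc d′) (c ∷ cs) = zeros-move d d′ cs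

zeros-initial : ∀ d J → J ≤ d → zeros d (replicate J false) ≡ 0
zeros-initial d       zero    _       = refl
zeros-initial (suc d) (suc J) (s≤s h) = zeros-initial d J h

pot-initial : ∀ J ρ → pot (replicate J false) ρ ≡ 0
pot-initial zero    ρ = refl
pot-initial (suc J) ρ = pot-initial J (ρ ∘ suc)

-- The price of clearing counters

ticks : (K d : ℕ) → (ℕ → ℕ) → ℕ
ticks zero    d       ρ = 0
ticks (suc K) zero    ρ = (1 ⟦ ρ 0 ≡ᵇ 1 ⟧) + ticks K zero (ρ ∘ suc)
ticks (suc K) (suc d) ρ = ticks K d (ρ ∘ suc)

-- The weight `2 ^ k` stands, up to the factor `2 ^ suc u`, for the number of items at levels up to
-- `u + k`, to which a clearing of the k-th counters matters.
charge : ℕ → (ℕ → ℕ) → ℕ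
charge zero    ρ = 0
charge (suc K) ρ = (1 ⟦ ρ 0 ≡ᵇ 1 ⟧) + 2 * charge K (ρ ∘ suc)

zeros-expire : ∀ K d cs ρ → length cs ≤ K → zeros d (expire cs ρ) ≤ zeros d cs + ticks K d ρ
zeros-expire K       d       []       ρ _ = z≤n
zeros-expire (suc K) (suc d) (c ∷ cs) ρ (s≤s h) = zeros-expire K d cs (ρ ∘ suc) h
zeros-expire (suc K) zero    (c ∷ cs) ρ (s≤s h) =
  ≤-trans (+-mono-≤ (head c (ρ 0 ≡ᵇ 1)) (zeros-expire K zero cs (ρ ∘ suc) h))
          (≤-reflexive (lem (1 ⟦ not c ⟧) _ _ _))
  where
  lem : ∀ a b x y → (a + b) + (x + y) ≡ (a + x) + (b + y)
  lem = solve-∀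
  head : ∀ c e → (1 ⟦ not (c ∧ not e) ⟧) ≤ (1 ⟦ not c ⟧) + (1 ⟦ e ⟧)
  head true  true  = ≤-refl
  head true  false = ≤-refl
  head false e     = s≤s z≤n

-- Levels `0` to `k` hold `2 ^ suc k - 1` items. The extra `ticks K 0 ρ` plays the missing item and
-- lets the induction close.
∑-ticks₀ : ∀ w K ρ → ∑ {w} (λ l → 2 ^ toℕ l * ticks K (toℕ l) ρ) + ticks K 0 ρ ≤ 2 * charge K ρ
∑-ticks₀ w zero ρ = ≤-reflexive (trans (+-identityʳ _) (∑-zero {w} (λ l → *-zeroʳ (2 ^ toℕ l))))
∑-ticks₀ zero (suc K) ρ = begin
  ∑ F + (t + ticks K 0 (ρ ∘ suc))   ≡⟨ cong (_+ (t + ticks K 0 (ρ ∘ suc))) (∑-empty F) ⟩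
  t + ticks K 0 (ρ ∘ suc)           ≤⟨ +-monoʳ-≤ t (≤-trans (m≤n+m _ _) (∑-ticks₀ zero K (ρ ∘ suc))) ⟩
  t + 2 * charge K (ρ ∘ suc)        ≤⟨ m≤n*m _ 2 ⟩
  2 * (t + 2 * charge K (ρ ∘ suc))  ∎
  where
  open ≤-Reasoning
  t = 1 ⟦ ρ 0 ≡ᵇ 1 ⟧
  F = λ (l : Fin 0) → 2 ^ toℕ l * ticks (suc K) (toℕ l) ρ
∑-ticks₀ (suc w) (suc K) ρ = begin
  ∑ F + (t + T)                      ≡⟨ cong (_+ (t + T)) (∑-suc F) ⟩
  1 * (t + T) + ∑ (F ∘ suc) + (t + T) ≡⟨ cong (λ x → 1 * (t + T) + x + (t + T)) (trans (∑-cong (λ l → *-assoc 2 (2 ^ toℕ l) (ticks K (toℕ l) (ρ ∘ suc)))) (sym (*-distribˡ-∑ 2 _))) ⟩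
  1 * (t + T) + 2 * ∑ G + (t + T)    ≡⟨ lem t T (∑ G) ⟩
  2 * t + 2 * (∑ G + T)              ≤⟨ +-monoʳ-≤ (2 * t) (*-monoʳ-≤ 2 (∑-ticks₀ w K (ρ ∘ suc))) ⟩
  2 * t + 2 * (2 * charge K (ρ ∘ suc)) ≡⟨ *-distribˡ-+ 2 t _ ⟨
  2 * (t + 2 * charge K (ρ ∘ suc))   ∎
  where
  open ≤-Reasoning
  t = 1 ⟦ ρ 0 ≡ᵇ 1 ⟧
  T = ticks K 0 (ρ ∘ suc)
  F = λ (l : Fin (suc w)) → 2 ^ toℕ l * ticks (suc K) (toℕ l) ρ
  G = λ (l : Fin w) → 2 ^ toℕ l * ticks K (toℕ l) (ρ ∘ suc)
  lem : ∀ t T g → 1 * (t + T) + 2 * g + (t + T) ≡ 2 * t + 2 * (g + T)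
  lem = solve-∀

-- Level `0` has threshold `0` and splits off, while all other levels are twice as large as for `u`.
-- Again the extra term turns this into an exact doubling.
∑-ticks′ : ∀ u w K ρ → ∑ {w} (λ l → 2 ^ toℕ l * ticks K (toℕ l ∸ u) ρ) + ticks K 0 ρ ≤ 2 ^ suc u * charge K ρ
∑-ticks′ zero    w       K ρ = ∑-ticks₀ w K ρ
∑-ticks′ (suc u) zero    K ρ = begin
  ∑ F + ticks K 0 ρ             ≡⟨ cong (_+ ticks K 0 ρ) (trans (∑-empty F) (sym (∑-empty G))) ⟩
  ∑ G + ticks K 0 ρ             ≤⟨ ∑-ticks′ u zero K ρ ⟩
  2 ^ suc u * charge K ρ        ≤⟨ *-monoˡ-≤ (charge K ρ) (m≤n*m (2 ^ suc u) 2) ⟩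
  2 ^ suc (suc u) * charge K ρ  ∎
  where
  open ≤-Reasoning
  F = λ (l : Fin 0) → 2 ^ toℕ l * ticks K (toℕ l ∸ suc u) ρ
  G = λ (l : Fin 0) → 2 ^ toℕ l * ticks K (toℕ l ∸ u) ρ
∑-ticks′ (suc u) (suc w) K ρ = begin
  ∑ F + T                       ≡⟨ cong (_+ T) (∑-suc F) ⟩
  1 * T + ∑ (F ∘ suc) + T       ≡⟨ cong (λ x → 1 * T + x + T) (trans (∑-cong (λ l → *-assoc 2 (2 ^ toℕ l) (ticks K (toℕ l ∸ u) ρ))) (sym (*-distribˡ-∑ 2 _))) ⟩
  1 * T + 2 * ∑ G + T           ≡⟨ lem T (∑ G) ⟩
  2 * (∑ G + T)                 ≤⟨ *-monoʳ-≤ 2 (∑-ticks′ u w K ρ) ⟩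
  2 * (2 ^ suc u * charge K ρ)  ≡⟨ *-assoc 2 (2 ^ suc u) (charge K ρ) ⟨
  2 ^ suc (suc u) * charge K ρ  ∎
  where
  open ≤-Reasoning
  T = ticks K 0 ρ
  F = λ (l : Fin (suc w)) → 2 ^ toℕ l * ticks K (toℕ l ∸ suc u) ρ
  G = λ (l : Fin w) → 2 ^ toℕ l * ticks K (toℕ l ∸ u) ρ
  lem : ∀ t g → 1 * t + 2 * g + t ≡ 2 * (g + t)
  lem = solve-∀

∑-ticks : ∀ u w K ρ → ∑ {w} (λ l → 2 ^ toℕ l * ticks K (toℕ l ∸ u) ρ) ≤ 2 ^ suc u * charge K ρ
∑-ticks u w K ρ = ≤-trans (m≤m+n _ _) (∑-ticks′ u w K ρ)

-- Savings for the next clearing of each counter, in units that make 2^K * q * charge the price of the clearings.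
bank : (K q : ℕ) → (ℕ → ℕ) → ℕ
bank zero    q ρ = 0
bank (suc K) q ρ = 2 ^ suc K * (q ∸ ρ 0) + bank K (4 * q) (ρ ∘ suc)

bank-initial : ∀ K q ρ → (∀ k → ρ k ≡ 4 ^ k * q) → bank K q ρ ≡ 0
bank-initial zero    q ρ h = refl
bank-initial (suc K) q ρ h = cong₂ _+_
  (trans (cong (2 ^ suc K *_) (trans (cong (q ∸_) (trans (h 0) (*-identityˡ q))) (n∸n≡0 q))) (*-zeroʳ (2 ^ suc K)))
  (bank-initial K (4 * q) (ρ ∘ suc) (λ k → trans (h (suc k)) (4^-shift k q)))

-- Per tick the k-th counter saves `2 ^ (K - k)`, in total less than `2 * 2 ^ K`. Over its lifetime
-- `4 ^ k * q` this accumulates to `2 ^ K * q * 2 ^ k`, its share of the price.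
bank-tick : ∀ K q P ρ → (∀ k → P k ≡ 4 ^ k * q) → (∀ k → 1 ≤ ρ k) → (∀ k → ρ k ≤ 4 ^ k * q)
  → bank K q (tick P ρ) + 2 ^ K * q * charge K ρ ≤ bank K q ρ + 2 * 2 ^ K
bank-tick zero q P ρ hP lo up = ≤-trans (≤-reflexive (*-zeroʳ (1 * q))) z≤n
bank-tick (suc K) q P ρ hP lo up = begin
  A * (q ∸ tick P ρ 0) + bank K (4 * q) (tick P ρ ∘ suc) + A * q * (t + 2 * ch)
    ≡⟨ lem₁ (2 ^ K) (q ∸ tick P ρ 0) _ q t ch ⟩
  (A * (q ∸ tick P ρ 0 + q * t)) + (bank K (4 * q) (tick P ρ ∘ suc) + 2 ^ K * (4 * q) * ch)
    ≤⟨ +-mono-≤ (*-monoʳ-≤ A head) (bank-tick K (4 * q) (P ∘ suc) (ρ ∘ suc) (λ k → trans (hP (suc k)) (4^-shift k q)) (lo ∘ suc) (λ k → ≤-trans (up (suc k)) (≤-reflexive (4^-shift k q)))) ⟩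
  A * (q ∸ ρ 0 + 1) + (bank K (4 * q) (ρ ∘ suc) + 2 * 2 ^ K)
    ≡⟨ lem₂ (2 ^ K) (q ∸ ρ 0) (bank K (4 * q) (ρ ∘ suc)) ⟩
  A * (q ∸ ρ 0) + bank K (4 * q) (ρ ∘ suc) + 2 * A ∎
  where
  open ≤-Reasoning
  A = 2 ^ suc K
  t = 1 ⟦ ρ 0 ≡ᵇ 1 ⟧
  ch = charge K (ρ ∘ suc)
  lem₁ : ∀ a x b q t c → 2 * a * x + b + 2 * a * q * (t + 2 * c) ≡ 2 * a * (x + q * t) + (b + a * (4 * q) * c)
  lem₁ = solve-∀
  lem₂ : ∀ a x b → 2 * a * (x + 1) + (b + 2 * a) ≡ 2 * a * x + b + 2 * (2 * a)
  lem₂ = solve-∀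
  P₀ : P 0 ≡ q
  P₀ = trans (hP 0) (*-identityˡ q)
  -- The `1` is the saving of the present tick: when `ρ 0` is `1`, the stock is `q - 1` and the
  -- price is `q`.
  head : q ∸ tick P ρ 0 + q * t ≤ q ∸ ρ 0 + 1
  head with ρ 0 | lo 0 | up 0
  ... | suc zero    | _ | 1≤q rewrite P₀ | n∸n≡0 q | *-identityʳ q = ≤-reflexive (sym (m∸n+n≡m (≤-trans 1≤q (≤-reflexive (*-identityˡ q)))))
  ... | suc (suc m) | _ | m≤q rewrite *-zeroʳ q | +-identityʳ (q ∸ suc m) = begin
    q ∸ suc m               ≤⟨ aux q (suc m) ⟩
    q ∸ suc (suc m) + 1     ∎
    where
    aux : ∀ a b → a ∸ b ≤ a ∸ suc b + 1
    aux zero    b       = ≤-trans (≤-reflexive (0∸n≡0 b)) z≤n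
    aux (suc a) zero    = ≤-reflexive (+-comm 1 a)
    aux (suc a) (suc b) = aux a b

-- The counters of a single level

∑-weights₀ : ∀ w κ → ∑ {w} (λ l → 2 ^ toℕ l * (8 ^ (κ ∸ toℕ l) ∸ 1)) ≤ 2 * 8 ^ κ
∑-weights₀ w zero = ≤-trans (≤-reflexive (∑-zero {w} (λ l → trans (cong (λ x → 2 ^ toℕ l * (8 ^ x ∸ 1)) (0∸n≡0 (toℕ l))) (*-zeroʳ (2 ^ toℕ l))))) z≤n
∑-weights₀ zero (suc κ) = ≤-trans (≤-reflexive (∑-empty _)) z≤n
∑-weights₀ (suc w) (suc κ) = begin
  ∑ F                                  ≡⟨ ∑-suc F ⟩
  1 * (8 ^ suc κ ∸ 1) + ∑ (F ∘ suc)    ≤⟨ +-mono-≤ (≤-trans (≤-reflexive (*-identityˡ _)) (m∸n≤m (8 ^ suc κ) 1))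
                                           (≤-reflexive (trans (∑-cong (λ l → *-assoc 2 (2 ^ toℕ l) _)) (sym (*-distribˡ-∑ 2 _)))) ⟩
  8 ^ suc κ + 2 * ∑ G                  ≤⟨ +-monoʳ-≤ (8 ^ suc κ) (*-monoʳ-≤ 2 (∑-weights₀ w κ)) ⟩
  8 ^ suc κ + 2 * (2 * 8 ^ κ)          ≤⟨ +-monoʳ-≤ (8 ^ suc κ) (≤-trans (≤-reflexive (sym (*-assoc 2 2 (8 ^ κ)))) (*-monoˡ-≤ (8 ^ κ) (m≤m+n 4 4))) ⟩
  8 ^ suc κ + 8 ^ suc κ                ≡⟨ cong (8 ^ suc κ +_) (sym (+-identityʳ _)) ⟩
  2 * 8 ^ suc κ                        ∎
  where
  open ≤-Reasoning
  F = λ (l : Fin (suc w)) → 2 ^ toℕ l * (8 ^ (suc κ ∸ toℕ l) ∸ 1)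
  G = λ (l : Fin w) → 2 ^ toℕ l * (8 ^ (κ ∸ toℕ l) ∸ 1)

-- From level `u` on, sizes double while weights fall by `8`, a geometric series of ratio 1/4; below
-- `u` there are fewer than `2 ^ u` items of full weight. The `∸ 1` leaves out the items of weight
-- `1`, and the added `8 ^ κ` closes the induction.
∑-weights : ∀ u w κ → ∑ {w} (λ l → 2 ^ toℕ l * (8 ^ (κ ∸ (toℕ l ∸ u)) ∸ 1)) + 8 ^ κ ≤ 3 * (2 ^ u * 8 ^ κ)
∑-weights zero w κ = ≤-trans (+-monoˡ-≤ (8 ^ κ) (∑-weights₀ w κ)) (≤-reflexive (lem (8 ^ κ)))
  where
  lem : ∀ x → 2 * x + x ≡ 3 * (1 * x)
  lem = solve-∀
∑-weights (suc u) zero κ = begin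
  ∑ F + 8 ^ κ               ≡⟨ cong (_+ 8 ^ κ) (trans (∑-empty F) (sym (∑-empty G))) ⟩
  ∑ G + 8 ^ κ               ≤⟨ ∑-weights u zero κ ⟩
  3 * (2 ^ u * 8 ^ κ)       ≤⟨ *-monoʳ-≤ 3 (*-monoˡ-≤ (8 ^ κ) (m≤n*m (2 ^ u) 2)) ⟩
  3 * (2 ^ suc u * 8 ^ κ)   ∎
  where
  open ≤-Reasoning
  F = λ (l : Fin 0) → 2 ^ toℕ l * (8 ^ (κ ∸ (toℕ l ∸ suc u)) ∸ 1)
  G = λ (l : Fin 0) → 2 ^ toℕ l * (8 ^ (κ ∸ (toℕ l ∸ u)) ∸ 1)
∑-weights (suc u) (suc w) κ = begin
  ∑ F + 8 ^ κ                                ≡⟨ cong (_+ 8 ^ κ) (∑-suc F) ⟩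
  1 * (8 ^ κ ∸ 1) + ∑ (F ∘ suc) + 8 ^ κ      ≤⟨ +-monoˡ-≤ (8 ^ κ) (+-mono-≤ (≤-trans (≤-reflexive (*-identityˡ _)) (m∸n≤m (8 ^ κ) 1))
                                           (≤-reflexive (trans (∑-cong (λ l → *-assoc 2 (2 ^ toℕ l) _)) (sym (*-distribˡ-∑ 2 _))))) ⟩
  8 ^ κ + 2 * ∑ G + 8 ^ κ                    ≡⟨ lem (8 ^ κ) (∑ G) ⟩
  2 * (∑ G + 8 ^ κ)                          ≤⟨ *-monoʳ-≤ 2 (∑-weights u w κ) ⟩
  2 * (3 * (2 ^ u * 8 ^ κ))                  ≡⟨ lem′ (2 ^ u) (8 ^ κ) ⟩
  3 * (2 ^ suc u * 8 ^ κ)                    ∎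
  where
  open ≤-Reasoning
  F = λ (l : Fin (suc w)) → 2 ^ toℕ l * (8 ^ (κ ∸ (toℕ l ∸ suc u)) ∸ 1)
  G = λ (l : Fin w) → 2 ^ toℕ l * (8 ^ (κ ∸ (toℕ l ∸ u)) ∸ 1)
  lem : ∀ x g → x + 2 * g + x ≡ 2 * (g + x)
  lem = solve-∀
  lem′ : ∀ a b → 2 * (3 * (a * b)) ≡ 3 * (2 * a * b)
  lem′ = solve-∀

record Level (n : ℕ) : Set where
  constructor level
  field
    rem  : ℕ → ℕ
    bits : Fin n → List Bool
open Level public

module Levels {n w : ℕ} (κ β : ℕ) (4≤κ : 4 ≤ κ) (p₀ : Part n w) (valid₀ : Valid p₀) where

  -- A sixteenth of the size of chunk `i`: the gain `16 * q * rate` of `pot-inc`, incurred with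
  -- probability `1 / 2 ^ i`, then equals one tick of decay.
  period : ℕ → ℕ
  period i = 2 ^ (i ∸ 4)

  -- Elements that start near the front get fewer counters, so that the potentials vanish initially.
  quota : ℕ → Fin n → ℕ
  quota i z = κ ⊓ (lev p₀ z ∸ (i ∸ κ))

  record Consistent (i : ℕ) (g : Level n) : Set where
    field
      rem-pos   : ∀ k → 1 ≤ rem g k
      rem-bound : ∀ k → rem g k ≤ 4 ^ k * period i
      bits-len  : ∀ z → length (bits g z) ≡ quota i z
  open Consistent public

  fresh : ℕ → Level n
  fresh i = level (λ k → 4 ^ k * period i) (λ z → replicate (quota i z) false)

  fresh-consistent : ∀ i → Consistent i (fresh i)
  fresh-consistent i = record
    { rem-pos   = λ k → *-mono-≤ {1} {4 ^ k} {1} (m^n>0 4 k) (m^n>0 2 (i ∸ 4))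
    ; rem-bound = λ k → ≤-refl
    ; bits-len  = λ z → length-replicate (quota i z)
    }

  expired : Level n → Fin n → List Bool
  expired g z = expire (bits g z) (rem g)

  -- Expiry precedes the arrival, so `lost` is decided by the counters that remain after the
  -- clearing.
  evict : ℕ → Level n → Fin n → Level n
  evict i g a = level (tick (λ k → 4 ^ k * period i) (rem g))
    (λ z → if toℕ z ≡ᵇ toℕ a then inc (expired g z) else expired g z)

  evict-consistent : ∀ i g a → Consistent i g → Consistent i (evict i g a)
  evict-consistent i g a c = record { rem-pos = pos ; rem-bound = bound ; bits-len = len }
    where
    pos : ∀ k → 1 ≤ rem (evict i g a) k
    pos k with rem g k | rem-pos c k
    ... | suc zero    | _ = *-mono-≤ {1} {4 ^ k} {1} (m^n>0 4 k) (m^n>0 2 (i ∸ 4))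
    ... | suc (suc m) | _ = s≤s z≤n
    bound : ∀ k → rem (evict i g a) k ≤ 4 ^ k * period i
    bound k with rem g k ≡ᵇ 1
    ... | true  = ≤-refl
    ... | false = ≤-trans (m∸n≤m (rem g k) 1) (rem-bound c k)
    len : ∀ z → length (bits (evict i g a) z) ≡ quota i z
    len z with toℕ z ≡ᵇ toℕ a
    ... | true  = trans (length-inc (expired g z)) (trans (length-expire (bits g z) (rem g)) (bits-len c z))
    ... | false = trans (length-expire (bits g z) (rem g)) (bits-len c z)

  -- All potentials are scaled by S to keep them integral.
  S : ℕ
  S = 8 ^ κ

  wt : ℕ → ℕ
  wt i = β * 2 ^ suc i

  -- The factor of the bank is `S * wt i * 2 ^ suc (i ∸ κ)` divided by `2 ^ κ * period i`; with it
  -- the bank pays exactly for what clearings can add to the first summand.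
  Ψ : ℕ → Level n → Part n w → ℕ
  Ψ i g p* = S * wt i * ∑ (λ z → zeros (lev p* z ∸ (i ∸ κ)) (bits g z))
           + β * 64 * 2 ^ (i ∸ κ) * 4 ^ κ * bank κ (period i) (rem g)

  -- An item with fewer counters is full more easily and weighs more in return, so that
  -- `weight-quota` makes a loss worth the same for every item.
  weight : ℕ → Fin n → ℕ
  weight i z = 8 ^ (κ ∸ (lev p₀ z ∸ (i ∸ κ)))

  Γ : ℕ → Level n → ℕ
  Γ i g = β * 16 * ∑ (λ z → weight i z * pot (bits g z) (rem g))

  lost : Level n → Fin n → Bool
  lost g a = full (expired g a)

  gain : ℕ → Part n w → Fin n → ℕ
  gain i p* a = 1 ⟦ lev p* a + κ ≤ᵇ i ⟧

  2^i : ∀ {i} → κ ≤ i → 2 ^ i ≡ 16 * period i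
  2^i {i} κ≤i = trans (cong (2 ^_) (sym (m+[n∸m]≡n (≤-trans 4≤κ κ≤i)))) (^-distribˡ-+-* 2 4 (i ∸ 4))

  2^i′ : ∀ {i} → κ ≤ i → 2 ^ i ≡ 2 ^ κ * 2 ^ (i ∸ κ)
  2^i′ {i} κ≤i = trans (cong (2 ^_) (sym (m+[n∸m]≡n κ≤i))) (^-distribˡ-+-* 2 κ (i ∸ κ))

  8^≡ : ∀ k → 8 ^ k ≡ 4 ^ k * 2 ^ k
  8^≡ k = ^-distribʳ-* 4 2 k
    where
    ^-distribʳ-* : ∀ a b k → (a * b) ^ k ≡ a ^ k * b ^ k
    ^-distribʳ-* a b zero    = refl
    ^-distribʳ-* a b (suc k) = trans (cong (a * b *_) (^-distribʳ-* a b k)) (lem a b (a ^ k) (b ^ k))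
      where
      lem : ∀ a b x y → a * b * (x * y) ≡ a * x * (b * y)
      lem = solve-∀

  2^≤8^ : ∀ k → 2 ^ k ≤ 8 ^ k
  2^≤8^ k = ^-monoˡ-≤ k (m≤m+n 2 6)

  wt-period : ∀ {i} → κ ≤ i → wt i ≡ β * 32 * period i
  wt-period {i} κ≤i = trans (cong (λ x → β * (2 * x)) (2^i κ≤i)) (lem β (period i))
    where
    lem : ∀ b q → b * (2 * (16 * q)) ≡ b * 32 * q
    lem = solve-∀

  -- If `gain` is `1`, the threshold of `a` is `0`, so the counter that the arrival sets is one that
  -- counts, unless all are set. The clearings are summed by offline level, using validity of `p*`.
  zeros-evict : ∀ i g a p* → κ ≤ i → Consistent i g → Valid p*
    → ∑ (λ z → zeros (lev p* z ∸ (i ∸ κ)) (bits (evict i g a) z)) + gain i p* a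
      ≤ ∑ (λ z → zeros (lev p* z ∸ (i ∸ κ)) (bits g z)) + 2 ^ suc (i ∸ κ) * charge κ (rem g) + (1 ⟦ lost g a ⟧)
  zeros-evict i g a p* κ≤i c v = begin
    ∑ Z′ + gain i p* a
      ≡⟨ cong (∑ Z′ +_) (∑-single a (gain i p* a)) ⟨
    ∑ Z′ + ∑ (λ z → gain i p* a ⟦ toℕ z ≡ᵇ toℕ a ⟧)
      ≡⟨ ∑-+ Z′ _ ⟨
    ∑ (λ z → Z′ z + (gain i p* a ⟦ toℕ z ≡ᵇ toℕ a ⟧))
      ≤⟨ ∑-mono pointwise ⟩
    ∑ (λ z → Z z + T z + ((1 ⟦ lost g a ⟧) ⟦ toℕ z ≡ᵇ toℕ a ⟧))
      ≡⟨ trans (∑-+ (λ z → Z z + T z) _) (cong₂ _+_ (∑-+ Z T) (∑-single a _)) ⟩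
    ∑ Z + ∑ T + (1 ⟦ lost g a ⟧)
      ≤⟨ +-monoˡ-≤ (1 ⟦ lost g a ⟧) (+-monoʳ-≤ (∑ Z) (≤-trans (≤-reflexive (∑-by-level p* v (λ l → ticks κ (l ∸ u) (rem g)))) (∑-ticks u w κ (rem g)))) ⟩
    ∑ Z + 2 ^ suc u * charge κ (rem g) + (1 ⟦ lost g a ⟧) ∎
    where
    open ≤-Reasoning
    u = i ∸ κ
    Z = λ z → zeros (lev p* z ∸ u) (bits g z)
    Z′ = λ z → zeros (lev p* z ∸ u) (bits (evict i g a) z)
    T = λ z → ticks κ (lev p* z ∸ u) (rem g)
    exp : ∀ z → zeros (lev p* z ∸ u) (expired g z) ≤ Z z + T z
    exp z = zeros-expire κ (lev p* z ∸ u) (bits g z) (rem g) (≤-trans (≤-reflexive (bits-len c z)) (m⊓n≤m κ _))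
    arrive : zeros (lev p* a ∸ u) (inc (expired g a)) + gain i p* a ≤ zeros (lev p* a ∸ u) (expired g a) + (1 ⟦ lost g a ⟧)
    arrive with lev p* a + κ ≤ᵇ i in e
    ... | false = ≤-trans (≤-reflexive (+-identityʳ _)) (≤-trans (zeros-inc (lev p* a ∸ u) (expired g a)) (m≤m+n _ _))
    ... | true with full (expired g a) in f
    ...   | true  = +-monoˡ-≤ 1 (zeros-inc (lev p* a ∸ u) (expired g a))
    ...   | false = ≤-trans (≤-reflexive (trans (cong (λ d → zeros d (inc (expired g a)) + 1) d≡0)
                       (trans (zeros-gain (expired g a) f) (cong (λ d → zeros d (expired g a)) (sym d≡0))))) (m≤m+n _ 0)
      where
      d≡0 : lev p* a ∸ u ≡ 0
      d≡0 = m≤n⇒m∸n≡0 (m+n≤o⇒m≤o∸n (lev p* a) (≤ᵇ⇒≤ _ _ (subst 𝔹.T (sym e) _)))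
    pointwise : ∀ z → Z′ z + (gain i p* a ⟦ toℕ z ≡ᵇ toℕ a ⟧) ≤ Z z + T z + ((1 ⟦ lost g a ⟧) ⟦ toℕ z ≡ᵇ toℕ a ⟧)
    pointwise z with toℕ z ≡ᵇ toℕ a in e
    ... | false = +-monoˡ-≤ 0 (exp z)
    ... | true rewrite toℕ-injective (≡ᵇ-sound (toℕ z) (toℕ a) e) = ≤-trans arrive (+-monoˡ-≤ (1 ⟦ lost g a ⟧) (exp a))

  -- The bank drops by the price of the clearings and receives one round of savings. The factor `64`
  -- of the bank times the `2` of `bank-tick` is the `128`.
  Ψ-evict : ∀ i g a p* → κ ≤ i → Consistent i g → Valid p*
    → Ψ i (evict i g a) p* + S * wt i * gain i p* a
      ≤ Ψ i g p* + (S * wt i * (1 ⟦ lost g a ⟧) + β * 128 * 2 ^ (i ∸ κ) * S)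
  Ψ-evict i g a p* κ≤i c v = begin
    W * Z′ + A * B′ + W * G
      ≡⟨ lem₁ W Z′ (A * B′) G ⟩
    W * (Z′ + G) + A * B′
      ≤⟨ +-monoˡ-≤ (A * B′) (*-monoʳ-≤ W (zeros-evict i g a p* κ≤i c v)) ⟩
    W * (Z + 2 ^ suc u * ch + l) + A * B′
      ≡⟨ lem₂ W Z (2 ^ suc u) ch l (A * B′) ⟩
    W * Z + W * l + (A * B′ + W * 2 ^ suc u * ch)
      ≡⟨ cong (λ x → W * Z + W * l + (A * B′ + x * ch)) WA ⟩
    W * Z + W * l + (A * B′ + A * (2 ^ κ * q) * ch)
      ≡⟨ cong (W * Z + W * l +_) (lem₃ A B′ (2 ^ κ * q) ch) ⟩
    W * Z + W * l + A * (B′ + 2 ^ κ * q * ch)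
      ≤⟨ +-monoʳ-≤ (W * Z + W * l) (*-monoʳ-≤ A (bank-tick κ q _ (rem g) (λ _ → refl) (rem-pos c) (rem-bound c))) ⟩
    W * Z + W * l + A * (B + 2 * 2 ^ κ)
      ≡⟨ lem₄ (W * Z) (W * l) A B (2 * 2 ^ κ) ⟩
    W * Z + A * B + (W * l + A * (2 * 2 ^ κ))
      ≡⟨ cong (λ x → W * Z + A * B + (W * l + x)) A2 ⟩
    W * Z + A * B + (W * l + β * 128 * 2 ^ u * S) ∎
    where
    open ≤-Reasoning
    u = i ∸ κ
    q = period i
    W = S * wt i
    A = β * 64 * 2 ^ u * 4 ^ κ
    G = gain i p* a
    l = 1 ⟦ lost g a ⟧
    ch = charge κ (rem g)
    B = bank κ q (rem g)
    B′ = bank κ q (rem (evict i g a))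
    Z = ∑ (λ z → zeros (lev p* z ∸ u) (bits g z))
    Z′ = ∑ (λ z → zeros (lev p* z ∸ u) (bits (evict i g a) z))
    lem₁ : ∀ W Z B G → W * Z + B + W * G ≡ W * (Z + G) + B
    lem₁ = solve-∀
    lem₂ : ∀ W Z x c l B → W * (Z + x * c + l) + B ≡ W * Z + W * l + (B + W * x * c)
    lem₂ = solve-∀
    lem₃ : ∀ A B x c → A * B + A * x * c ≡ A * (B + x * c)
    lem₃ = solve-∀
    lem₄ : ∀ a b A B x → a + b + A * (B + x) ≡ a + A * B + (b + A * x)
    lem₄ = solve-∀
    lem₅ : ∀ x y b q u → x * y * (b * 32 * q) * (2 * u) ≡ b * 64 * u * x * (y * q)
    lem₅ = solve-∀
    lem₆ : ∀ b u x y → b * 64 * u * x * (2 * y) ≡ b * 128 * u * (x * y)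
    lem₆ = solve-∀
    WA : W * 2 ^ suc u ≡ A * (2 ^ κ * q)
    WA = trans (cong₂ (λ x y → x * y * 2 ^ suc u) (8^≡ κ) (wt-period κ≤i)) (lem₅ (4 ^ κ) (2 ^ κ) β q (2 ^ u))
    A2 : A * (2 * 2 ^ κ) ≡ β * 128 * 2 ^ u * S
    A2 = trans (lem₆ β (2 ^ u) (4 ^ κ) (2 ^ κ)) (cong (β * 128 * 2 ^ u *_) (sym (8^≡ κ)))

  -- The chunk depends on the random past, the weights on `p₀` alone. Hence a weight is split into
  -- `1`, counted over the chunk, and the excess, summed over all items.
  weights-in-chunk : ∀ i (p : Part n w) → κ ≤ i → count p i ≡ 2 ^ i
    → ∑ (λ a → weight i a ⟦ lev p a ≡ᵇ i ⟧) ≤ 4 * (2 ^ (i ∸ κ) * S)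
  weights-in-chunk i p κ≤i cnt = begin
    ∑ (λ a → weight i a ⟦ lev p a ≡ᵇ i ⟧)
      ≤⟨ ∑-mono pointwise ⟩
    ∑ (λ a → (1 ⟦ lev p a ≡ᵇ i ⟧) + (weight i a ∸ 1))
      ≡⟨ trans (∑-+ (λ a → 1 ⟦ lev p a ≡ᵇ i ⟧) _) (cong₂ _+_ cnt (∑-by-level p₀ valid₀ (λ l → 8 ^ (κ ∸ (l ∸ u)) ∸ 1))) ⟩
    2 ^ i + ∑ (λ l → 2 ^ toℕ l * (8 ^ (κ ∸ (toℕ l ∸ u)) ∸ 1))
      ≤⟨ +-mono-≤ (≤-trans (≤-reflexive (trans (2^i′ κ≤i) (*-comm (2 ^ κ) (2 ^ u)))) (*-monoʳ-≤ (2 ^ u) (2^≤8^ κ)))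
                  (≤-trans (m≤m+n _ (8 ^ κ)) (∑-weights u w κ)) ⟩
    4 * (2 ^ u * S) ∎
    where
    open ≤-Reasoning
    u = i ∸ κ
    pointwise : ∀ a → (weight i a ⟦ lev p a ≡ᵇ i ⟧) ≤ (1 ⟦ lev p a ≡ᵇ i ⟧) + (weight i a ∸ 1)
    pointwise a with lev p a ≡ᵇ i
    ... | true  = m≤n+m∸n (weight i a) 1
    ... | false = z≤n

  weight-quota : ∀ i z → weight i z * 8 ^ quota i z ≡ S
  weight-quota i z = trans (sym (^-distribˡ-+-* 8 (κ ∸ d) (κ ⊓ d))) (cong (8 ^_) (trans (+-comm (κ ∸ d) (κ ⊓ d)) (m⊓n+m∸n≡m κ d)))
    where
    d = lev p₀ z ∸ (i ∸ κ)
    m⊓n+m∸n≡m : ∀ m n → (m ⊓ n) + (m ∸ n) ≡ m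
    m⊓n+m∸n≡m zero    n       = 0∸n≡0 n
    m⊓n+m∸n≡m (suc m) zero    = refl
    m⊓n+m∸n≡m (suc m) (suc n) = cong suc (m⊓n+m∸n≡m m n)

  -- The surplus of `pot-inc` for a full list, times the weight of the item, is exactly the cost
  -- `S * wt i` of a loss.
  Γ-arrival : ∀ i g a → κ ≤ i → Consistent i g
    → S * wt i * (1 ⟦ lost g a ⟧) + Γ i (evict i g a)
      ≤ β * 16 * (∑ (λ z → weight i z * pot (expired g z) (rem (evict i g a)))
                  + weight i a * (2 ^ i * rate (bits g a) + 2 * period i))
  Γ-arrival i g a κ≤i c = begin
    S * wt i * l + β * 16 * D′
      ≡⟨ cong (_+ β * 16 * D′) loss-value ⟩
    β * 16 * (v * L) + β * 16 * D′
      ≡⟨ *-distribˡ-+ (β * 16) (v * L) D′ ⟨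
    β * 16 * (v * L + D′)
      ≤⟨ *-monoʳ-≤ (β * 16) (+-cancelʳ-≤ (v * pot e ρ′) _ _ bound) ⟩
    β * 16 * (D + v * (2 ^ i * rate (bits g a) + 2 * q)) ∎
    where
    open ≤-Reasoning
    q = period i
    v = weight i a
    e = expired g a
    l = 1 ⟦ lost g a ⟧
    L = 2 * q * 8 ^ length e ⟦ lost g a ⟧
    ρ′ = rem (evict i g a)
    f f′ : Fin n → ℕ
    f z = weight i z * pot (expired g z) ρ′
    f′ z = weight i z * pot (bits (evict i g a) z) ρ′
    D = ∑ f
    D′ = ∑ f′
    loss-value : S * wt i * l ≡ β * 16 * (v * L)
    loss-value with lost g a
    ... | false = trans (*-zeroʳ (S * wt i)) (sym (trans (cong (β * 16 *_) (*-zeroʳ v)) (*-zeroʳ (β * 16))))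
    ... | true  = trans (cong₂ (λ x y → x * y * 1) (sym (weight-quota i a)) (wt-period κ≤i))
                    (trans (lem v (8 ^ quota i a) β q)
                      (cong (λ x → β * 16 * (v * (2 * q * 8 ^ x))) (sym (trans (length-expire (bits g a) (rem g)) (bits-len c a)))))
      where
      lem : ∀ v x b q → v * x * (b * 32 * q) * 1 ≡ b * 16 * (v * (2 * q * x))
      lem = solve-∀
    upd : D′ + v * pot e ρ′ ≡ D + v * pot (inc e) ρ′
    upd = trans (∑-update f′ f a off) (cong (λ x → D + v * pot x ρ′) on)
      where
      on : bits (evict i g a) a ≡ inc e
      on rewrite ≡ᵇ-refl (toℕ a) = refl
      off : ∀ z → z ≢ a → f′ z ≡ f z
      off z ne rewrite ≡ᵇ-false (λ x → ne (toℕ-injective x)) = refl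
    bound : v * L + D′ + v * pot e ρ′ ≤ D + v * (2 ^ i * rate (bits g a) + 2 * q) + v * pot e ρ′
    bound = begin
      v * L + D′ + v * pot e ρ′              ≡⟨ +-assoc (v * L) D′ _ ⟩
      v * L + (D′ + v * pot e ρ′)            ≡⟨ cong (v * L +_) upd ⟩
      v * L + (D + v * pot (inc e) ρ′)       ≡⟨ lem₁ v L D (pot (inc e) ρ′) ⟩
      D + v * (pot (inc e) ρ′ + L)           ≤⟨ +-monoʳ-≤ D (*-monoʳ-≤ v (pot-inc e ρ′ q (rem-bound (evict-consistent i g a c)))) ⟩
      D + v * (pot e ρ′ + (16 * q * rate e + 2 * q)) ≤⟨ +-monoʳ-≤ D (*-monoʳ-≤ v (+-monoʳ-≤ (pot e ρ′) (+-monoˡ-≤ (2 * q)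
                                                       (≤-trans (*-monoʳ-≤ (16 * q) (rate-expire (bits g a) (rem g))) (≤-reflexive (cong (_* rate (bits g a)) (sym (2^i κ≤i)))))))) ⟩
      D + v * (pot e ρ′ + (2 ^ i * rate (bits g a) + 2 * q)) ≡⟨ lem₂ D v (pot e ρ′) _ ⟩
      D + v * (2 ^ i * rate (bits g a) + 2 * q) + v * pot e ρ′ ∎
      where
      lem₁ : ∀ v L D x → v * L + (D + v * x) ≡ D + v * (x + L)
      lem₁ = solve-∀
      lem₂ : ∀ D v x y → D + v * (x + y) ≡ D + v * y + v * x
      lem₂ = solve-∀

  -- An item is drawn with probability at most `1 / 2 ^ i`, which turns its gain `2 ^ i * R` into at
  -- most `R`; ageing takes `R` away from every item. Only the constant `2 * period i` survives, and
  -- it is met by the total weight of the chunk.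
  Γ-average : ∀ i g (p : Part n w) → κ ≤ i → Consistent i g → count p i ≡ 2 ^ i
    → ∑ (λ a → (S * wt i * (1 ⟦ lost g a ⟧) + Γ i (evict i g a)) ⟦ lev p a ≡ᵇ i ⟧)
      ≤ 2 ^ i * (Γ i g + β * 8 * 2 ^ (i ∸ κ) * S)
  Γ-average i g p κ≤i c cnt = begin
    ∑ (λ a → (S * wt i * (1 ⟦ lost g a ⟧) + Γ i (evict i g a)) ⟦ lev p a ≡ᵇ i ⟧)
      ≤⟨ ∑-mono pointwise ⟩
    ∑ (λ a → β * 16 * (D * ind a + (2 ^ i * R a + 2 * q * V a)))
      ≡⟨ *-distribˡ-∑ (β * 16) _ ⟨
    β * 16 * ∑ (λ a → D * ind a + (2 ^ i * R a + 2 * q * V a))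
      ≡⟨ cong (β * 16 *_) (trans (∑-+ (λ a → D * ind a) _) (cong₂ _+_ (sym (*-distribˡ-∑ D ind))
           (trans (∑-+ (λ a → 2 ^ i * R a) _) (cong₂ _+_ (sym (*-distribˡ-∑ (2 ^ i) R)) (sym (*-distribˡ-∑ (2 * q) V)))))) ⟩
    β * 16 * (D * count p i + (2 ^ i * ∑ R + 2 * q * ∑ V))
      ≤⟨ *-monoʳ-≤ (β * 16) (+-monoʳ-≤ (D * count p i) (+-monoʳ-≤ (2 ^ i * ∑ R) (*-monoʳ-≤ (2 * q) (weights-in-chunk i p κ≤i cnt)))) ⟩
    β * 16 * (D * count p i + (2 ^ i * ∑ R + 2 * q * (4 * (2 ^ u * S))))
      ≡⟨ cong (λ x → β * 16 * (D * x + (2 ^ i * ∑ R + 2 * q * (4 * (2 ^ u * S))))) cnt ⟩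
    β * 16 * (D * 2 ^ i + (2 ^ i * ∑ R + 2 * q * (4 * (2 ^ u * S))))
      ≡⟨ lem₁ β D (2 ^ i) (∑ R) q (2 ^ u) S ⟩
    2 ^ i * (β * 16 * (D + ∑ R)) + 16 * q * (β * 8 * 2 ^ u * S)
      ≡⟨ cong (λ x → 2 ^ i * (β * 16 * (D + ∑ R)) + x * (β * 8 * 2 ^ u * S)) (sym (2^i κ≤i)) ⟩
    2 ^ i * (β * 16 * (D + ∑ R)) + 2 ^ i * (β * 8 * 2 ^ u * S)
      ≡⟨ *-distribˡ-+ (2 ^ i) _ _ ⟨
    2 ^ i * (β * 16 * (D + ∑ R) + β * 8 * 2 ^ u * S)
      ≤⟨ *-monoʳ-≤ (2 ^ i) (+-monoˡ-≤ _ (*-monoʳ-≤ (β * 16) decay)) ⟩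
    2 ^ i * (Γ i g + β * 8 * 2 ^ u * S) ∎
    where
    open ≤-Reasoning
    u = i ∸ κ
    q = period i
    ρ′ = tick (λ k → 4 ^ k * period i) (rem g)
    D = ∑ (λ z → weight i z * pot (expired g z) ρ′)
    R V ind : Fin n → ℕ
    R a = weight i a * rate (bits g a)
    V a = weight i a ⟦ lev p a ≡ᵇ i ⟧
    ind a = 1 ⟦ lev p a ≡ᵇ i ⟧
    lem₁ : ∀ b D x r q u s → b * 16 * (D * x + (x * r + 2 * q * (4 * (u * s)))) ≡ x * (b * 16 * (D + r)) + 16 * q * (b * 8 * u * s)
    lem₁ = solve-∀
    decay : D + ∑ R ≤ ∑ (λ z → weight i z * pot (bits g z) (rem g))
    decay = ≤-trans (≤-reflexive (sym (∑-+ _ R))) (∑-mono (λ z → ≤-trans (≤-reflexive (sym (*-distribˡ-+ (weight i z) _ _)))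
              (*-monoʳ-≤ (weight i z) (pot-tick (bits g z) _ (rem g) (rem-pos c)))))
    pointwise : ∀ a → ((S * wt i * (1 ⟦ lost g a ⟧) + Γ i (evict i g a)) ⟦ lev p a ≡ᵇ i ⟧)
                  ≤ β * 16 * (D * ind a + (2 ^ i * R a + 2 * q * V a))
    pointwise a with lev p a ≡ᵇ i
    ... | false = z≤n
    ... | true  = ≤-trans (Γ-arrival i g a κ≤i c) (≤-reflexive (cong (β * 16 *_) (lem D (weight i a) (2 ^ i) (rate (bits g a)) q)))
      where
      lem : ∀ D v x r q → D + v * (x * r + 2 * q) ≡ D * 1 + (x * (v * r) + 2 * q * v)
      lem = solve-∀

  Ψ-fresh : ∀ i → Ψ i (fresh i) p₀ ≡ 0
  Ψ-fresh i = cong₂ _+_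
    (trans (cong (S * wt i *_) (∑-zero (λ z → zeros-initial _ (quota i z) (m⊓n≤n κ _)))) (*-zeroʳ (S * wt i)))
    (trans (cong (β * 64 * 2 ^ (i ∸ κ) * 4 ^ κ *_) (bank-initial κ (period i) _ (λ _ → refl))) (*-zeroʳ (β * 64 * 2 ^ (i ∸ κ) * 4 ^ κ)))

  Γ-fresh : ∀ i → Γ i (fresh i) ≡ 0
  Γ-fresh i = trans (cong (β * 16 *_) (∑-zero (λ z → trans (cong (weight i z *_) (pot-initial (quota i z) _)) (*-zeroʳ (weight i z))))) (*-zeroʳ (β * 16))

  -- Wherever a moved item goes, it exposes at most the counters below its old threshold. Thus the
  -- old level alone bounds the increase.
  Ψ-move : ∀ i g p* q*
    → Ψ i g q* ≤ Ψ i g p* + S * wt i * ∑ (λ z → (lev p* z + κ ∸ i) ⟦ not (lev p* z ≡ᵇ lev q* z) ⟧)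
  Ψ-move i g p* q* = begin
    W * ∑ Z′ + B                   ≤⟨ +-monoˡ-≤ B (*-monoʳ-≤ W (∑-mono pt)) ⟩
    W * ∑ (λ z → Z z + D z) + B    ≡⟨ cong (λ x → W * x + B) (∑-+ Z D) ⟩
    W * (∑ Z + ∑ D) + B            ≡⟨ lem W (∑ Z) (∑ D) B ⟩
    W * ∑ Z + B + W * ∑ D          ∎
    where
    open ≤-Reasoning
    u = i ∸ κ
    W = S * wt i
    B = β * 64 * 2 ^ u * 4 ^ κ * bank κ (period i) (rem g)
    Z Z′ D : Fin n → ℕ
    Z z = zeros (lev p* z ∸ u) (bits g z)
    Z′ z = zeros (lev q* z ∸ u) (bits g z)
    D z = (lev p* z + κ ∸ i) ⟦ not (lev p* z ≡ᵇ lev q* z) ⟧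
    lem : ∀ w x y b → w * (x + y) + b ≡ w * x + b + w * y
    lem = solve-∀
    diff : ∀ l → l ∸ u ≤ l + κ ∸ i
    diff l with κ ≤? i
    ... | yes h = ≤-reflexive (sym (trans (cong (λ x → l + κ ∸ x) (trans (sym (m∸n+n≡m h)) (+-comm u κ)))
                    (trans (sym (∸-+-assoc (l + κ) κ u)) (cong (_∸ u) (m+n∸n≡m l κ)))))
    ... | no  h = ≤-trans (m∸n≤m l u) (m+n≤o⇒m≤o∸n l (+-monoʳ-≤ l (<⇒≤ (≰⇒> h))))
    pt : ∀ z → Z′ z ≤ Z z + D z
    pt z with lev p* z ≡ᵇ lev q* z in e
    ... | true  = ≤-trans (≤-reflexive (cong (λ l → zeros (l ∸ u) (bits g z)) (sym (≡ᵇ-sound (lev p* z) (lev q* z) e)))) (m≤m+n _ 0)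
    ... | false = ≤-trans (zeros-move (lev p* z ∸ u) (lev q* z ∸ u) (bits g z))
                    (+-monoʳ-≤ (Z z) (≤-trans (m∸n≤m (lev p* z ∸ u) (lev q* z ∸ u)) (diff (lev p* z))))

-- Potentials and the fetch routine

≤ᵇ-true : ∀ {m n} → m ≤ n → (m ≤ᵇ n) ≡ true
≤ᵇ-true {m} {n} h with m ≤ᵇ n | ≤⇒≤ᵇ h
... | true | _ = refl

≤ᵇ-false : ∀ {m n} → n < m → (m ≤ᵇ n) ≡ false
≤ᵇ-false {m} {n} h with m ≤ᵇ n in e
... | false = refl
... | true  = ⊥-elim (<⇒≱ h (≤ᵇ⇒≤ m n (subst 𝔹.T (sym e) _)))

≤ᵇ-sound : ∀ m n → (m ≤ᵇ n) ≡ true → m ≤ n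
≤ᵇ-sound m n e = ≤ᵇ⇒≤ m n (subst 𝔹.T (sym e) _)

≤ᵇ-sound′ : ∀ m n → (m ≤ᵇ n) ≡ false → n < m
≤ᵇ-sound′ m n e with m ≤? n
... | yes h with () ← trans (sym (≤ᵇ-true h)) e
... | no  h = ≰⇒> h

∑-indicator-+ : ∀ {n} (f : Fin n → ℕ) (c : ℕ) (P : Fin n → Bool)
  → ∑ (λ a → (f a + c) ⟦ P a ⟧) ≡ ∑ (λ a → f a ⟦ P a ⟧) + c * ∑ (λ a → 1 ⟦ P a ⟧)
∑-indicator-+ f c P = trans (∑-cong pt) (trans (∑-+ _ _) (cong (∑ (λ a → f a ⟦ P a ⟧) +_) (sym (*-distribˡ-∑ c _))))
  where
  pt : ∀ a → ((f a + c) ⟦ P a ⟧) ≡ (f a ⟦ P a ⟧) + c * (1 ⟦ P a ⟧)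
  pt a with P a
  ... | true  = cong (f a +_) (sym (*-identityʳ c))
  ... | false = sym (*-zeroʳ c)

data Chain {w : ℕ} : ℕ → ℕ → List (Fin w × Fin w) → Set where
  []  : ∀ {ℓ} → Chain ℓ ℓ []
  _∷_ : ∀ {i i′ ℓ is} → toℕ i′ ≡ suc (toℕ i) → Chain (suc (toℕ i)) ℓ is → Chain (toℕ i) ℓ ((i , i′) ∷ is)

chain-suc : ∀ {w k ℓ} {is : List (Fin w × Fin w)} → Chain k ℓ is
  → Chain (suc k) (suc ℓ) (map (λ ij → (suc (proj₁ ij) , suc (proj₂ ij))) is)
chain-suc []       = []
chain-suc (e ∷ ch) = cong suc e ∷ chain-suc ch

steps-chain : ∀ {w} (j : Fin w) → Chain 0 (toℕ j) (steps j)
steps-chain zero = []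
steps-chain {suc (suc w)} (suc j) = refl ∷ chain-suc (steps-chain j)

toℕ-zeroOf : ∀ {w} (j : Fin w) → toℕ (zeroOf j) ≡ 0
toℕ-zeroOf zero    = refl
toℕ-zeroOf (suc j) = refl

module Potential {n w : ℕ} (κ γ β : ℕ) (β≡ : β ≡ 2 * γ + 4) (4≤κ : 4 ≤ κ) (κ-large : β * 136 ≤ 2 ^ κ)
                 (p₀ : Part n w) (valid₀ : Valid p₀) where

  open Levels {n} {w} κ β 4≤κ p₀ valid₀ public

  -- The potential of a single item

  4≤β : 4 ≤ β
  4≤β = ≤-trans (m≤n+m 4 (2 * γ)) (≤-reflexive (sym β≡))

  -- A near item saves for its next fetch. A far item holds a stock that covers a fetch and is
  -- released at rate `γ` by deposits. The truncated subtraction is exact while `b` is at most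
  -- `2 * 2 ^ l`.
  φ : (l* l b : ℕ) → ℕ
  φ l* l b = if l ≤ᵇ l* + κ then 4 * b else β * 2 ^ l ∸ γ * b

  φ-near : ∀ l* {l} b → l ≤ l* + κ → φ l* l b ≡ 4 * b
  φ-near l* b h rewrite ≤ᵇ-true h = refl

  φ-far : ∀ l* {l} b → l* + κ < l → φ l* l b ≡ β * 2 ^ l ∸ γ * b
  φ-far l* b h rewrite ≤ᵇ-false h = refl

  -- If `l* + κ ≤ i`, the item is far at level `suc i` and its entire new potential is charged;
  -- otherwise it is near before and after.
  φ-raise : ∀ l* i b → φ l* (suc i) b ≤ φ l* i b + wt i * (1 ⟦ l* + κ ≤ᵇ i ⟧)
  φ-raise l* i b with l* + κ ≤? i
  ... | yes h rewrite ≤ᵇ-true h | φ-far l* b (s≤s h) | *-identityʳ (wt i) = ≤-trans (m∸n≤m _ (γ * b)) (m≤n+m _ _)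
  ... | no  h rewrite φ-near l* b (≰⇒> h) | φ-near l* b (<⇒≤ (≰⇒> h)) = m≤m+n _ _

  φ-slack : ∀ l* l b → b ≤ 2 * 2 ^ l → 2 ^ l ≤ b → 4 * 2 ^ l ≤ φ l* l b
  φ-slack l* l b b≤ ≤b with l ≤? l* + κ
  ... | yes h rewrite φ-near l* b h = *-monoʳ-≤ 4 ≤b
  ... | no  h rewrite φ-far l* b (≰⇒> h) = m+n≤o⇒m≤o∸n (4 * 2 ^ l) (begin
    4 * 2 ^ l + γ * b              ≤⟨ +-monoʳ-≤ (4 * 2 ^ l) (*-monoʳ-≤ γ b≤) ⟩
    4 * 2 ^ l + γ * (2 * 2 ^ l)    ≡⟨ lem γ (2 ^ l) ⟩
    (2 * γ + 4) * 2 ^ l            ≡⟨ cong (_* 2 ^ l) (sym β≡) ⟩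
    β * 2 ^ l                      ∎)
    where
    open ≤-Reasoning
    lem : ∀ g x → 4 * x + g * (2 * x) ≡ (2 * g + 4) * x
    lem = solve-∀

  φ-deposit : ∀ l* l b v → φ l* l (b + v) ≤ φ l* l b + 4 * v
  φ-deposit l* l b v with l ≤ᵇ l* + κ
  ... | true  = ≤-reflexive (*-distribˡ-+ 4 b v)
  ... | false = ≤-trans (∸-monoʳ-≤ (β * 2 ^ l) (*-monoʳ-≤ γ (m≤m+n b v))) (m≤m+n _ _)

  φ-deposit-far : ∀ l* l b v → l* + κ < l → b + v ≤ 2 * 2 ^ l → φ l* l (b + v) + γ * v ≤ φ l* l b
  φ-deposit-far l* l b v far h rewrite φ-far l* b far | φ-far l* (b + v) far =
    m+n≤o⇒m≤o∸n _ (begin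
    β * 2 ^ l ∸ γ * (b + v) + γ * v + γ * b   ≡⟨ lem (β * 2 ^ l ∸ γ * (b + v)) γ v b ⟩
    β * 2 ^ l ∸ γ * (b + v) + γ * (b + v)     ≡⟨ m∸n+n≡m γb≤ ⟩
    β * 2 ^ l                                 ∎)
    where
    open ≤-Reasoning
    lem : ∀ x g v b → x + g * v + g * b ≡ x + g * (b + v)
    lem = solve-∀
    lem′ : ∀ g x → g * (2 * x) + 4 * x ≡ (2 * g + 4) * x
    lem′ = solve-∀
    γb≤ : γ * (b + v) ≤ β * 2 ^ l
    γb≤ = ≤-trans (*-monoʳ-≤ γ h) (≤-trans (m≤m+n _ (4 * 2 ^ l)) (≤-reflexive (trans (lem′ γ (2 ^ l)) (cong (_* 2 ^ l) (sym β≡)))))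

  φ-far-large : ∀ l* l b → l* + κ < l → b ≤ 2 ^ l → γ * 2 ^ l ≤ φ l* l b
  φ-far-large l* l b far h rewrite φ-far l* b far = m+n≤o⇒m≤o∸n (γ * 2 ^ l) (begin
    γ * 2 ^ l + γ * b              ≤⟨ +-monoʳ-≤ (γ * 2 ^ l) (*-monoʳ-≤ γ h) ⟩
    γ * 2 ^ l + γ * 2 ^ l          ≤⟨ m≤m+n _ (4 * 2 ^ l) ⟩
    γ * 2 ^ l + γ * 2 ^ l + 4 * 2 ^ l ≡⟨ lem γ (2 ^ l) ⟩
    (2 * γ + 4) * 2 ^ l            ≡⟨ cong (_* 2 ^ l) (sym β≡) ⟩
    β * 2 ^ l                      ∎)
    where
    open ≤-Reasoning
    lem : ∀ g x → g * x + g * x + 4 * x ≡ (2 * g + 4) * x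
    lem = solve-∀

  -- Only a change between near and far costs anything. The item is then near for one of the two
  -- offline levels, which bounds `2 ^ l` by `2 ^ κ` times the size at that level.
  φ-opt : ∀ l* m* l b → b ≤ 2 ^ l → φ m* l b ≤ φ l* l b + β * 2 ^ κ * mv l* m*
  φ-opt l* m* l b b≤ with l* ≡ᵇ m* in e
  ... | true rewrite ≡ᵇ-sound l* m* e = m≤m+n _ _
  ... | false with l ≤? m* + κ | l ≤? l* + κ
  ...   | yes h | yes h′ rewrite φ-near l* b h′ | φ-near m* b h = m≤m+n _ _
  ...   | no  h | no  h′ rewrite φ-far l* b (≰⇒> h′) | φ-far m* b (≰⇒> h) = m≤m+n _ _
  ...   | yes h | no  _  rewrite φ-near m* b h = ≤-trans (begin
    4 * b                           ≤⟨ *-mono-≤ {4} {β} 4≤β b≤ ⟩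
    β * 2 ^ l                       ≤⟨ *-monoʳ-≤ β (≤-trans (^-monoʳ-≤ 2 h) (≤-reflexive (trans (cong (2 ^_) (+-comm m* κ)) (^-distribˡ-+-* 2 κ m*)))) ⟩
    β * (2 ^ κ * 2 ^ m*)            ≡⟨ *-assoc β (2 ^ κ) _ ⟨
    β * 2 ^ κ * 2 ^ m*              ≤⟨ *-monoʳ-≤ (β * 2 ^ κ) (m≤n⊔m (2 ^ l*) (2 ^ m*)) ⟩
    β * 2 ^ κ * (2 ^ l* ⊔ 2 ^ m*)   ∎) (m≤n+m _ _)
    where open ≤-Reasoning
  ...   | no  h | yes h′ rewrite φ-far m* b (≰⇒> h) = ≤-trans (begin
    β * 2 ^ l ∸ γ * b               ≤⟨ m∸n≤m _ (γ * b) ⟩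
    β * 2 ^ l                       ≤⟨ *-monoʳ-≤ β (≤-trans (^-monoʳ-≤ 2 h′) (≤-reflexive (trans (cong (2 ^_) (+-comm l* κ)) (^-distribˡ-+-* 2 κ l*)))) ⟩
    β * (2 ^ κ * 2 ^ l*)            ≡⟨ *-assoc β (2 ^ κ) _ ⟨
    β * 2 ^ κ * 2 ^ l*              ≤⟨ *-monoʳ-≤ (β * 2 ^ κ) (m≤m⊔n (2 ^ l*) (2 ^ m*)) ⟩
    β * 2 ^ κ * (2 ^ l* ⊔ 2 ^ m*)   ∎) (m≤n+m _ _)
    where open ≤-Reasoning

  -- All items and all levels together

  Ghost : Set
  Ghost = Fin w → Level n

  AllConsistent : Ghost → Set
  AllConsistent g = ∀ i → Consistent (toℕ i) (g i)

  φ∑ : Part n w → Vec ℕ n → Part n w → ℕ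
  φ∑ p b p* = ∑ (λ z → φ (lev p* z) (lev p z) (lookup b z))

  Ψ∑ : Ghost → Part n w → ℕ
  Ψ∑ g p* = ∑ (λ i → Ψ (toℕ i) (g i) p*)

  Φ : Part n w → Vec ℕ n → Ghost → Part n w → ℕ
  Φ p b g p* = S * φ∑ p b p* + Ψ∑ g p*

  Γ∑ : Ghost → ℕ
  Γ∑ g = ∑ (λ i → Γ (toℕ i) (g i))

  -- On levels below `κ` the condition `lev p* a + κ ≤ i` cannot hold, so evictions there are free
  -- and their counters stand still.
  next : ℕ → Level n → Fin n → Level n
  next i l a = if κ ≤ᵇ i then evict i l a else l

  toll : ℕ → Level n → Fin n → ℕ
  toll i l a = if κ ≤ᵇ i then S * wt i * (1 ⟦ lost l a ⟧) + β * 128 * 2 ^ (i ∸ κ) * S else 0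

  next-consistent : ∀ i l a → Consistent i l → Consistent i (next i l a)
  next-consistent i l a c with κ ≤ᵇ i
  ... | true  = evict-consistent i l a c
  ... | false = c

  Ψ-next : ∀ i l a p* → Consistent i l → Valid p*
    → Ψ i (next i l a) p* + S * wt i * gain i p* a ≤ Ψ i l p* + toll i l a
  Ψ-next i l a p* c v with κ ≤? i
  ... | yes h rewrite ≤ᵇ-true h = Ψ-evict i l a p* h c v
  ... | no  h rewrite ≤ᵇ-false (≰⇒> h) | ≤ᵇ-false (≤-trans (≰⇒> h) (m≤n+m κ (lev p* a))) =
    ≤-reflexive (cong (Ψ i l p* +_) (*-zeroʳ (S * wt i)))

  -- The `8` of `Γ-average` and the `128` of the toll add up to the `136` of `κ-large`, which trades
  -- `β * 136 * 2 ^ (i ∸ κ)` for `2 ^ i`.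
  Γ-next : ∀ i l (p : Part n w) → Consistent i l → count p i ≡ 2 ^ i
    → ∑ (λ a → (toll i l a + Γ i (next i l a)) ⟦ lev p a ≡ᵇ i ⟧) ≤ 2 ^ i * (Γ i l + S * 2 ^ i)
  Γ-next i l p c cnt with κ ≤? i
  ... | no h rewrite ≤ᵇ-false (≰⇒> h) = begin
    ∑ (λ a → (0 + Γ i l) ⟦ lev p a ≡ᵇ i ⟧)                       ≡⟨ ∑-indicator-+ (λ _ → 0) (Γ i l) (λ a → lev p a ≡ᵇ i) ⟩
    ∑ (λ a → 0 ⟦ lev p a ≡ᵇ i ⟧) + Γ i l * count p i            ≡⟨ cong₂ _+_ (∑-zero zero-ind) (trans (cong (Γ i l *_) cnt) (*-comm (Γ i l) (2 ^ i))) ⟩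
    2 ^ i * Γ i l                                               ≤⟨ *-monoʳ-≤ (2 ^ i) (m≤m+n (Γ i l) _) ⟩
    2 ^ i * (Γ i l + S * 2 ^ i)                                 ∎
    where
    open ≤-Reasoning
    zero-ind : ∀ a → (0 ⟦ lev p a ≡ᵇ i ⟧) ≡ 0
    zero-ind a with lev p a ≡ᵇ i
    ... | true  = refl
    ... | false = refl
  ... | yes h rewrite ≤ᵇ-true h = begin
    ∑ (λ a → (X a + R + Γ i (evict i l a)) ⟦ lev p a ≡ᵇ i ⟧)    ≡⟨ ∑-cong (λ a → cong (λ x → x ⟦ lev p a ≡ᵇ i ⟧) (lem (X a) R _)) ⟩
    ∑ (λ a → (X a + Γ i (evict i l a) + R) ⟦ lev p a ≡ᵇ i ⟧)    ≡⟨ ∑-indicator-+ (λ a → X a + Γ i (evict i l a)) R (λ a → lev p a ≡ᵇ i) ⟩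
    ∑ (λ a → (X a + Γ i (evict i l a)) ⟦ lev p a ≡ᵇ i ⟧) + R * count p i
                                                                ≤⟨ +-mono-≤ (Γ-average i l p h c cnt) (≤-reflexive (cong (R *_) cnt)) ⟩
    2 ^ i * (Γ i l + β * 8 * 2 ^ u * S) + R * 2 ^ i             ≡⟨ lem′ (2 ^ i) (Γ i l) 8 128 β (2 ^ u) S ⟩
    2 ^ i * (Γ i l + β * 136 * (2 ^ u * S))                     ≤⟨ *-monoʳ-≤ (2 ^ i) (+-monoʳ-≤ (Γ i l) (*-monoˡ-≤ (2 ^ u * S) κ-large)) ⟩
    2 ^ i * (Γ i l + 2 ^ κ * (2 ^ u * S))                       ≡⟨ cong (λ x → 2 ^ i * (Γ i l + x)) (trans (sym (*-assoc (2 ^ κ) (2 ^ u) S)) (trans (cong (_* S) (sym (2^i′ h))) (*-comm (2 ^ i) S))) ⟩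
    2 ^ i * (Γ i l + S * 2 ^ i)                                 ∎
    where
    open ≤-Reasoning
    u = i ∸ κ
    X = λ a → S * wt i * (1 ⟦ lost l a ⟧)
    R = β * 128 * 2 ^ u * S
    lem : ∀ x y z → x + y + z ≡ x + z + y
    lem = solve-∀
    lem′ : ∀ x g c d b u s → x * (g + b * c * u * s) + b * d * u * s * x ≡ x * (g + b * (c + d) * (u * s))
    lem′ = solve-∀

  evictAt : Ghost → Fin w → Fin n → Ghost
  evictAt g i a j = if toℕ j ≡ᵇ toℕ i then next (toℕ j) (g j) a else g j

  evictAt-at : ∀ g i a → evictAt g i a i ≡ next (toℕ i) (g i) a
  evictAt-at g i a rewrite ≡ᵇ-refl (toℕ i) = refl

  evictAt-off : ∀ g i a j → j ≢ i → evictAt g i a j ≡ g j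
  evictAt-off g i a j ne rewrite ≡ᵇ-false (λ e → ne (toℕ-injective {i = j} {i} e)) = refl

  evictAt-consistent : ∀ g i a → AllConsistent g → AllConsistent (evictAt g i a)
  evictAt-consistent g i a c j with toℕ j ≡ᵇ toℕ i
  ... | true  = next-consistent (toℕ j) (g j) a (c j)
  ... | false = c j

  -- `φ-raise` charges `wt i` in exactly the case in which `Ψ` yields it. What is left is the toll,
  -- which does not mention `p*` and is therefore the same for all rivals.
  Φ-pick : ∀ p b g p* (i i′ : Fin w) a → toℕ i′ ≡ suc (toℕ i) → lev p a ≡ toℕ i → AllConsistent g → Valid p*
    → Φ (p [ a ]≔ i′) b (evictAt g i a) p* ≤ Φ p b g p* + toll (toℕ i) (g i) a
  Φ-pick p b g p* i i′ a i′≡ la c v = begin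
    S * φ∑ p′ b p* + Ψ∑ g′ p*
      ≤⟨ +-monoˡ-≤ (Ψ∑ g′ p*) (*-monoʳ-≤ S main) ⟩
    S * (φ∑ p b p* + W * G) + Ψ∑ g′ p*
      ≡⟨ lem S (φ∑ p b p*) W G (Ψ∑ g′ p*) ⟩
    S * φ∑ p b p* + (Ψ∑ g′ p* + S * W * G)
      ≤⟨ +-monoʳ-≤ (S * φ∑ p b p*) counters ⟩
    S * φ∑ p b p* + (Ψ∑ g p* + t)
      ≡⟨ +-assoc (S * φ∑ p b p*) (Ψ∑ g p*) t ⟨
    S * φ∑ p b p* + Ψ∑ g p* + t ∎
    where
    open ≤-Reasoning
    W = wt (toℕ i)
    G = gain (toℕ i) p* a
    t = toll (toℕ i) (g i) a
    p′ = p [ a ]≔ i′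
    g′ = evictAt g i a
    lem : ∀ s f w g y → s * (f + w * g) + y ≡ s * f + (y + s * w * g)
    lem = solve-∀
    f f′ : Fin n → ℕ
    f z = φ (lev p* z) (lev p z) (lookup b z)
    f′ z = φ (lev p* z) (lev p′ z) (lookup b z)
    f′a : f′ a ≤ f a + W * G
    f′a = subst₂ (λ x y → φ (lev p* a) x (lookup b a) ≤ φ (lev p* a) y (lookup b a) + W * G)
            (sym (trans (lev-update p a i′) i′≡)) (sym la) (φ-raise (lev p* a) (toℕ i) (lookup b a))
    main : ∑ f′ ≤ ∑ f + W * G
    main = +-cancelʳ-≤ (f a) _ _ (begin
      ∑ f′ + f a          ≡⟨ ∑-update f′ f a (λ z ne → cong (λ x → φ (lev p* z) x (lookup b z)) (lev-update′ p i′ ne)) ⟩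
      ∑ f + f′ a          ≤⟨ +-monoʳ-≤ (∑ f) f′a ⟩
      ∑ f + (f a + W * G) ≡⟨ lem₁ (∑ f) (f a) (W * G) ⟩
      ∑ f + W * G + f a   ∎)
      where
      lem₁ : ∀ x y z → x + (y + z) ≡ x + z + y
      lem₁ = solve-∀
    counters : Ψ∑ g′ p* + S * W * G ≤ Ψ∑ g p* + t
    counters = +-cancelʳ-≤ (Ψ (toℕ i) (g i) p*) _ _ (begin
      Ψ∑ g′ p* + S * W * G + Ψ (toℕ i) (g i) p*
        ≡⟨ lem₁ (Ψ∑ g′ p*) (S * W * G) _ ⟩
      Ψ∑ g′ p* + Ψ (toℕ i) (g i) p* + S * W * G
        ≡⟨ cong (_+ S * W * G) (∑-update (λ j → Ψ (toℕ j) (g′ j) p*) (λ j → Ψ (toℕ j) (g j) p*) i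
              (λ j ne → cong (λ x → Ψ (toℕ j) x p*) (evictAt-off g i a j ne))) ⟩
      Ψ∑ g p* + Ψ (toℕ i) (g′ i) p* + S * W * G
        ≡⟨ trans (+-assoc (Ψ∑ g p*) _ _) (cong (λ x → Ψ∑ g p* + (Ψ (toℕ i) x p* + S * W * G)) (evictAt-at g i a)) ⟩
      Ψ∑ g p* + (Ψ (toℕ i) (next (toℕ i) (g i) a) p* + S * W * G)
        ≤⟨ +-monoʳ-≤ (Ψ∑ g p*) (Ψ-next (toℕ i) (g i) a p* (c i) v) ⟩
      Ψ∑ g p* + (Ψ (toℕ i) (g i) p* + t)
        ≡⟨ lem₂ (Ψ∑ g p*) _ t ⟩
      Ψ∑ g p* + t + Ψ (toℕ i) (g i) p* ∎)
      where
      lem₁ : ∀ x y z → x + y + z ≡ x + z + y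
      lem₁ = solve-∀
      lem₂ : ∀ x y z → x + (y + z) ≡ x + z + y
      lem₂ = solve-∀

  Γ∑-average : ∀ g (i : Fin w) (p : Part n w) → AllConsistent g → Valid p
    → ∑ (λ a → (toll (toℕ i) (g i) a + Γ∑ (evictAt g i a)) ⟦ lev p a ≡ᵇ toℕ i ⟧)
      ≤ 2 ^ toℕ i * (Γ∑ g + S * 2 ^ toℕ i)
  Γ∑-average g i p c v = +-cancelʳ-≤ (Γᵢ * count p k) _ _ (begin
    ∑ (λ a → (t a + Γ∑ (evictAt g i a)) ⟦ lev p a ≡ᵇ k ⟧) + Γᵢ * count p k
      ≡⟨ ∑-indicator-+ (λ a → t a + Γ∑ (evictAt g i a)) Γᵢ (λ a → lev p a ≡ᵇ k) ⟨
    ∑ (λ a → (t a + Γ∑ (evictAt g i a) + Γᵢ) ⟦ lev p a ≡ᵇ k ⟧)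
      ≡⟨ ∑-cong (λ a → cong (λ x → x ⟦ lev p a ≡ᵇ k ⟧) (swap a)) ⟩
    ∑ (λ a → (t a + Γ k (next k (g i) a) + Γ∑ g) ⟦ lev p a ≡ᵇ k ⟧)
      ≡⟨ ∑-indicator-+ (λ a → t a + Γ k (next k (g i) a)) (Γ∑ g) (λ a → lev p a ≡ᵇ k) ⟩
    ∑ (λ a → (t a + Γ k (next k (g i) a)) ⟦ lev p a ≡ᵇ k ⟧) + Γ∑ g * count p k
      ≤⟨ +-monoˡ-≤ (Γ∑ g * count p k) (Γ-next k (g i) p (c i) (valid-count p v i)) ⟩
    2 ^ k * (Γᵢ + S * 2 ^ k) + Γ∑ g * count p k
      ≡⟨ cong (λ x → 2 ^ k * (Γᵢ + S * 2 ^ k) + Γ∑ g * x) (valid-count p v i) ⟩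
    2 ^ k * (Γᵢ + S * 2 ^ k) + Γ∑ g * 2 ^ k
      ≡⟨ lem (2 ^ k) Γᵢ (S * 2 ^ k) (Γ∑ g) ⟩
    2 ^ k * (Γ∑ g + S * 2 ^ k) + Γᵢ * 2 ^ k
      ≡⟨ cong (λ x → 2 ^ k * (Γ∑ g + S * 2 ^ k) + Γᵢ * x) (valid-count p v i) ⟨
    2 ^ k * (Γ∑ g + S * 2 ^ k) + Γᵢ * count p k ∎)
    where
    open ≤-Reasoning
    k = toℕ i
    t = toll k (g i)
    Γᵢ = Γ k (g i)
    lem : ∀ x a s b → x * (a + s) + b * x ≡ x * (b + s) + a * x
    lem = solve-∀
    swap : ∀ a → t a + Γ∑ (evictAt g i a) + Γᵢ ≡ t a + Γ k (next k (g i) a) + Γ∑ g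
    swap a = trans (+-assoc (t a) _ Γᵢ) (trans (cong (t a +_)
      (trans (∑-update (λ j → Γ (toℕ j) (evictAt g i a j)) (λ j → Γ (toℕ j) (g j)) i (λ j ne → cong (Γ (toℕ j)) (evictAt-off g i a j ne)))
        (trans (+-comm (Γ∑ g) _) (cong (λ x → Γ k x + Γ∑ g) (evictAt-at g i a)))))
      (sym (+-assoc (t a) _ _)))

  -- One inequality debit + Φ ≤ credit + X per offline solution (rival), with a common X: which rival is optimal is only
  -- known at the end of the run.
  record Ledger : Set₁ where
    field
      Rival       : Set
      place       : Rival → Part n w
      place-valid : ∀ x → Valid (place x)
      debit       : Rival → ℕ
      credit      : Rival → ℕ
  open Ledger public

  -- The state after `k` evictions: draws refer to the fixed `p`, moves have been applied to `p′`.
  -- Level `0` is one item short and level `k` has one too many. The `+ 2` comes from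
  -- `2 + 4 + ... + 2 ^ k = 2 * 2 ^ k - 2`.
  record Picked (p : Part n w) (b : Vec ℕ n) (B : Ledger) (k : ℕ)
                (p′ : Part n w) (g : Ghost) (X : ℕ) : Set where
    field
      untouched  : ∀ y → k ≤ lev p y → lev p′ y ≡ lev p y
      grows      : ∀ y → lev p y ≤ lev p′ y
      counts     : ∀ l → count p′ l + (1 ⟦ 0 ≡ᵇ l ⟧) ≡ count p l + (1 ⟦ k ≡ᵇ l ⟧)
      consistent : AllConsistent g
      moved      : moveCost p p′ + 2 ≤ 2 * 2 ^ k
      bounded    : ∀ x → debit B x + Φ p′ b g (place B x) ≤ credit B x + X
  open Picked

  picked-step : ∀ {p b B p′ g X} (i i′ : Fin w) a → toℕ i′ ≡ suc (toℕ i) → lev p a ≡ toℕ i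
    → Picked p b B (toℕ i) p′ g X
    → Picked p b B (suc (toℕ i)) (p′ [ a ]≔ i′) (evictAt g i a) (X + toll (toℕ i) (g i) a)
  picked-step {p} {b} {B} {p′} {g} {X} i i′ a i′≡ la inv = record
    { untouched  = λ y h → trans (lev-update′ p′ i′ (λ { refl → <⇒≱ h (≤-reflexive la) })) (untouched inv y (≤-trans (n≤1+n _) h))
    ; grows      = gr
    ; counts     = λ l → +-cancelʳ-≡ (1 ⟦ toℕ i ≡ᵇ l ⟧) _ _ (cnt l)
    ; consistent = evictAt-consistent g i a (consistent inv)
    ; moved      = mvd
    ; bounded    = bnd
    }
    where
    la′ : lev p′ a ≡ toℕ i
    la′ = trans (untouched inv a (≤-reflexive (sym la))) la
    bnd : ∀ x → debit B x + Φ (p′ [ a ]≔ i′) b (evictAt g i a) (place B x) ≤ credit B x + (X + toll (toℕ i) (g i) a)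
    bnd x = begin
      debit B x + Φ (p′ [ a ]≔ i′) b (evictAt g i a) (place B x)
        ≤⟨ +-monoʳ-≤ (debit B x) (Φ-pick p′ b g (place B x) i i′ a i′≡ la′ (consistent inv) (place-valid B x)) ⟩
      debit B x + (Φ p′ b g (place B x) + t)   ≡⟨ +-assoc (debit B x) _ t ⟨
      debit B x + Φ p′ b g (place B x) + t     ≤⟨ +-monoˡ-≤ t (bounded inv x) ⟩
      credit B x + X + t                       ≡⟨ +-assoc (credit B x) X t ⟩
      credit B x + (X + t)                     ∎
      where
      open ≤-Reasoning
      t = toll (toℕ i) (g i) a
    gr : ∀ y → lev p y ≤ lev (p′ [ a ]≔ i′) y
    gr y with toℕ y ≡ᵇ toℕ a in e
    ... | false = ≤-trans (grows inv y) (≤-reflexive (sym (lev-update′ p′ i′ (λ { refl → case (trans (sym (≡ᵇ-refl (toℕ y))) e) }))))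
      where
      case : true ≡ false → _
      case ()
    ... | true rewrite toℕ-injective (≡ᵇ-sound (toℕ y) (toℕ a) e) =
      ≤-trans (≤-reflexive la) (≤-trans (n≤1+n _) (≤-reflexive (sym (trans (lev-update p′ a i′) i′≡))))
    cnt : ∀ l → count (p′ [ a ]≔ i′) l + (1 ⟦ 0 ≡ᵇ l ⟧) + (1 ⟦ toℕ i ≡ᵇ l ⟧) ≡ count p l + (1 ⟦ suc (toℕ i) ≡ᵇ l ⟧) + (1 ⟦ toℕ i ≡ᵇ l ⟧)
    cnt l = begin
      count (p′ [ a ]≔ i′) l + z₀ + zᵢ      ≡⟨ lem _ z₀ zᵢ ⟩
      count (p′ [ a ]≔ i′) l + zᵢ + z₀      ≡⟨ cong (λ x → count (p′ [ a ]≔ i′) l + (1 ⟦ x ≡ᵇ l ⟧) + z₀) la′ ⟨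
      count (p′ [ a ]≔ i′) l + (1 ⟦ lev p′ a ≡ᵇ l ⟧) + z₀  ≡⟨ cong (_+ z₀) (count-update p′ a i′ l) ⟩
      count p′ l + (1 ⟦ toℕ i′ ≡ᵇ l ⟧) + z₀ ≡⟨ cong (λ x → count p′ l + (1 ⟦ x ≡ᵇ l ⟧) + z₀) i′≡ ⟩
      count p′ l + zₛ + z₀                  ≡⟨ lem (count p′ l) zₛ z₀ ⟩
      count p′ l + z₀ + zₛ                  ≡⟨ cong (_+ zₛ) (counts inv l) ⟩
      count p l + zᵢ + zₛ                   ≡⟨ lem (count p l) zᵢ zₛ ⟩
      count p l + zₛ + zᵢ                   ∎
      where
      open ≡-Reasoning
      z₀ = 1 ⟦ 0 ≡ᵇ l ⟧
      zᵢ = 1 ⟦ toℕ i ≡ᵇ l ⟧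
      zₛ = 1 ⟦ suc (toℕ i) ≡ᵇ l ⟧
      lem : ∀ x y z → x + y + z ≡ x + z + y
      lem = solve-∀
    mvd : moveCost p (p′ [ a ]≔ i′) + 2 ≤ 2 * 2 ^ suc (toℕ i)
    mvd = begin
      moveCost p (p′ [ a ]≔ i′) + 2                             ≤⟨ +-monoˡ-≤ 2 (moveCost-triangle p p′ (p′ [ a ]≔ i′)) ⟩
      moveCost p p′ + moveCost p′ (p′ [ a ]≔ i′) + 2            ≡⟨ lem (moveCost p p′) _ 2 ⟩
      moveCost p p′ + 2 + moveCost p′ (p′ [ a ]≔ i′)            ≤⟨ +-mono-≤ (moved inv) (≤-trans (moveCost-update p′ a i′) (≤-reflexive (cong₂ (λ x y → 2 ^ x ⊔ 2 ^ y) la′ i′≡))) ⟩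
      2 * 2 ^ toℕ i + (2 ^ toℕ i ⊔ 2 * 2 ^ toℕ i)               ≡⟨ cong (2 * 2 ^ toℕ i +_) (m≤n⇒m⊔n≡n (m≤n*m (2 ^ toℕ i) 2)) ⟩
      2 * 2 ^ toℕ i + 2 * 2 ^ toℕ i                             ≡⟨ cong (2 * 2 ^ toℕ i +_) (sym (+-identityʳ _)) ⟩
      2 * 2 ^ suc (toℕ i)                                       ∎
      where
      open ≤-Reasoning
      lem : ∀ x y z → x + y + z ≡ x + z + y
      lem = solve-∀

  -- Expectations are bounded in the form E F + T ≤ X + Γ, where X collects the tolls and T the amounts S 2^ℓ that the
  -- main potential sets aside at a fetch from level ℓ to cover them.
  E-pickAll : ∀ {p b B k ℓ is} → Valid p → Chain k ℓ is → ∀ (F : List (Fin n × Fin w) → ℚ) p′ g X T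
    → Picked p b B k p′ g X
    → (∀ as g′ X′ → Picked p b B ℓ (moveAll p′ as) g′ X′ → F as ℚ.+ ℕtoℚ (T + S * 2 ^ ℓ) ℚ.≤ ℕtoℚ (X′ + Γ∑ g′))
    → E (pickAll p is) F ℚ.+ ℕtoℚ (T + S * 2 ^ k) ℚ.≤ ℕtoℚ (X + Γ∑ g)
  E-pickAll v [] F p′ g X T inv cont = cont [] g X inv
  E-pickAll {p} {b} {B} v (_∷_ {i} {i′} {ℓ} {is} i′≡ ch) F p′ g X T inv cont =
    -- The reserve doubles with each level: one half of `S * 2 ^ suc k` pays the mean toll of level
    -- `k`, the other half is the claim for `k`.
    ι-cancel (E (pickAll p ((i , i′) ∷ is)) F) (T + S * 2 ^ k) (X + Γ∑ g) (S * 2 ^ k)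
      (subst (λ x → E (pickAll p ((i , i′) ∷ is)) F ℚ.+ ℕtoℚ x ℚ.≤ ℕtoℚ (X + Γ∑ g + S * 2 ^ k)) (lem T S (2 ^ k))
        (E-unif (chunk p i) _ F (λ y → lev p y ≡ k) h (T + S * 2 ^ suc k) (X + Γ∑ g + S * 2 ^ k)
          (≤-trans (m^n>0 2 k) (≤-reflexive (sym (v i))))
          (All.map (λ {y} t → ≡ᵇ⇒≡ (lev p y) k t) (all-filter _ (allFin n)))
          branch average))
    where
    k = toℕ i
    t = toll k (g i)
    h : Fin n → ℕ
    h a = X + t a + Γ∑ (evictAt g i a)
    lem : ∀ t s x → t + s * (2 * x) ≡ t + s * x + s * x
    lem = solve-∀
    branch : ∀ a → lev p a ≡ k → E (pickAll p is >>= λ as → ret ((a , i′) ∷ as)) F ℚ.+ ℕtoℚ (T + S * 2 ^ suc k) ℚ.≤ ℕtoℚ (h a)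
    branch a la = E-bind-≤ (pickAll p is) (λ as → ret ((a , i′) ∷ as)) F (T + S * 2 ^ suc k)
      (E-pickAll v ch (λ as → F ((a , i′) ∷ as)) (p′ [ a ]≔ i′) (evictAt g i a) (X + t a) T (picked-step i i′ a i′≡ la inv)
        (λ as → cont ((a , i′) ∷ as)))
    average : L.sum (map h (chunk p i)) ≤ length (chunk p i) * (X + Γ∑ g + S * 2 ^ k)
    average = begin
      L.sum (map h (chunk p i))
        ≡⟨ sum-filter (λ a → lev p a ≡ᵇ k) h ⟩
      ∑ (λ a → (X + t a + Γ∑ (evictAt g i a)) ⟦ lev p a ≡ᵇ k ⟧)
        ≡⟨ ∑-cong (λ a → cong (λ x → x ⟦ lev p a ≡ᵇ k ⟧) (lem₁ X (t a) _)) ⟩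
      ∑ (λ a → (t a + Γ∑ (evictAt g i a) + X) ⟦ lev p a ≡ᵇ k ⟧)
        ≡⟨ ∑-indicator-+ (λ a → t a + Γ∑ (evictAt g i a)) X (λ a → lev p a ≡ᵇ k) ⟩
      ∑ (λ a → (t a + Γ∑ (evictAt g i a)) ⟦ lev p a ≡ᵇ k ⟧) + X * count p k
        ≤⟨ +-mono-≤ (Γ∑-average g i p (consistent inv) v) (≤-reflexive (cong (X *_) (valid-count p v i))) ⟩
      2 ^ k * (Γ∑ g + S * 2 ^ k) + X * 2 ^ k
        ≡⟨ lem₂ (2 ^ k) (Γ∑ g) (S * 2 ^ k) X ⟩
      2 ^ k * (X + Γ∑ g + S * 2 ^ k)
        ≡⟨ cong (_* (X + Γ∑ g + S * 2 ^ k)) (sym (v i)) ⟩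
      length (chunk p i) * (X + Γ∑ g + S * 2 ^ k) ∎
      where
      open ≤-Reasoning
      lem₁ : ∀ x y z → x + y + z ≡ y + z + x
      lem₁ = solve-∀
      lem₂ : ∀ a g s x → a * (g + s) + x * a ≡ a * (x + g + s)
      lem₂ = solve-∀

  record Fetched (p : Part n w) (b : Vec ℕ n) (z : Fin n) (B : Ledger)
                 (p′ : Part n w) (g : Ghost) (X : ℕ) : Set where
    field
      valid      : Valid p′
      consistent : AllConsistent g
      front      : lev p′ z ≡ 0
      grows      : ∀ y → y ≢ z → lev p y ≤ lev p′ y
      moved      : moveCost p p′ ≤ 3 * 2 ^ lev p z
      bounded    : ∀ x → debit B x + (Φ p′ (b [ z ]≔ 0) g (place B x) + S * φ (lev (place B x) z) (lev p z) (lookup b z)) ≤ credit B x + X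

  E-fetch : ∀ p b z g (B : Ledger) X T (F : State n w × List (Fin n) → ℚ)
    → Valid p → AllConsistent g → (∀ x → debit B x + Φ p b g (place B x) ≤ credit B x + X)
    → (∀ p′ ch g′ X′ → Fetched p b z B p′ g′ X′ → F (st p′ (b [ z ]≔ 0) , ch) ℚ.+ ℕtoℚ (T + S * 2 ^ lev p z) ℚ.≤ ℕtoℚ (X′ + Γ∑ g′))
    → E (fetch (st p b) z) F ℚ.+ ℕtoℚ T ℚ.≤ ℕtoℚ (X + Γ∑ g)
  E-fetch p b z g B X T F v c bnd cont =
    E-bind-≤ (pickAll p (steps (lookup p z))) (λ as → ret (outcome as)) F T
      (ι-weaken (E (pickAll p (steps (lookup p z))) (F ∘ outcome)) (m≤m+n T (S * 1))
        (E-pickAll v (steps-chain (lookup p z)) (F ∘ outcome) p g X T base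
          (λ as g′ X′ inv → cont _ (map proj₁ as) g′ X′ (finish inv))))
    where
    ℓ = lev p z
    outcome : List (Fin n × Fin w) → State n w × List (Fin n)
    outcome as = st (moveAll p as [ z ]≔ zeroOf (lookup p z)) (b [ z ]≔ 0) , map proj₁ as
    base : Picked p b B 0 p g X
    base = record
      { untouched = λ _ _ → refl ; grows = λ _ → ≤-refl ; counts = λ _ → refl ; consistent = c
      ; moved = ≤-reflexive (cong (_+ 2) (moveCost-refl p)) ; bounded = bnd }
    finish : ∀ {p₁ g′ X′} → Picked p b B ℓ p₁ g′ X′ → Fetched p b z B (p₁ [ z ]≔ zeroOf (lookup p z)) g′ X′
    finish {p₁} {g′} {X′} inv = record
      { valid      = count-valid p₂ (λ i → trans (+-cancelʳ-≡ (1 ⟦ ℓ ≡ᵇ toℕ i ⟧) _ _ (cnt (toℕ i))) (valid-count p v i))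
      ; consistent = consistent inv
      ; front      = lz′
      ; grows      = λ y ne → ≤-trans (grows inv y) (≤-reflexive (sym (lev-update′ p₁ j ne)))
      ; moved      = mvd
      ; bounded    = λ x → ≤-trans (+-monoʳ-≤ (debit B x) (Φ-front (place B x))) (bounded inv x)
      }
      where
      j = zeroOf (lookup p z)
      p₂ = p₁ [ z ]≔ j
      b′ = b [ z ]≔ 0
      lz : lev p₁ z ≡ ℓ
      lz = untouched inv z ≤-refl
      lz′ : lev p₂ z ≡ 0
      lz′ = trans (lev-update p₁ z j) (toℕ-zeroOf (lookup p z))
      cnt : ∀ l → count p₂ l + (1 ⟦ ℓ ≡ᵇ l ⟧) ≡ count p l + (1 ⟦ ℓ ≡ᵇ l ⟧)
      cnt l = trans (cong (λ x → count p₂ l + (1 ⟦ x ≡ᵇ l ⟧)) (sym lz))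
                (trans (count-update p₁ z j l) (trans (cong (λ x → count p₁ l + (1 ⟦ x ≡ᵇ l ⟧)) (toℕ-zeroOf (lookup p z))) (counts inv l)))
      mvd : moveCost p p₂ ≤ 3 * 2 ^ ℓ
      mvd = begin
        moveCost p p₂                         ≤⟨ moveCost-triangle p p₁ p₂ ⟩
        moveCost p p₁ + moveCost p₁ p₂        ≤⟨ +-mono-≤ (≤-trans (m≤m+n _ 2) (moved inv)) (≤-trans (moveCost-update p₁ z j)
                                                   (≤-reflexive (cong₂ (λ x y → 2 ^ x ⊔ 2 ^ y) lz (toℕ-zeroOf (lookup p z))))) ⟩
        2 * 2 ^ ℓ + (2 ^ ℓ ⊔ 1)               ≡⟨ cong (2 * 2 ^ ℓ +_) (m≥n⇒m⊔n≡m (m^n>0 2 ℓ)) ⟩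
        2 * 2 ^ ℓ + 2 ^ ℓ                     ≡⟨ +-comm (2 * 2 ^ ℓ) (2 ^ ℓ) ⟩
        3 * 2 ^ ℓ                             ∎
        where open ≤-Reasoning
      Φ-front : ∀ p* → Φ p₂ b′ g′ p* + S * φ (lev p* z) ℓ (lookup b z) ≤ Φ p₁ b g′ p*
      Φ-front p* = ≤-reflexive (begin
        S * φ∑ p₂ b′ p* + Ψ∑ g′ p* + S * φ (lev p* z) ℓ (lookup b z)
          ≡⟨ lem S (φ∑ p₂ b′ p*) (Ψ∑ g′ p*) _ ⟩
        S * (φ∑ p₂ b′ p* + φ (lev p* z) ℓ (lookup b z)) + Ψ∑ g′ p*
          ≡⟨ cong (λ x → S * (φ∑ p₂ b′ p* + φ (lev p* z) x (lookup b z)) + Ψ∑ g′ p*) lz ⟨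
        S * (φ∑ p₂ b′ p* + φ (lev p* z) (lev p₁ z) (lookup b z)) + Ψ∑ g′ p*
          ≡⟨ cong (λ x → S * x + Ψ∑ g′ p*) (trans (∑-update f′ f z off) (trans (cong (φ∑ p₁ b p* +_) zero-at) (+-identityʳ _))) ⟩
        S * φ∑ p₁ b p* + Ψ∑ g′ p* ∎)
        where
        open ≡-Reasoning
        lem : ∀ s x y z → s * x + y + s * z ≡ s * (x + z) + y
        lem = solve-∀
        f f′ : Fin n → ℕ
        f y = φ (lev p* y) (lev p₁ y) (lookup b y)
        f′ y = φ (lev p* y) (lev p₂ y) (lookup b′ y)
        off : ∀ y → y ≢ z → f′ y ≡ f y
        off y ne = cong₂ (φ (lev p* y)) (lev-update′ p₁ j ne) (lookup∘update′ ne b 0)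
        -- Level `0` is near for every `p*` and the budget is reset, so the whole potential of `z`
        -- is released.
        zero-at : f′ z ≡ 0
        zero-at = cong₂ (φ (lev p* z)) lz′ (lookup∘update z b 0)

-- Requests

T⇒≡ : ∀ {b} → 𝔹.T b → b ≡ true
T⇒≡ {true} _ = refl

≡⇒T : ∀ {b} → b ≡ true → 𝔹.T b
≡⇒T refl = _

minList-attained : {A : Set} (f : A → ℕ) (c : A) (cs : List A) → ∃[ y ] y ∈ (c ∷ cs) × minList (map f (c ∷ cs)) ≡ f y
minList-attained f c [] = c , here refl , refl
minList-attained f c (d ∷ cs) with f d ≤? foldr _⊓_ (f c) (map f cs)
... | yes h = d , there (here refl) , m≤n⇒m⊓n≡m h
... | no  h with minList-attained f c cs
...   | y , here refl , e = y , here refl , trans (m≥n⇒m⊓n≡n (<⇒≤ (≰⇒> h))) e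
...   | y , there m   , e = y , there (there m) , trans (m≥n⇒m⊓n≡n (<⇒≤ (≰⇒> h))) e

minList-lower : {A : Set} (f : A → ℕ) (xs : List A) {y : A} → y ∈ xs → minList (map f xs) ≤ f y
minList-lower f (c ∷ cs) (here refl) = base cs
  where
  base : ∀ cs → foldr _⊓_ (f c) (map f cs) ≤ f c
  base []       = ≤-refl
  base (d ∷ cs) = ≤-trans (m⊓n≤n (f d) _) (base cs)
minList-lower f (c ∷ cs) (there m) = go cs m
  where
  go : ∀ cs {y} → y ∈ cs → foldr _⊓_ (f c) (map f cs) ≤ f y
  go (d ∷ cs) (here refl) = m⊓n≤m (f d) _
  go (d ∷ cs) (there m)   = ≤-trans (m⊓n≤n (f d) _) (go cs m)

∈-members⁺ : (R : Subset n) {y : Fin n} → lookup R y ≡ true → y ∈ members R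
∈-members⁺ R {y} h = ∈-filter⁺ (T? ∘ lookup R) (∈-allFin y) (≡⇒T h)

∈-members⁻ : (R : Subset n) {y : Fin n} → y ∈ members R → lookup R y ≡ true
∈-members⁻ R m = T⇒≡ (proj₂ (∈-filter⁻ (T? ∘ lookup R) {xs = allFin _} m))

accessCost-attained : (p : Part n w) (R : Subset n) → Nonempty R
  → ∃[ y ] lookup R y ≡ true × accessCost p R ≡ 2 ^ lev p y
accessCost-attained p R (x , x∈R) = go (members R) refl
  where
  go : ∀ ms → members R ≡ ms → ∃[ y ] lookup R y ≡ true × minList (map (size p) ms) ≡ 2 ^ lev p y
  go [] e with () ← subst (x ∈_) e (∈-members⁺ R ([]=⇒lookup x∈R))
  go (c ∷ cs) e with minList-attained (size p) c cs
  ... | y , m , eq = y , ∈-members⁻ R (subst (y ∈_) (sym e) m) , eq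

accessCost-lower : (p : Part n w) (R : Subset n) {y : Fin n} → lookup R y ≡ true → accessCost p R ≤ 2 ^ lev p y
accessCost-lower p R h = minList-lower (size p) (members R) (∈-members⁺ R h)

∣∣-∑ : (R : Subset n) → ∑ (λ z → 1 ⟦ lookup R z ⟧) ≡ ∣ R ∣
∣∣-∑ []          = ∑-empty _
∣∣-∑ (true ∷ R)  = trans (∑-suc _) (cong suc (∣∣-∑ R))
∣∣-∑ (false ∷ R) = trans (∑-suc _) (∣∣-∑ R)

sum-filter-list : {A : Set} (P : A → Bool) (h : A → ℕ) (xs : List A)
  → L.sum (map h (filterᵇ P xs)) ≡ L.sum (map (λ y → h y ⟦ P y ⟧) xs)
sum-filter-list P h [] = refl
sum-filter-list P h (x ∷ xs) with P x
... | true  = cong (h x +_) (sum-filter-list P h xs)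
... | false = sum-filter-list P h xs

lookup-addBudget : (b : Vec ℕ n) (ys : List (Fin n)) (v : ℕ) (z : Fin n)
  → lookup (addBudget b ys v) z ≡ lookup b z + L.sum (map (λ y → v ⟦ toℕ y ≡ᵇ toℕ z ⟧) ys)
lookup-addBudget b [] v z = sym (+-identityʳ _)
lookup-addBudget b (y ∷ ys) v z = trans (lookup-addBudget _ ys v z)
  (trans (cong (_+ L.sum (map (λ y → v ⟦ toℕ y ≡ᵇ toℕ z ⟧) ys)) here′) (+-assoc (lookup b z) _ _))
  where
  here′ : lookup (b [ y ]≔ (lookup b y + v)) z ≡ lookup b z + (v ⟦ toℕ y ≡ᵇ toℕ z ⟧)
  here′ with toℕ y ≡ᵇ toℕ z in e
  ... | true rewrite toℕ-injective (≡ᵇ-sound (toℕ y) (toℕ z) e) = lookup∘update z b (lookup b z + v)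
  ... | false = trans (lookup∘update′ (λ { refl → case (trans (sym (≡ᵇ-refl (toℕ z))) e) }) b _) (sym (+-identityʳ _))
    where
    case : true ≡ false → _
    case ()

∑-pick : (f : Fin n → ℕ) (z : Fin n) → ∑ (λ y → f y ⟦ toℕ y ≡ᵇ toℕ z ⟧) ≡ f z
∑-pick f z = trans (∑-cong pt) (∑-single z (f z))
  where
  pt : ∀ y → (f y ⟦ toℕ y ≡ᵇ toℕ z ⟧) ≡ (f z ⟦ toℕ y ≡ᵇ toℕ z ⟧)
  pt y with toℕ y ≡ᵇ toℕ z in e
  ... | true  = cong f (toℕ-injective (≡ᵇ-sound (toℕ y) (toℕ z) e))
  ... | false = refl

charged : Subset n → Fin n → Fin n → ℕ
charged R x z = (1 ⟦ not (toℕ z ≡ᵇ toℕ x) ⟧) ⟦ lookup R z ⟧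

charged≤ : (R : Subset n) (x z : Fin n) → charged R x z ≤ (1 ⟦ lookup R z ⟧)
charged≤ R x z = ⟦⟧-mono (lookup R z) (⟦⟧-≤ (not (toℕ z ≡ᵇ toℕ x)) ≤-refl)

charged-self : (R : Subset n) (x : Fin n) → charged R x x ≡ 0
charged-self R x rewrite ≡ᵇ-refl (toℕ x) with lookup R x
... | true  = refl
... | false = refl

charged-other : (R : Subset n) {x z : Fin n} → z ≢ x → lookup R z ≡ true → charged R x z ≡ 1
charged-other R ne h rewrite h | ≡ᵇ-false (λ e → ne (toℕ-injective e)) = refl

charged-total : (R : Subset n) (x : Fin n) → ∑ (charged R x) ≤ ∣ R ∣
charged-total R x = ≤-trans (∑-mono (charged≤ R x)) (≤-reflexive (∣∣-∑ R))

lookup-charge : (b : Vec ℕ n) (R : Subset n) (x : Fin n) (v : ℕ) (z : Fin n)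
  → lookup (addBudget b (filterᵇ (λ y → not (toℕ y ≡ᵇ toℕ x)) (members R)) v) z ≡ lookup b z + v * charged R x z
lookup-charge {n} b R x v z = trans (lookup-addBudget b (filterᵇ (λ y → not (toℕ y ≡ᵇ toℕ x)) (members R)) v z) (cong (lookup b z +_) (begin
  L.sum (map h (filterᵇ (λ y → not (toℕ y ≡ᵇ toℕ x)) (members R)))  ≡⟨ sum-filter-list _ h (members R) ⟩
  L.sum (map (λ y → h y ⟦ not (toℕ y ≡ᵇ toℕ x) ⟧) (members R))      ≡⟨ sum-filter (lookup R) _ ⟩
  ∑ (λ y → (h y ⟦ not (toℕ y ≡ᵇ toℕ x) ⟧) ⟦ lookup R y ⟧)          ≡⟨ ∑-cong pt ⟩
  ∑ (λ y → v * charged R x y ⟦ toℕ y ≡ᵇ toℕ z ⟧)                  ≡⟨ ∑-pick (λ y → v * charged R x y) z ⟩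
  v * charged R x z                                               ∎))
  where
  open ≡-Reasoning
  h : Fin n → ℕ
  h y = v ⟦ toℕ y ≡ᵇ toℕ z ⟧
  pt : ∀ y → ((h y ⟦ not (toℕ y ≡ᵇ toℕ x) ⟧) ⟦ lookup R y ⟧) ≡ (v * charged R x y ⟦ toℕ y ≡ᵇ toℕ z ⟧)
  pt y with toℕ y ≡ᵇ toℕ z | toℕ y ≡ᵇ toℕ x | lookup R y
  ... | true  | true  | true  = sym (*-zeroʳ v)
  ... | true  | true  | false = sym (*-zeroʳ v)
  ... | true  | false | true  = sym (*-identityʳ v)
  ... | true  | false | false = sym (*-zeroʳ v)
  ... | false | true  | true  = refl
  ... | false | true  | false = refl
  ... | false | false | true  = refl
  ... | false | false | false = refl

2^-cancel-≤ : ∀ {a b} → 2 ^ a ≤ 2 ^ b → a ≤ b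
2^-cancel-≤ {a} {b} h with a ≤? b
... | yes le = le
... | no nle = ⊥-elim (<⇒≱ (^-monoʳ-< 2 (s≤s (s≤s z≤n)) (≰⇒> nle)) h)

select-property : {P : Fin n → Bool} (tb : TieBreak n w) (s : State n w) (xs : List (Fin n)) {c : Fin n} {cs : List (Fin n)}
  → filterᵇ P xs ≡ c ∷ cs → select tb s c cs ∈ xs × P (select tb s c cs) ≡ true
select-property {P = P} tb s xs {c} {cs} e
  with ∈-filter⁻ (T? ∘ P) {xs = xs} (subst (select tb s c cs ∈_) (sym e) (∈-lookup (tb s c cs)))
... | m , t = m , T⇒≡ t

-- For `N ≥ M` this is an equality: the sum is `4 * 2 ^ M - 2 * M - 4`, and only with the linear
-- term does the induction go through.
∑-level-weights : ∀ N M → ∑ {N} (λ i → 2 ^ suc (toℕ i) * (M ∸ toℕ i)) + (2 * M + 4) ≤ 4 * 2 ^ M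
∑-level-weights zero M = ≤-trans (≤-reflexive (cong (_+ (2 * M + 4)) (∑-empty _))) (base M)
  where
  lem : ∀ m → 2 * suc m + 4 ≡ 2 * m + 4 + 2
  lem = solve-∀
  base : ∀ M → 2 * M + 4 ≤ 4 * 2 ^ M
  base zero    = ≤-refl
  base (suc M) = ≤-trans (≤-reflexive (lem M)) (≤-trans (+-mono-≤ (base M) (*-mono-≤ {2} {4} (s≤s (s≤s z≤n)) (m^n>0 2 M))) (≤-reflexive (lem′ (2 ^ M))))
    where
    lem′ : ∀ x → 4 * x + 4 * x ≡ 4 * (2 * x)
    lem′ = solve-∀
∑-level-weights (suc N) zero = ≤-reflexive (cong (_+ 4) (∑-zero (λ i → trans (cong (2 ^ suc (toℕ i) *_) (0∸n≡0 (toℕ i))) (*-zeroʳ (2 ^ suc (toℕ i))))))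
∑-level-weights (suc N) (suc M) = begin
  ∑ F + (2 * suc M + 4)                              ≡⟨ cong (_+ (2 * suc M + 4)) (∑-suc F) ⟩
  2 * suc M + ∑ (F ∘ suc) + (2 * suc M + 4)          ≡⟨ cong (λ x → 2 * suc M + x + (2 * suc M + 4)) (trans (∑-cong (λ i → *-assoc 2 (2 ^ suc (toℕ i)) (M ∸ toℕ i))) (sym (*-distribˡ-∑ 2 _))) ⟩
  2 * suc M + 2 * ∑ G + (2 * suc M + 4)              ≡⟨ lem M (∑ G) ⟩
  2 * (∑ G + (2 * M + 4))                            ≤⟨ *-monoʳ-≤ 2 (∑-level-weights N M) ⟩
  2 * (4 * 2 ^ M)                                    ≡⟨ lem′ (2 ^ M) ⟩
  4 * 2 ^ suc M                                      ∎
  where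
  open ≤-Reasoning
  F = λ (i : Fin (suc N)) → 2 ^ suc (toℕ i) * (suc M ∸ toℕ i)
  G = λ (i : Fin N) → 2 ^ suc (toℕ i) * (M ∸ toℕ i)
  lem : ∀ m g → 2 * suc m + 2 * g + (2 * suc m + 4) ≡ 2 * (g + (2 * m + 4))
  lem = solve-∀
  lem′ : ∀ x → 2 * (4 * x) ≡ 4 * (2 * x)
  lem′ = solve-∀

-- The while loop

module Amortisation {n w : ℕ} (r κ γ β : ℕ) (γ≡ : γ ≡ 5 + 4 * r) (β≡ : β ≡ 2 * γ + 4) (4≤κ : 4 ≤ κ) (κ-large : β * 136 ≤ 2 ^ κ)
                    (p₀ : Part n w) (valid₀ : Valid p₀) where

  open Potential {n} {w} κ γ β β≡ 4≤κ κ-large p₀ valid₀ public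

  Settled : Part n w → Vec ℕ n → Set
  Settled p b = ∀ z → lookup b z ≤ 2 ^ lev p z

  overfulls : Part n w → Vec ℕ n → ℕ
  overfulls p b = ∑ (λ z → 1 ⟦ 2 ^ lev p z ≤ᵇ lookup b z ⟧)

  overfulls-length : ∀ p b → length (overfull (st p b)) ≡ overfulls p b
  overfulls-length p b = length-filter (λ z → 2 ^ lev p z ≤ᵇ lookup b z)

  none-overfull : ∀ p b → overfulls p b ≤ 0 → Settled p b
  none-overfull p b h z with 2 ^ lev p z ≤ᵇ lookup b z in e
  ... | false = <⇒≤ (≤ᵇ-sound′ (2 ^ lev p z) (lookup b z) e)
  ... | true  = ⊥-elim (<⇒≱ (s≤s z≤n) (≤-trans (≤-reflexive (sym (cong (λ x → 1 ⟦ x ⟧) e))) (≤-trans (term≤∑ (λ z → 1 ⟦ 2 ^ lev p z ≤ᵇ lookup b z ⟧) z) h)))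

  -- `z` drops out, and no item enters: the levels of the others never fall and their budgets stay.
  overfulls-fetch : ∀ {p b z B p′ g X} → Fetched p b z B p′ g X → 2 ^ lev p z ≤ lookup b z
    → suc (overfulls p′ (b [ z ]≔ 0)) ≤ overfulls p b
  overfulls-fetch {p} {b} {z} {p′ = p′} ft full = begin
    suc (∑ o′)                                      ≡⟨ cong (_+ ∑ o′) (sym (∑-single z 1)) ⟩
    ∑ (λ y → 1 ⟦ toℕ y ≡ᵇ toℕ z ⟧) + ∑ o′           ≡⟨ ∑-+ (λ y → 1 ⟦ toℕ y ≡ᵇ toℕ z ⟧) o′ ⟨
    ∑ (λ y → (1 ⟦ toℕ y ≡ᵇ toℕ z ⟧) + o′ y)         ≤⟨ ∑-mono pt ⟩
    ∑ o                                             ∎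
    where
    open ≤-Reasoning
    b′ = b [ z ]≔ 0
    o o′ : Fin n → ℕ
    o y = 1 ⟦ 2 ^ lev p y ≤ᵇ lookup b y ⟧
    o′ y = 1 ⟦ 2 ^ lev p′ y ≤ᵇ lookup b′ y ⟧
    pt : ∀ y → (1 ⟦ toℕ y ≡ᵇ toℕ z ⟧) + o′ y ≤ o y
    pt y with toℕ y ≡ᵇ toℕ z in e
    ... | true rewrite toℕ-injective (≡ᵇ-sound (toℕ y) (toℕ z) e) | Fetched.front ft | lookup∘update z b 0 | ≤ᵇ-true full = ≤-refl
    ... | false with 2 ^ lev p′ y ≤ᵇ lookup b′ y in e′
    ...   | false = z≤n
    ...   | true  = ≤-reflexive (sym (cong (λ x → 1 ⟦ x ⟧) (≤ᵇ-true (begin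
              2 ^ lev p y      ≤⟨ ^-monoʳ-≤ 2 (Fetched.grows ft y ne) ⟩
              2 ^ lev p′ y     ≤⟨ ≤ᵇ-sound (2 ^ lev p′ y) (lookup b′ y) e′ ⟩
              lookup b′ y      ≡⟨ lookup∘update′ ne b 0 ⟩
              lookup b y       ∎))))
      where
      ne : y ≢ z
      ne refl with () ← trans (sym (≡ᵇ-refl (toℕ y))) e

  -- A step is charged for its net movement only, so the distance from its starting point `pˢ` is
  -- recorded and extended by the triangle inequality.
  LoopBound : Part n w → Ledger → Part n w → Vec ℕ n → Ghost → ℕ → ℕ → Set
  LoopBound pˢ B p b g T X = ∀ x → debit B x + S * moveCost pˢ p + T + Φ p b g (place B x) ≤ credit B x + X

  E-loop-fetch : ∀ (pˢ : Part n w) (B : Ledger) (F : State n w × List (Fin n) → ℚ) p b z g T X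
    → Valid p → AllConsistent g → (∀ y → lookup b y ≤ 2 * 2 ^ lev p y) → 2 ^ lev p z ≤ lookup b z
    → LoopBound pˢ B p b g T X
    → (∀ p′ b′ ch g′ T′ X′ → Valid p′ → AllConsistent g′ → (∀ y → lookup b′ y ≤ 2 * 2 ^ lev p′ y)
        → suc (overfulls p′ b′) ≤ overfulls p b → LoopBound pˢ B p′ b′ g′ T′ X′
        → F (st p′ b′ , ch) ℚ.+ ℕtoℚ T′ ℚ.≤ ℕtoℚ (X′ + Γ∑ g′))
    → E (fetch (st p b) z) F ℚ.+ ℕtoℚ T ℚ.≤ ℕtoℚ (X + Γ∑ g)
  E-loop-fetch pˢ B F p b z g T X v c weak full-z bnd cont =
    E-fetch p b z g B₁ X T F v c bnd
      (λ p′ ch′ g′ X′ ft → cont p′ (b [ z ]≔ 0) ch′ g′ (T + S * 2 ^ lev p z) X′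
        (Fetched.valid ft) (Fetched.consistent ft) (weak′ ft) (overfulls-fetch ft full-z) (bnd′ ft))
    where
    B₁ : Ledger
    B₁ = record { Rival = Rival B ; place = place B ; place-valid = place-valid B
                ; debit = λ x → debit B x + S * moveCost pˢ p + T ; credit = credit B }
    weak′ : ∀ {p′ g′ X′} → Fetched p b z B₁ p′ g′ X′ → ∀ y → lookup (b [ z ]≔ 0) y ≤ 2 * 2 ^ lev p′ y
    weak′ {p′} ft y with toℕ y ≡ᵇ toℕ z in e′
    ... | true rewrite toℕ-injective (≡ᵇ-sound (toℕ y) (toℕ z) e′) | lookup∘update z b 0 = z≤n
    ... | false = ≤-trans (≤-reflexive (lookup∘update′ ne b 0)) (≤-trans (weak y) (*-monoʳ-≤ 2 (^-monoʳ-≤ 2 (Fetched.grows ft y ne))))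
      where
      ne : y ≢ z
      ne refl with () ← trans (sym (≡ᵇ-refl (toℕ y))) e′
    bnd′ : ∀ {p′ g′ X′} → Fetched p b z B₁ p′ g′ X′
      → ∀ x → debit B x + S * moveCost pˢ p′ + (T + S * 2 ^ lev p z) + Φ p′ (b [ z ]≔ 0) g′ (place B x) ≤ credit B x + X′
    bnd′ {p′} {g′} {X′} ft x = begin
      D + S * moveCost pˢ p′ + (T + S * 2 ^ ℓ) + Φ′
        ≤⟨ +-monoˡ-≤ Φ′ (+-monoˡ-≤ (T + S * 2 ^ ℓ) (+-monoʳ-≤ D (*-monoʳ-≤ S (≤-trans (moveCost-triangle pˢ p p′) (+-monoʳ-≤ (moveCost pˢ p) (Fetched.moved ft)))))) ⟩
      D + S * (moveCost pˢ p + 3 * 2 ^ ℓ) + (T + S * 2 ^ ℓ) + Φ′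
        ≡⟨ lem D S (moveCost pˢ p) (2 ^ ℓ) T Φ′ ⟩
      D + S * moveCost pˢ p + T + (Φ′ + S * (4 * 2 ^ ℓ))
        ≤⟨ +-monoʳ-≤ (D + S * moveCost pˢ p + T) (+-monoʳ-≤ Φ′ (*-monoʳ-≤ S (φ-slack (lev (place B x) z) ℓ (lookup b z) (weak z) full-z))) ⟩
      D + S * moveCost pˢ p + T + (Φ′ + S * φ (lev (place B x) z) ℓ (lookup b z))
        ≤⟨ Fetched.bounded ft x ⟩
      credit B x + X′ ∎
      where
      open ≤-Reasoning
      ℓ = lev p z
      D = debit B x
      Φ′ = Φ p′ (b [ z ]≔ 0) g′ (place B x)
      lem : ∀ d s m y t f → d + s * (m + 3 * y) + (t + s * y) + f ≡ d + s * m + t + (f + s * (4 * y))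
      lem = solve-∀

  E-loop : ∀ (tb : TieBreak n w) (pˢ : Part n w) (B : Ledger) (F : State n w × List (Fin n) → ℚ)
    → (∀ p b ch g T X → Valid p → AllConsistent g → Settled p b → LoopBound pˢ B p b g T X
        → F (st p b , ch) ℚ.+ ℕtoℚ T ℚ.≤ ℕtoℚ (X + Γ∑ g))
    → ∀ k p b ch g T X → Valid p → AllConsistent g → (∀ z → lookup b z ≤ 2 * 2 ^ lev p z) → overfulls p b ≤ k
    → LoopBound pˢ B p b g T X
    → E (loop tb k (st p b) ch) F ℚ.+ ℕtoℚ T ℚ.≤ ℕtoℚ (X + Γ∑ g)
  E-loop tb pˢ B F cont zero p b ch g T X v c weak few bnd = cont p b ch g T X v c (none-overfull p b few) bnd
  E-loop tb pˢ B F cont (suc k) p b ch g T X v c weak few bnd with overfull (st p b) in e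
  ... | [] = cont p b ch g T X v c (none-overfull p b (≤-reflexive (trans (sym (overfulls-length p b)) (cong length e)))) bnd
  ... | d ∷ ds = E-bind-≤ (fetch (st p b) (select tb (st p b) d ds)) (λ r → loop tb k (proj₁ r) (ch ++ proj₂ r)) F T
    (E-loop-fetch pˢ B (λ r → E (loop tb k (proj₁ r) (ch ++ proj₂ r)) F) p b (select tb (st p b) d ds) g T X v c weak
      (≤ᵇ-sound _ _ (proj₂ (select-property tb (st p b) (allFin n) e))) bnd
      (λ p′ b′ ch′ g′ T′ X′ v′ c′ weak′ fewer bnd′ →
        E-loop tb pˢ B F cont k p′ b′ (ch ++ ch′) g′ T′ X′ v′ c′ weak′ (≤-pred (≤-trans fewer few)) bnd′))

  -- Let `y` attain the offline access cost. If `ℓ` is at most `κ` below the offline level of `y`,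
  -- that cost pays for `γ * 2 ^ ℓ` directly. Otherwise `y` is far, being at level `ℓ` or deeper.
  -- For `y = x` the fetch has released at least `γ * 2 ^ ℓ`; for `y ≢ x` the deposit on `y` lowers
  -- its potential by that amount.
  charge-bound : ∀ {p b x B p′ g X} (R : Subset n) → Nonempty R → ∣ R ∣ ≤ r → Settled p b
    → (∀ y → lookup R y ≡ true → lev p x ≤ lev p y) → Fetched p b x B p′ g X → ∀ p*
    → 5 * 2 ^ lev p x + φ∑ p′ (addBudget (b [ x ]≔ 0) (filterᵇ (λ y → not (toℕ y ≡ᵇ toℕ x)) (members R)) (2 ^ lev p x)) p*
      ≤ φ∑ p′ (b [ x ]≔ 0) p* + φ (lev p* x) (lev p x) (lookup b x) + γ * 2 ^ κ * accessCost p* R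
  charge-bound {p} {b} {x} {p′ = p′} R ne R≤r set least ft p* with accessCost-attained p* R ne
  ... | y , y∈R , acc≡ = cases
    where
    open ≤-Reasoning
    ℓ = lev p x
    v = 2 ^ ℓ
    b₁ = b [ x ]≔ 0
    b₂ = addBudget b₁ (filterᵇ (λ y → not (toℕ y ≡ᵇ toℕ x)) (members R)) v
    acc = accessCost p* R
    q = charged R x
    f₁ f₂ : Fin n → ℕ
    f₁ z = φ (lev p* z) (lev p′ z) (lookup b₁ z)
    f₂ z = φ (lev p* z) (lev p′ z) (lookup b₂ z)
    φx = φ (lev p* x) ℓ (lookup b x)
    pt : ∀ z → f₂ z ≤ f₁ z + 4 * (v * q z)
    pt z rewrite lookup-charge b₁ R x v z = φ-deposit (lev p* z) (lev p′ z) (lookup b₁ z) (v * q z)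
    total : ∑ (λ z → 4 * (v * q z)) ≤ 4 * r * v
    total = begin
      ∑ (λ z → 4 * (v * q z))    ≡⟨ ∑-cong (λ z → sym (*-assoc 4 v (q z))) ⟩
      ∑ (λ z → 4 * v * q z)      ≡⟨ *-distribˡ-∑ (4 * v) q ⟨
      4 * v * ∑ q                ≤⟨ *-monoʳ-≤ (4 * v) (≤-trans (charged-total R x) R≤r) ⟩
      4 * v * r                  ≡⟨ lem v r ⟩
      4 * r * v                  ∎
      where
      lem : ∀ v r → 4 * v * r ≡ 4 * r * v
      lem = solve-∀
    deposits : ∑ f₂ ≤ ∑ f₁ + 4 * r * v
    deposits = ≤-trans (∑-mono pt) (≤-trans (≤-reflexive (∑-+ f₁ _)) (+-monoʳ-≤ (∑ f₁) total))
    γv : ∀ X → 5 * v + (X + 4 * r * v) ≡ X + γ * v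
    γv X = trans (lem v X r) (cong (λ g → X + g * v) (sym γ≡))
      where
      lem : ∀ v X r → 5 * v + (X + 4 * r * v) ≡ X + (5 + 4 * r) * v
      lem = solve-∀
    cases : 5 * v + ∑ f₂ ≤ ∑ f₁ + φx + γ * 2 ^ κ * acc
    cases with ℓ ≤? lev p* y + κ
    ... | yes h = begin
      5 * v + ∑ f₂                     ≤⟨ +-monoʳ-≤ (5 * v) deposits ⟩
      5 * v + (∑ f₁ + 4 * r * v)       ≡⟨ γv (∑ f₁) ⟩
      ∑ f₁ + γ * v                     ≤⟨ +-mono-≤ (m≤m+n (∑ f₁) φx) (*-monoʳ-≤ γ (^-monoʳ-≤ 2 h)) ⟩
      ∑ f₁ + φx + γ * 2 ^ (lev p* y + κ) ≡⟨ cong (λ e → ∑ f₁ + φx + e) (trans (cong (γ *_) (trans (^-distribˡ-+-* 2 (lev p* y) κ) (*-comm (2 ^ lev p* y) (2 ^ κ))))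
                                              (trans (sym (*-assoc γ (2 ^ κ) _)) (cong (γ * 2 ^ κ *_) (sym acc≡)))) ⟩
      ∑ f₁ + φx + γ * 2 ^ κ * acc      ∎
    ... | no  h with toℕ y ≡ᵇ toℕ x in e
    ...   | true = begin
      5 * v + ∑ f₂                     ≤⟨ +-monoʳ-≤ (5 * v) deposits ⟩
      5 * v + (∑ f₁ + 4 * r * v)       ≡⟨ γv (∑ f₁) ⟩
      ∑ f₁ + γ * v                     ≤⟨ +-monoʳ-≤ (∑ f₁) (φ-far-large (lev p* x) ℓ (lookup b x) far (set x)) ⟩
      ∑ f₁ + φx                        ≤⟨ m≤m+n _ _ ⟩
      ∑ f₁ + φx + γ * 2 ^ κ * acc      ∎
      where
      far : lev p* x + κ < ℓ
      far = subst (λ z → lev p* z + κ < ℓ) (toℕ-injective (≡ᵇ-sound (toℕ y) (toℕ x) e)) (≰⇒> h)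
    ...   | false = +-cancelʳ-≤ (γ * v) _ _ (begin
      5 * v + ∑ f₂ + γ * v             ≡⟨ +-assoc (5 * v) (∑ f₂) (γ * v) ⟩
      5 * v + (∑ f₂ + γ * v)           ≤⟨ +-monoʳ-≤ (5 * v) special ⟩
      5 * v + (∑ f₁ + 4 * r * v)       ≡⟨ γv (∑ f₁) ⟩
      ∑ f₁ + γ * v                     ≤⟨ +-monoˡ-≤ (γ * v) (≤-trans (m≤m+n (∑ f₁) φx) (m≤m+n _ _)) ⟩
      ∑ f₁ + φx + γ * 2 ^ κ * acc + γ * v ∎)
      where
      y≢x : y ≢ x
      y≢x refl with () ← trans (sym (≡ᵇ-refl (toℕ y))) e
      lev≤ : ℓ ≤ lev p′ y
      lev≤ = ≤-trans (least y y∈R) (Fetched.grows ft y y≢x)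
      small : lookup b₁ y + v ≤ 2 * 2 ^ lev p′ y
      small = ≤-trans (+-mono-≤ (≤-trans (≤-reflexive (lookup∘update′ y≢x b 0)) (≤-trans (set y) (^-monoʳ-≤ 2 (Fetched.grows ft y y≢x)))) (^-monoʳ-≤ 2 lev≤))
                (≤-reflexive (cong (2 ^ lev p′ y +_) (sym (+-identityʳ _))))
      drop : f₂ y + γ * v ≤ f₁ y
      drop = subst (λ β → φ (lev p* y) (lev p′ y) β + γ * v ≤ f₁ y)
        (sym (trans (lookup-charge b₁ R x v y) (cong (lookup b₁ y +_) (trans (cong (v *_) (charged-other R y≢x y∈R)) (*-identityʳ v)))))
        (φ-deposit-far (lev p* y) (lev p′ y) (lookup b₁ y) v (≤-trans (≰⇒> h) lev≤) small)
      pt′ : ∀ z → f₂ z + (γ * v ⟦ toℕ z ≡ᵇ toℕ y ⟧) ≤ f₁ z + 4 * (v * q z)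
      pt′ z with toℕ z ≡ᵇ toℕ y in e′
      ... | false = ≤-trans (≤-reflexive (+-identityʳ _)) (pt z)
      ... | true  = subst (λ z → f₂ z + γ * v ≤ f₁ z + 4 * (v * q z)) (sym (toℕ-injective (≡ᵇ-sound (toℕ z) (toℕ y) e′))) (≤-trans drop (m≤m+n _ _))
      special : ∑ f₂ + γ * v ≤ ∑ f₁ + 4 * r * v
      special = begin
        ∑ f₂ + γ * v                                         ≡⟨ cong (∑ f₂ +_) (∑-single y (γ * v)) ⟨
        ∑ f₂ + ∑ (λ z → γ * v ⟦ toℕ z ≡ᵇ toℕ y ⟧)            ≡⟨ ∑-+ f₂ _ ⟨
        ∑ (λ z → f₂ z + (γ * v ⟦ toℕ z ≡ᵇ toℕ y ⟧))          ≤⟨ ∑-mono pt′ ⟩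
        ∑ (λ z → f₁ z + 4 * (v * q z))                       ≡⟨ ∑-+ f₁ _ ⟩
        ∑ f₁ + ∑ (λ z → 4 * (v * q z))                       ≤⟨ +-monoʳ-≤ (∑ f₁) total ⟩
        ∑ f₁ + 4 * r * v                                     ∎

-- Whole runs

module Competition {n w : ℕ} (r κ γ β : ℕ) (γ≡ : γ ≡ 5 + 4 * r) (β≡ : β ≡ 2 * γ + 4) (4≤κ : 4 ≤ κ) (κ-large : β * 136 ≤ 2 ^ κ)
                   (p₀ : Part n w) (valid₀ : Valid p₀) where

  open Amortisation {n} {w} r κ γ β γ≡ β≡ 4≤κ κ-large p₀ valid₀

  charged-weak : ∀ {p b x B p′ g X} (R : Subset n) → Settled p b
    → (∀ y → lookup R y ≡ true → lev p x ≤ lev p y) → Fetched p b x B p′ g X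
    → ∀ z → lookup (addBudget (b [ x ]≔ 0) (filterᵇ (λ y → not (toℕ y ≡ᵇ toℕ x)) (members R)) (2 ^ lev p x)) z ≤ 2 * 2 ^ lev p′ z
  charged-weak {p} {b} {x} {p′ = p′} R set least ft z =
    ≤-trans (≤-reflexive (lookup-charge (b [ x ]≔ 0) R x v z)) (bound (toℕ z ≡ᵇ toℕ x) refl)
    where
    v = 2 ^ lev p x
    bound : ∀ e → (toℕ z ≡ᵇ toℕ x) ≡ e → lookup (b [ x ]≔ 0) z + v * charged R x z ≤ 2 * 2 ^ lev p′ z
    bound true e rewrite toℕ-injective (≡ᵇ-sound (toℕ z) (toℕ x) e) | lookup∘update x b 0 | charged-self R x | *-zeroʳ v = z≤n
    bound false e = +-mono-≤ (≤-trans (≤-reflexive (lookup∘update′ ne b 0)) (≤-trans (set z) grow)) (requested (lookup R z) refl)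
      where
      ne : z ≢ x
      ne refl with () ← trans (sym (≡ᵇ-refl (toℕ z))) e
      grow : 2 ^ lev p z ≤ 2 ^ lev p′ z
      grow = ^-monoʳ-≤ 2 (Fetched.grows ft z ne)
      requested : ∀ f → lookup R z ≡ f → v * charged R x z ≤ 2 ^ lev p′ z + 0
      requested true h = begin
        v * charged R x z   ≡⟨ trans (cong (v *_) (charged-other R ne h)) (*-identityʳ v) ⟩
        v                   ≤⟨ ^-monoʳ-≤ 2 (least z h) ⟩
        2 ^ lev p z         ≤⟨ grow ⟩
        2 ^ lev p′ z        ≡⟨ +-identityʳ _ ⟨
        2 ^ lev p′ z + 0    ∎
        where open ≤-Reasoning
      requested false h = ≤-trans (*-monoʳ-≤ v (≤-trans (charged≤ R x z) (≤-reflexive (cong (λ f → 1 ⟦ f ⟧) h)))) (≤-trans (≤-reflexive (*-zeroʳ v)) z≤n)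

  StepBound : Ledger → Subset n → ℕ → Part n w → Vec ℕ n → Ghost → ℕ → ℕ → Set
  StepBound B R c p b g T X =
    ∀ x → debit B x + S * c + T + Φ p b g (place B x) ≤ credit B x + S * (γ * 2 ^ κ * accessCost (place B x) R) + X

  E-serve : ∀ (tbz : TieBreak n w) (R : Subset n) (B : Ledger) (F : State n w × List (Fin n) × ℕ → ℚ) p b x g T X
    → Nonempty R → ∣ R ∣ ≤ r → Valid p → AllConsistent g → Settled p b
    → (∀ y → lookup R y ≡ true → lev p x ≤ lev p y)
    → (∀ y → debit B y + T + Φ p b g (place B y) ≤ credit B y + X)
    → (∀ p′ b′ ch c g′ T′ X′ → Valid p′ → AllConsistent g′ → Settled p′ b′ → StepBound B R c p′ b′ g′ T′ X′
        → F (st p′ b′ , ch , c) ℚ.+ ℕtoℚ T′ ℚ.≤ ℕtoℚ (X′ + Γ∑ g′))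
    → E (fetch (st p b) x >>= λ f →
           loop tbz n (st (State.part (proj₁ f)) (addBudget (State.budget (proj₁ f)) (filterᵇ (λ y → not (toℕ y ≡ᵇ toℕ x)) (members R)) (2 ^ lev p x)))
                (proj₂ f) >>= λ f′ →
           ret (proj₁ f′ , proj₂ f′ , 2 ^ lev p x + moveCost p (State.part (proj₁ f′)))) F ℚ.+ ℕtoℚ T
      ℚ.≤ ℕtoℚ (X + Γ∑ g)
  E-serve tbz R B F p b x g T X ne R≤r v c set least bnd cont =
    E-bind-≤ (fetch (st p b) x) afterFetch F T
      (E-fetch p b x g B₁ X T (λ f → E (afterFetch f) F) v c bnd
        (λ p₁ ch g₁ X₁ ft → E-bind-≤ (afterCharge p₁ ch) afterLoop F (T + S * 2 ^ ℓ)
          (E-loop tbz p B₂ (λ f → E (afterLoop f) F)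
            (λ p′ b′ ch′ g′ T′ X′ v′ c′ set′ bnd′ → cont p′ b′ ch′ (2 ^ ℓ + moveCost p p′) g′ T′ X′ v′ c′ set′ (finish p′ b′ g′ T′ X′ bnd′))
            n p₁ (charge′ (b [ x ]≔ 0)) ch g₁ (T + S * 2 ^ ℓ) X₁ (Fetched.valid ft) (Fetched.consistent ft)
            (charged-weak R set least ft) (count≤n p₁ (charge′ (b [ x ]≔ 0))) (begin-loop p₁ g₁ X₁ ft))))
    where
    ℓ = lev p x
    charge′ : Vec ℕ n → Vec ℕ n
    charge′ b = addBudget b (filterᵇ (λ y → not (toℕ y ≡ᵇ toℕ x)) (members R)) (2 ^ ℓ)
    afterLoop : State n w × List (Fin n) → Rand n (State n w × List (Fin n) × ℕ)
    afterLoop f′ = ret (proj₁ f′ , proj₂ f′ , 2 ^ ℓ + moveCost p (State.part (proj₁ f′)))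
    afterCharge : Part n w → List (Fin n) → Rand n (State n w × List (Fin n))
    afterCharge p₁ ch = loop tbz n (st p₁ (charge′ (b [ x ]≔ 0))) ch
    afterFetch : State n w × List (Fin n) → Rand n (State n w × List (Fin n) × ℕ)
    afterFetch f = loop tbz n (st (State.part (proj₁ f)) (charge′ (State.budget (proj₁ f)))) (proj₂ f) >>= afterLoop
    B₁ B₂ : Ledger
    B₁ = record { Rival = Rival B ; place = place B ; place-valid = place-valid B
                ; debit = λ y → debit B y + T ; credit = credit B }
    B₂ = record { Rival = Rival B ; place = place B ; place-valid = place-valid B
                ; debit = λ y → debit B y + S * 2 ^ ℓ
                ; credit = λ y → credit B y + S * (γ * 2 ^ κ * accessCost (place B y) R) }
    count≤n : ∀ p b → overfulls p b ≤ n
    count≤n p b = ≤-trans (∑-mono (λ z → ⟦⟧-≤ (2 ^ lev p z ≤ᵇ lookup b z) ≤-refl)) (≤-reflexive (trans (∑-const n 1) (*-identityʳ n)))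
    -- The first fetch consumes `5 * 2 ^ ℓ`: one part for the access, three for the movement, one
    -- for the reserve.
    begin-loop : ∀ p₁ g₁ X₁ → Fetched p b x B₁ p₁ g₁ X₁ → LoopBound p B₂ p₁ (charge′ (b [ x ]≔ 0)) g₁ (T + S * 2 ^ ℓ) X₁
    begin-loop p₁ g₁ X₁ ft y = begin
      D + S * 2 ^ ℓ + S * moveCost p p₁ + (T + S * 2 ^ ℓ) + (S * φ₂ + Ψ₁)
        ≤⟨ +-monoˡ-≤ (S * φ₂ + Ψ₁) (+-monoˡ-≤ (T + S * 2 ^ ℓ) (+-monoʳ-≤ (D + S * 2 ^ ℓ) (*-monoʳ-≤ S (Fetched.moved ft)))) ⟩
      D + S * 2 ^ ℓ + S * (3 * 2 ^ ℓ) + (T + S * 2 ^ ℓ) + (S * φ₂ + Ψ₁)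
        ≡⟨ lem₁ D S (2 ^ ℓ) T φ₂ Ψ₁ ⟩
      D + T + Ψ₁ + S * (5 * 2 ^ ℓ + φ₂)
        ≤⟨ +-monoʳ-≤ (D + T + Ψ₁) (*-monoʳ-≤ S (charge-bound R ne R≤r set least ft (place B y))) ⟩
      D + T + Ψ₁ + S * (φ₁ + φx + A)
        ≡⟨ lem₂ D T Ψ₁ S φ₁ φx A ⟩
      D + T + (S * φ₁ + Ψ₁ + S * φx) + S * A
        ≤⟨ +-monoˡ-≤ (S * A) (Fetched.bounded ft y) ⟩
      credit B y + X₁ + S * A
        ≡⟨ lem₃ (credit B y) X₁ (S * A) ⟩
      credit B y + S * A + X₁ ∎
      where
      open ≤-Reasoning
      D = debit B y
      p* = place B y
      φ₁ = φ∑ p₁ (b [ x ]≔ 0) p*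
      φ₂ = φ∑ p₁ (charge′ (b [ x ]≔ 0)) p*
      φx = φ (lev p* x) ℓ (lookup b x)
      Ψ₁ = Ψ∑ g₁ p*
      A = γ * 2 ^ κ * accessCost p* R
      lem₁ : ∀ D S v T f y → D + S * v + S * (3 * v) + (T + S * v) + (S * f + y) ≡ D + T + y + S * (5 * v + f)
      lem₁ = solve-∀
      lem₂ : ∀ D T y S f x a → D + T + y + S * (f + x + a) ≡ D + T + (S * f + y + S * x) + S * a
      lem₂ = solve-∀
      lem₃ : ∀ x y z → x + y + z ≡ x + z + y
      lem₃ = solve-∀
    finish : ∀ p′ b′ g′ T′ X′ → LoopBound p B₂ p′ b′ g′ T′ X′ → StepBound B R (2 ^ ℓ + moveCost p p′) p′ b′ g′ T′ X′
    finish p′ b′ g′ T′ X′ h y = ≤-trans (≤-reflexive (cong (λ e → e + T′ + Φ p′ b′ g′ (place B y))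
      (trans (cong (debit B y +_) (*-distribˡ-+ S (2 ^ ℓ) (moveCost p p′))) (sym (+-assoc (debit B y) (S * 2 ^ ℓ) _))))) (h y)

  E-step : ∀ (tbx tbz : TieBreak n w) (R : Subset n) (B : Ledger) (F : State n w × List (Fin n) × ℕ → ℚ) p b g T X
    → Nonempty R → ∣ R ∣ ≤ r → Valid p → AllConsistent g → Settled p b
    → (∀ y → debit B y + T + Φ p b g (place B y) ≤ credit B y + X)
    → (∀ p′ b′ ch c g′ T′ X′ → Valid p′ → AllConsistent g′ → Settled p′ b′ → StepBound B R c p′ b′ g′ T′ X′
        → F (st p′ b′ , ch , c) ℚ.+ ℕtoℚ T′ ℚ.≤ ℕtoℚ (X′ + Γ∑ g′))
    → E (lmaStep tbx tbz R (st p b)) F ℚ.+ ℕtoℚ T ℚ.≤ ℕtoℚ (X + Γ∑ g)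
  E-step tbx tbz R B F p b g T X ne R≤r v c set bnd cont
    with filterᵇ (λ x → size p x ≡ᵇ accessCost p R) (members R) in e
  -- A nonempty request has a cheapest item, so this branch never arises. Since it changes nothing
  -- at cost `0`, the bound holds here without an argument for that.
  ... | [] = cont p b [] 0 g T X v c set idle
    where
    idle : StepBound B R 0 p b g T X
    idle y = begin
      debit B y + S * 0 + T + Φ p b g (place B y)  ≡⟨ cong (λ x → x + T + Φ p b g (place B y)) (trans (cong (debit B y +_) (*-zeroʳ S)) (+-identityʳ _)) ⟩
      debit B y + T + Φ p b g (place B y)          ≤⟨ bnd y ⟩
      credit B y + X                               ≤⟨ +-monoˡ-≤ X (m≤m+n (credit B y) _) ⟩
      credit B y + S * (γ * 2 ^ κ * accessCost (place B y) R) + X ∎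
      where open ≤-Reasoning
  ... | d ∷ ds = E-serve tbz R B F p b (select tbx (st p b) d ds) g T X ne R≤r v c set least bnd cont
    where
    least : ∀ y → lookup R y ≡ true → lev p (select tbx (st p b) d ds) ≤ lev p y
    least y y∈R = 2^-cancel-≤ (≤-trans (≤-reflexive (≡ᵇ-sound _ _ (proj₂ (select-property tbx (st p b) (members R) e)))) (accessCost-lower p R y∈R))

  -- On level `i` a moved item exposes at most `M - i` counters worth `wt i` each, with
  -- `M = lev p* z + κ`. Summed over `i` this is at most `4 * β * 2 ^ M`, hence proportional to the
  -- size at the old offline level.
  Ψ∑-move : ∀ g p* q* → Ψ∑ g q* ≤ Ψ∑ g p* + S * (β * 4 * 2 ^ κ * moveCost p* q*)
  Ψ∑-move g p* q* = begin
    Ψ∑ g q*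
      ≤⟨ ∑-mono (λ i → Ψ-move (toℕ i) (g i) p* q*) ⟩
    ∑ (λ i → Ψ (toℕ i) (g i) p* + S * wt (toℕ i) * ∑ (D i))
      ≡⟨ ∑-+ (λ i → Ψ (toℕ i) (g i) p*) (λ i → S * wt (toℕ i) * ∑ (D i)) ⟩
    Ψ∑ g p* + ∑ (λ i → S * wt (toℕ i) * ∑ (D i))
      ≡⟨ cong (Ψ∑ g p* +_) (trans (∑-cong (λ i → trans (*-assoc S (wt (toℕ i)) _) (cong (S *_) (*-distribˡ-∑ (wt (toℕ i)) (D i))))) (sym (*-distribˡ-∑ S _))) ⟩
    Ψ∑ g p* + S * ∑ (λ i → ∑ (λ z → wt (toℕ i) * D i z))
      ≡⟨ cong (λ x → Ψ∑ g p* + S * x) (∑-comm (λ i z → wt (toℕ i) * D i z)) ⟩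
    Ψ∑ g p* + S * ∑ (λ z → ∑ (λ i → wt (toℕ i) * D i z))
      ≤⟨ +-monoʳ-≤ (Ψ∑ g p*) (*-monoʳ-≤ S (∑-mono pt)) ⟩
    Ψ∑ g p* + S * ∑ (λ z → β * 4 * 2 ^ κ * mv (lev p* z) (lev q* z))
      ≡⟨ cong (λ x → Ψ∑ g p* + S * x) (trans (sym (*-distribˡ-∑ (β * 4 * 2 ^ κ) _)) (cong (β * 4 * 2 ^ κ *_) (sym (moveCost-∑ p* q*)))) ⟩
    Ψ∑ g p* + S * (β * 4 * 2 ^ κ * moveCost p* q*) ∎
    where
    open ≤-Reasoning
    D : Fin w → Fin n → ℕ
    D i z = (lev p* z + κ ∸ toℕ i) ⟦ not (lev p* z ≡ᵇ lev q* z) ⟧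
    pt : ∀ z → ∑ (λ i → wt (toℕ i) * D i z) ≤ β * 4 * 2 ^ κ * mv (lev p* z) (lev q* z)
    pt z with lev p* z ≡ᵇ lev q* z
    ... | true  = ≤-trans (≤-reflexive (∑-zero (λ (i : Fin w) → *-zeroʳ (wt (toℕ i))))) z≤n
    ... | false = begin
      ∑ {w} (λ i → β * 2 ^ suc (toℕ i) * (M ∸ toℕ i))    ≡⟨ ∑-cong {w} (λ i → *-assoc β (2 ^ suc (toℕ i)) (M ∸ toℕ i)) ⟩
      ∑ {w} (λ i → β * (2 ^ suc (toℕ i) * (M ∸ toℕ i)))  ≡⟨ *-distribˡ-∑ {w} β _ ⟨
      β * ∑ {w} (λ i → 2 ^ suc (toℕ i) * (M ∸ toℕ i))    ≤⟨ *-monoʳ-≤ β (≤-trans (m≤m+n _ _) (∑-level-weights w M)) ⟩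
      β * (4 * 2 ^ M)                                ≡⟨ cong (λ x → β * (4 * x)) (^-distribˡ-+-* 2 (lev p* z) κ) ⟩
      β * (4 * (2 ^ lev p* z * 2 ^ κ))               ≡⟨ lem β (2 ^ lev p* z) (2 ^ κ) ⟩
      β * 4 * 2 ^ κ * 2 ^ lev p* z                   ≤⟨ *-monoʳ-≤ (β * 4 * 2 ^ κ) (m≤m⊔n (2 ^ lev p* z) (2 ^ lev q* z)) ⟩
      β * 4 * 2 ^ κ * (2 ^ lev p* z ⊔ 2 ^ lev q* z)  ∎
      where
      M = lev p* z + κ
      lem : ∀ b x y → b * (4 * (x * y)) ≡ b * 4 * y * x
      lem = solve-∀

  -- The factor `5` is `1` for `φ` and `4` for the counters. The offline move is accounted for after
  -- the online step, when the budgets are settled as `φ-opt` requires.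
  Φ-move : ∀ p b g p* q* → Settled p b → Φ p b g q* ≤ Φ p b g p* + S * (β * 5 * 2 ^ κ * moveCost p* q*)
  Φ-move p b g p* q* set = begin
    S * φ∑ p b q* + Ψ∑ g q*
      ≤⟨ +-mono-≤ (*-monoʳ-≤ S main) (Ψ∑-move g p* q*) ⟩
    S * (φ∑ p b p* + β * 2 ^ κ * m) + (Ψ∑ g p* + S * (β * 4 * 2 ^ κ * m))
      ≡⟨ lem S (φ∑ p b p*) β (2 ^ κ) m (Ψ∑ g p*) ⟩
    S * φ∑ p b p* + Ψ∑ g p* + S * (β * 5 * 2 ^ κ * m) ∎
    where
    open ≤-Reasoning
    m = moveCost p* q*
    lem : ∀ s f b x m y → s * (f + b * x * m) + (y + s * (b * 4 * x * m)) ≡ s * f + y + s * (b * 5 * x * m)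
    lem = solve-∀
    main : φ∑ p b q* ≤ φ∑ p b p* + β * 2 ^ κ * m
    main = begin
      φ∑ p b q*
        ≤⟨ ∑-mono (λ z → φ-opt (lev p* z) (lev q* z) (lev p z) (lookup b z) (set z)) ⟩
      ∑ (λ z → φ (lev p* z) (lev p z) (lookup b z) + β * 2 ^ κ * mv (lev p* z) (lev q* z))
        ≡⟨ ∑-+ _ _ ⟩
      φ∑ p b p* + ∑ (λ z → β * 2 ^ κ * mv (lev p* z) (lev q* z))
        ≡⟨ cong (φ∑ p b p* +_) (trans (sym (*-distribˡ-∑ (β * 2 ^ κ) _)) (cong (β * 2 ^ κ *_) (sym (moveCost-∑ p* q*)))) ⟩
      φ∑ p b p* + β * 2 ^ κ * m ∎

  ι-ledger : ∀ a t k x → a + t ≤ k + x → ℕtoℚ a ℚ.- ℕtoℚ k ℚ.+ ℕtoℚ t ℚ.≤ ℕtoℚ x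
  ι-ledger a t k x h = begin
    ℕtoℚ a ℚ.- ℕtoℚ k ℚ.+ ℕtoℚ t          ≡⟨ trans (ℚP.+-assoc (ℕtoℚ a) (ℚ.- ℕtoℚ k) (ℕtoℚ t)) (trans (cong (ℕtoℚ a ℚ.+_) (ℚP.+-comm (ℚ.- ℕtoℚ k) (ℕtoℚ t))) (sym (ℚP.+-assoc (ℕtoℚ a) (ℕtoℚ t) (ℚ.- ℕtoℚ k)))) ⟩
    ℕtoℚ a ℚ.+ ℕtoℚ t ℚ.- ℕtoℚ k          ≡⟨ cong (ℚ._- ℕtoℚ k) (ι-+ a t) ⟨
    ℕtoℚ (a + t) ℚ.- ℕtoℚ k               ≤⟨ ℚP.+-monoˡ-≤ (ℚ.- ℕtoℚ k) (ι-mono h) ⟩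
    ℕtoℚ (k + x) ℚ.- ℕtoℚ k               ≡⟨ cong (ℚ._- ℕtoℚ k) (trans (cong ℕtoℚ (+-comm k x)) (ι-+ x k)) ⟩
    ℕtoℚ x ℚ.+ ℕtoℚ k ℚ.- ℕtoℚ k          ≡⟨ trans (ℚP.+-assoc (ℕtoℚ x) (ℕtoℚ k) (ℚ.- ℕtoℚ k)) (trans (cong (ℕtoℚ x ℚ.+_) (ℚP.+-inverseʳ (ℕtoℚ k))) (ℚP.+-identityʳ (ℕtoℚ x))) ⟩
    ℕtoℚ x                                ∎
    where open ℚP.≤-Reasoning

  module _ (tbx tbz : TieBreak n w) (adv : Adversary n r) (K : ℕ) (access≤K : γ * 2 ^ κ ≤ K) (move≤K : β * 5 * 2 ^ κ ≤ K) where

    -- Rivals are the offline solutions of the requests served so far; V is the optimum as a function of the remaining ones.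
    E-run : ∀ m (Rv : Set) (pl : Rv → Part n w) → (∀ y → Valid (pl y)) → (off : Rv → ℕ) (V : List (Subset n) → ℕ)
      → ∀ (F : ℕ × List (Subset n) → ℚ) c T X p b g h
      → Valid p → AllConsistent g → Settled p b
      → (∀ y → S * c + T + Φ p b g (pl y) ≤ S * (K * off y) + X)
      → (∀ Rs → length Rs ≡ m → ∃[ y ] ∃[ qs ] AllValid qs × length qs ≡ m × V Rs ≡ off y + offCost (pl y) Rs qs)
      → (∀ o → F o ≡ ℕtoℚ (S * (c + proj₁ o)) ℚ.- ℕtoℚ (S * (K * V (proj₂ o))))
      → E (run tbx tbz adv m (st p b) h) F ℚ.+ ℕtoℚ T ℚ.≤ ℕtoℚ (X + Γ∑ g)
    E-run zero Rv pl plV off V F c T X p b g h v con set bnd opt hF with opt [] refl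
    ... | y , qs , _ , _ , V≡ = ℚP.≤-trans (ℚP.≤-reflexive (cong (ℚ._+ ℕtoℚ T) (hF (0 , []))))
      (ℚP.≤-trans (ι-ledger (S * (c + 0)) T (S * (K * V [])) X final) (ι-mono (m≤m+n X (Γ∑ g))))
      where
      final : S * (c + 0) + T ≤ S * (K * V []) + X
      final = begin
        S * (c + 0) + T                ≡⟨ cong (λ x → S * x + T) (+-identityʳ c) ⟩
        S * c + T                      ≤⟨ m≤m+n _ (Φ p b g (pl y)) ⟩
        S * c + T + Φ p b g (pl y)     ≤⟨ bnd y ⟩
        S * (K * off y) + X            ≡⟨ cong (λ x → S * (K * x) + X) (sym (trans V≡ (+-identityʳ (off y)))) ⟩
        S * (K * V []) + X             ∎
        where open ≤-Reasoning
    E-run (suc m) Rv pl plV off V F c T X p b g h v con set bnd opt hF =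
      E-bind-≤ (lmaStep tbx tbz R (st p b)) rest F T
        (E-step tbx tbz R B (λ f → E (rest f) F) p b g T X (proj₁ (proj₂ (adv h))) (proj₂ (proj₂ (adv h))) v con set bnd
          (λ p′ b′ ch d g′ T′ X′ v′ con′ set′ bnd′ →
            E-bind-≤ (run tbx tbz adv m (st p′ b′) (h ++ [ ch ])) (λ o → ret (d + proj₁ o , R ∷ proj₂ o)) F T′
              -- Every rival branches into all valid next partitionings, since the draws still to
              -- come may make any of them optimal.
              (E-run m (Rv × Σ (Part n w) Valid) (λ y → proj₁ (proj₂ y)) (λ y → proj₂ (proj₂ y)) off′ (λ Rs → V (R ∷ Rs))
                (λ o → F (d + proj₁ o , R ∷ proj₂ o)) (c + d) T′ X′ p′ b′ g′ (h ++ [ ch ]) v′ con′ set′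
                (extend p′ b′ d g′ T′ X′ set′ bnd′) opt′
                (λ o → trans (hF (d + proj₁ o , R ∷ proj₂ o)) (cong (λ x → ℕtoℚ (S * x) ℚ.- ℕtoℚ (S * (K * V (R ∷ proj₂ o)))) (sym (+-assoc c d (proj₁ o))))))))
      where
      R = proj₁ (adv h)
      rest : State n w × List (Fin n) × ℕ → Rand n (ℕ × List (Subset n))
      rest f = run tbx tbz adv m (proj₁ f) (h ++ [ proj₁ (proj₂ f) ]) >>= λ o → ret (proj₂ (proj₂ f) + proj₁ o , R ∷ proj₂ o)
      B : Ledger
      B = record { Rival = Rv ; place = pl ; place-valid = plV ; debit = λ _ → S * c ; credit = λ y → S * (K * off y) }
      off′ : Rv × Σ (Part n w) Valid → ℕ
      off′ (y , q , _) = off y + (accessCost (pl y) R + moveCost (pl y) q)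
      opt′ : ∀ Rs → length Rs ≡ m → ∃[ y ] ∃[ qs ] AllValid qs × length qs ≡ m × V (R ∷ Rs) ≡ off′ y + offCost (proj₁ (proj₂ y)) Rs qs
      opt′ Rs len with opt (R ∷ Rs) (cong suc len)
      ... | y , q ∷ qs , (vq , vqs) , lq , V≡ = (y , q , vq) , qs , vqs , suc-injective lq ,
        trans V≡ (sym (+-assoc (off y) (accessCost (pl y) R + moveCost (pl y) q) (offCost q Rs qs)))
      extend : ∀ p′ b′ d g′ T′ X′ → Settled p′ b′ → StepBound B R d p′ b′ g′ T′ X′
        → ∀ y → S * (c + d) + T′ + Φ p′ b′ g′ (proj₁ (proj₂ y)) ≤ S * (K * off′ y) + X′
      extend p′ b′ d g′ T′ X′ set′ bnd′ (y , q , _) = begin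
        S * (c + d) + T′ + Φ p′ b′ g′ q
          ≤⟨ +-mono-≤ (≤-reflexive (cong (_+ T′) (*-distribˡ-+ S c d))) (Φ-move p′ b′ g′ (pl y) q set′) ⟩
        S * c + S * d + T′ + (Φ p′ b′ g′ (pl y) + S * (β * 5 * 2 ^ κ * M))
          ≡⟨ +-assoc (S * c + S * d + T′) _ _ ⟨
        S * c + S * d + T′ + Φ p′ b′ g′ (pl y) + S * (β * 5 * 2 ^ κ * M)
          ≤⟨ +-mono-≤ (bnd′ y) (*-monoʳ-≤ S (*-monoˡ-≤ M move≤K)) ⟩
        S * (K * off y) + S * (γ * 2 ^ κ * A) + X′ + S * (K * M)
          ≤⟨ +-monoˡ-≤ (S * (K * M)) (+-monoˡ-≤ X′ (+-monoʳ-≤ (S * (K * off y)) (*-monoʳ-≤ S (*-monoˡ-≤ A access≤K)))) ⟩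
        S * (K * off y) + S * (K * A) + X′ + S * (K * M)
          ≡⟨ lem S K (off y) A X′ M ⟩
        S * (K * (off y + (A + M))) + X′ ∎
        where
        open ≤-Reasoning
        A = accessCost (pl y) R
        M = moveCost (pl y) q
        lem : ∀ s k o a x m → s * (k * o) + s * (k * a) + x + s * (k * m) ≡ s * (k * (o + (a + m))) + x
        lem = solve-∀

-- The offline optimum

all⁻ : {A : Set} (P : A → Bool) (xs : List A) → all P xs ≡ true → ∀ {x} → x ∈ xs → P x ≡ true
all⁻ P (y ∷ xs) e m with P y in ey
all⁻ P (y ∷ xs) e (here refl) | true = ey
all⁻ P (y ∷ xs) e (there m)   | true = all⁻ P xs e m

all⁺ : {A : Set} (P : A → Bool) (xs : List A) → (∀ x → P x ≡ true) → all P xs ≡ true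
all⁺ P [] h = refl
all⁺ P (x ∷ xs) h rewrite h x = all⁺ P xs h

validᵇ-sound : (p : Part n w) → validᵇ p ≡ true → Valid p
validᵇ-sound p e i = ≡ᵇ-sound _ _ (all⁻ (λ i → length (chunk p i) ≡ᵇ 2 ^ toℕ i) (allFin _) e (∈-allFin i))

validᵇ-complete : (p : Part n w) → Valid p → validᵇ p ≡ true
validᵇ-complete p v = all⁺ (λ i → length (chunk p i) ≡ᵇ 2 ^ toℕ i) (allFin _) (λ i → ≡ᵇ-complete (v i))

allValidᵇ-sound : (qs : List (Part n w)) → allValidᵇ qs ≡ true → AllValid qs
allValidᵇ-sound [] _ = _
allValidᵇ-sound (q ∷ qs) e with validᵇ q in eq
... | true = validᵇ-sound q eq , allValidᵇ-sound qs e

allValidᵇ-replicate : ∀ m (p : Part n w) → Valid p → allValidᵇ (replicate m p) ≡ true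
allValidᵇ-replicate zero    p v = refl
allValidᵇ-replicate (suc m) p v rewrite validᵇ-complete p v = allValidᵇ-replicate m p v

∈-allVec : (v : Vec (Fin w) n) → v ∈ allVec n
∈-allVec []      = here refl
∈-allVec {n = suc n} (i ∷ v) = ∈-concatMap⁺ (λ i → map (i ∷_) (allVec n)) (lose (∈-allFin i) (∈-map⁺ (i ∷_) (∈-allVec v)))

∈-allSeqs : ∀ m (p : Part n w) → replicate m p ∈ allSeqs m
∈-allSeqs zero    p = here refl
∈-allSeqs {n} (suc m) p = ∈-concatMap⁺ (λ q → map (q ∷_) (allSeqs m)) (lose (∈-allVec p) (∈-map⁺ (p ∷_) (∈-allSeqs m p)))

allSeqs-length : ∀ m {qs : List (Part n w)} → qs ∈ allSeqs m → length qs ≡ m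
allSeqs-length zero (here refl) = refl
allSeqs-length {n} (suc m) i with find (∈-concatMap⁻ (λ q → map (q ∷_) (allSeqs m)) {xs = allVec n} i)
... | q , _ , j with ∈-map⁻ (q ∷_) j
...   | qs , k , refl = cong suc (allSeqs-length m k)

OPT-attained : (p : Part n w) → Valid p → (Rs : List (Subset n))
  → ∃[ qs ] AllValid qs × length qs ≡ length Rs × OPT p Rs ≡ offCost p Rs qs
OPT-attained {n} {w} p v Rs = go candidates refl
  where
  candidates : List (List (Part n w))
  candidates = filterᵇ allValidᵇ (allSeqs (length Rs))
  go : ∀ cs → candidates ≡ cs → ∃[ qs ] AllValid qs × length qs ≡ length Rs × minList (map (offCost p Rs) cs) ≡ offCost p Rs qs
  -- Staying at `p` throughout is always a candidate, so the default `0` of `minList` never passes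
  -- for an optimum.
  go [] e with () ← subst (replicate (length Rs) p ∈_) e
                      (∈-filter⁺ (T? ∘ allValidᵇ) (∈-allSeqs (length Rs) p) (≡⇒T (allValidᵇ-replicate (length Rs) p v)))
  go (c ∷ cs) e with minList-attained (offCost p Rs) c cs
  ... | qs , m , eq with ∈-filter⁻ (T? ∘ allValidᵇ) {xs = allSeqs (length Rs)} (subst (qs ∈_) (sym e) m)
  ...   | i , t = qs , allValidᵇ-sound qs (T⇒≡ t) , allSeqs-length (length Rs) i , eq

-- Needed because `2 ^ κ` must be of order `r` from both sides: large enough for `κ-large`, small
-- enough to keep the ratio quadratic.
2^-round : ∀ r → 1 ≤ r → ∃[ e ] r ≤ 2 ^ e × 2 ^ e ≤ 2 * r
2^-round (suc zero) _ = 0 , ≤-refl , s≤s z≤n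
2^-round (suc r@(suc _)) _ with 2^-round r (s≤s z≤n)
... | e , lo , hi with suc r ≤? 2 ^ e
...   | yes h = e , h , ≤-trans hi (*-monoʳ-≤ 2 (n≤1+n r))
...   | no  h = suc e , ≤-trans (s≤s lo) (+-mono-≤ (m^n>0 2 e) (m≤m+n (2 ^ e) 0)) , *-monoʳ-≤ 2 (≤-trans (≤-pred (≰⇒> h)) (n≤1+n r))

-- From the amortised bound to competitiveness

module _ {n w : ℕ} (r κ γ β K : ℕ) (γ≡ : γ ≡ 5 + 4 * r) (β≡ : β ≡ 2 * γ + 4) (4≤κ : 4 ≤ κ) (κ-large : β * 136 ≤ 2 ^ κ)
         (access≤K : γ * 2 ^ κ ≤ K) (move≤K : β * 5 * 2 ^ κ ≤ K) (p₀ : Part n w) (valid₀ : Valid p₀) where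

  open Competition {n} {w} r κ γ β γ≡ β≡ 4≤κ κ-large p₀ valid₀
  open Amortisation {n} {w} r κ γ β γ≡ β≡ 4≤κ κ-large p₀ valid₀

  -- Cost and optimum of the same run are combined into one integrand `F`, whose mean is at most the
  -- initial potential. This is `0`, so no additive constant remains; linearity then separates the
  -- two expectations.
  competitive : (tbx tbz : TieBreak n w) (adv : Adversary n r) (m : ℕ)
    → E-LMA tbx tbz adv m p₀ ℚ.≤ ℕtoℚ K ℚ.* E-OPT tbx tbz adv m p₀
  competitive tbx tbz adv m = ℚP.*-cancelˡ-≤-pos (ℕtoℚ S) {{S>0}} (begin
    ℕtoℚ S ℚ.* lma                                    ≡⟨ undo (ℕtoℚ S ℚ.* lma) (ℕtoℚ (S * K) ℚ.* opt) ⟨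
    ℕtoℚ S ℚ.* lma ℚ.- ℕtoℚ (S * K) ℚ.* opt ℚ.+ ℕtoℚ (S * K) ℚ.* opt
                                                      ≤⟨ ℚP.+-monoˡ-≤ (ℕtoℚ (S * K) ℚ.* opt) nonpos ⟩
    0ℚ ℚ.+ ℕtoℚ (S * K) ℚ.* opt                       ≡⟨ ℚP.+-identityˡ _ ⟩
    ℕtoℚ (S * K) ℚ.* opt                              ≡⟨ trans (cong (ℚ._* opt) (ι-* S K)) (ℚP.*-assoc (ℕtoℚ S) (ℕtoℚ K) opt) ⟩
    ℕtoℚ S ℚ.* (ℕtoℚ K ℚ.* opt)                       ∎)
    where
    open ℚP.≤-Reasoning
    lma = E-LMA tbx tbz adv m p₀
    opt = E-OPT tbx tbz adv m p₀
    S>0 : ℚ.Positive (ℕtoℚ S)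
    S>0 = ℚP.normalize-pos S 1 {{_}} {{m^n≢0 8 κ}}
    undo : ∀ x y → x ℚ.- y ℚ.+ y ≡ x
    undo x y = trans (ℚP.+-assoc x (ℚ.- y) y) (trans (cong (x ℚ.+_) (ℚP.+-inverseˡ y)) (ℚP.+-identityʳ x))
    F : ℕ × List (Subset n) → ℚ
    F o = ℕtoℚ S ℚ.* ℕtoℚ (proj₁ o) ℚ.+ (ℚ.- ℕtoℚ (S * K)) ℚ.* ℕtoℚ (OPT p₀ (proj₂ o))
    g₀ : Ghost
    g₀ i = fresh (toℕ i)
    EF : E (run tbx tbz adv m (initState p₀) []) F ≡ ℕtoℚ S ℚ.* lma ℚ.- ℕtoℚ (S * K) ℚ.* opt
    EF = trans (E-linear (run tbx tbz adv m (initState p₀) []) _ _ (ℕtoℚ S) (ℚ.- ℕtoℚ (S * K)))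
               (cong (ℕtoℚ S ℚ.* lma ℚ.+_) (sym (ℚP.neg-distribˡ-* (ℕtoℚ (S * K)) opt)))
    hF : ∀ o → F o ≡ ℕtoℚ (S * (0 + proj₁ o)) ℚ.- ℕtoℚ (S * (K * OPT p₀ (proj₂ o)))
    hF o = cong₂ ℚ._+_ (sym (ι-* S (proj₁ o)))
      (trans (sym (ℚP.neg-distribˡ-* (ℕtoℚ (S * K)) (ℕtoℚ (OPT p₀ (proj₂ o)))))
        (cong ℚ.-_ (trans (sym (ι-* (S * K) (OPT p₀ (proj₂ o)))) (cong ℕtoℚ (*-assoc S K (OPT p₀ (proj₂ o)))))))
    Φ-fresh : S * 0 + 0 + Φ p₀ (State.budget (initState p₀)) g₀ p₀ ≡ 0
    Φ-fresh = cong₂ _+_ (cong (_+ 0) (*-zeroʳ S)) (cong₂ _+_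
      (trans (cong (S *_) (∑-zero (λ z → trans (φ-near (lev p₀ z) _ (m≤m+n (lev p₀ z) κ)) (cong (4 *_) (lookup-replicate z 0))))) (*-zeroʳ S))
      (∑-zero (λ (i : Fin w) → Ψ-fresh (toℕ i))))
    bound : E (run tbx tbz adv m (initState p₀) []) F ℚ.+ ℕtoℚ 0 ℚ.≤ ℕtoℚ (0 + Γ∑ g₀)
    bound = E-run tbx tbz adv K access≤K move≤K m ⊤ (λ _ → p₀) (λ _ → valid₀) (λ _ → 0) (OPT p₀) F 0 0 0 p₀
      (State.budget (initState p₀)) g₀ [] valid₀ (λ i → fresh-consistent (toℕ i))
      (λ z → ≤-trans (≤-reflexive (lookup-replicate z 0)) z≤n)
      (λ _ → ≤-trans (≤-reflexive Φ-fresh) z≤n)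
      (λ Rs len → tt , rival Rs len) hF
      where
      rival : ∀ Rs → length Rs ≡ m → ∃[ qs ] AllValid qs × length qs ≡ m × OPT p₀ Rs ≡ 0 + offCost p₀ Rs qs
      rival Rs len with OPT-attained p₀ valid₀ Rs
      ... | qs , vqs , lqs , eq = qs , vqs , trans lqs len , eq
    nonpos : ℕtoℚ S ℚ.* lma ℚ.- ℕtoℚ (S * K) ℚ.* opt ℚ.≤ 0ℚ
    nonpos = begin
      ℕtoℚ S ℚ.* lma ℚ.- ℕtoℚ (S * K) ℚ.* opt                      ≡⟨ EF ⟨
      E (run tbx tbz adv m (initState p₀) []) F                    ≡⟨ ℚP.+-identityʳ _ ⟨
      E (run tbx tbz adv m (initState p₀) []) F ℚ.+ 0ℚ             ≤⟨ bound ⟩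
      ℕtoℚ (Γ∑ g₀)                                                 ≡⟨ cong ℕtoℚ (∑-zero (λ (i : Fin w) → Γ-fresh (toℕ i))) ⟩
      0ℚ                                                           ∎

-- Opaque, since unfolding the resulting constant in unary is expensive.
opaque
  κ₀ : ℕ
  κ₀ = 12

  4≤κ₀ : 4 ≤ κ₀
  4≤κ₀ = ≤ᵇ⇒≤ 4 12 tt

  κ₀-large : 22 * 136 ≤ 2 ^ κ₀
  κ₀-large = ≤ᵇ⇒≤ (22 * 136) (2 ^ 12) tt

theorem2 : ∃[ C ] ((r : ℕ) → 1 ≤ r → (w : ℕ) → (p₀ : Part (2 ^ w ∸ 1) w) → Valid p₀
    → (tbx tbz : TieBreak (2 ^ w ∸ 1) w) → (adv : Adversary (2 ^ w ∸ 1) r) → (m : ℕ)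
    → E-LMA tbx tbz adv m p₀ ℚ.≤ ℕtoℚ (C * r * r) ℚ.* E-OPT tbx tbz adv m p₀)
-- `220` is `22 * 5 * 2`, from `β ≤ r * 22`, the `5` of `Φ-move` and `2 ^ e ≤ 2 * r`.
theorem2 = 2 ^ κ₀ * 220 , bound
  where
  bound : (r : ℕ) → 1 ≤ r → (w : ℕ) → (p₀ : Part (2 ^ w ∸ 1) w) → Valid p₀
    → (tbx tbz : TieBreak (2 ^ w ∸ 1) w) → (adv : Adversary (2 ^ w ∸ 1) r) → (m : ℕ)
    → E-LMA tbx tbz adv m p₀ ℚ.≤ ℕtoℚ (2 ^ κ₀ * 220 * r * r) ℚ.* E-OPT tbx tbz adv m p₀
  bound r 1≤r w p₀ valid₀ = competitive r κ γ β (2 ^ κ₀ * 220 * r * r) refl refl (≤-trans 4≤κ₀ (m≤m+n κ₀ e)) κ-large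
                              (≤-trans (*-monoˡ-≤ (2 ^ κ) γ≤) move≤) move≤ p₀ valid₀
    where
    open ≤-Reasoning
    e = proj₁ (2^-round r 1≤r)
    κ = κ₀ + e
    γ = 5 + 4 * r
    β = 2 * γ + 4
    2^κ : 2 ^ κ ≡ 2 ^ κ₀ * 2 ^ e
    2^κ = ^-distribˡ-+-* 2 κ₀ e
    β≤ : β ≤ r * 22
    β≤ = ≤-trans (≤-reflexive (lem r)) (≤-trans (+-monoˡ-≤ (r * 8) (*-monoˡ-≤ 14 1≤r)) (≤-reflexive (sym (*-distribˡ-+ r 14 8))))
      where
      lem : ∀ r → 2 * (5 + 4 * r) + 4 ≡ 14 + r * 8
      lem = solve-∀
    κ-large : β * 136 ≤ 2 ^ κ
    κ-large = begin
      β * 136            ≤⟨ *-monoˡ-≤ 136 β≤ ⟩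
      r * 22 * 136       ≡⟨ *-assoc r 22 136 ⟩
      r * (22 * 136)     ≤⟨ *-mono-≤ (proj₁ (proj₂ (2^-round r 1≤r))) κ₀-large ⟩
      2 ^ e * 2 ^ κ₀     ≡⟨ trans (*-comm (2 ^ e) (2 ^ κ₀)) (sym 2^κ) ⟩
      2 ^ κ              ∎
    γ≤ : γ ≤ β * 5
    γ≤ = ≤-trans (≤-trans (m≤n*m γ 2) (m≤m+n (2 * γ) 4)) (m≤m*n β 5)
    move≤ : β * 5 * 2 ^ κ ≤ 2 ^ κ₀ * 220 * r * r
    move≤ = begin
      β * 5 * 2 ^ κ                        ≡⟨ cong (β * 5 *_) 2^κ ⟩
      β * 5 * (2 ^ κ₀ * 2 ^ e)             ≤⟨ *-mono-≤ (*-monoˡ-≤ 5 β≤) (*-monoʳ-≤ (2 ^ κ₀) (proj₂ (proj₂ (2^-round r 1≤r)))) ⟩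
      r * 22 * 5 * (2 ^ κ₀ * (2 * r))      ≡⟨ lem r 22 5 (2 ^ κ₀) 2 ⟩
      2 ^ κ₀ * (22 * 5 * 2) * r * r        ∎
      where
      lem : ∀ r a b c d → r * a * b * (c * (d * r)) ≡ c * (a * b * d) * r * r
      lem = solve-∀
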